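{- Let $W$ be a Coxeter group which avoids all triangle groups in $\mathcal{T} = \{(2,b,c) : b,c \geq 3,\ b < \infty\}$. Let $w\in W$ be $2$-palindromic and fix a Grassmannian factorization $w=uv$ with respect to $J\subseteq S$. Then $w=uv$ is a BP-decomposition with respect to $J$, and $|\operatorname{supp}(v)|\leq 3$. Moreover, if $|\operatorname{supp}(v)| = 3$, then the three elements of $\operatorname{supp}(v)$ can be named $r,s,t$ so that one of the following holds: (1) $v = t r v'$ with $v' = stst\cdots$ (alternating word of length $m_{st}-1$), where $m_{rt}=3$, $3\leq m_{st}<\infty$ and $3\leq m_{rs}\leq \infty$; (2) $v = rstr v'$ with $v' = stst\cdots$ (alternating word of length $m_{st}-1$), where $m_{rs}=m_{rt}=3$ and $3<m_{st}<\infty$; (3) $v = strstr\cdots$ is a spiral word (a word cycling through $s,t,r$ in this fixed order) of even length, where $m_{rs}=m_{rt}=m_{st}=3$.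
   Context: $(W,S)$ is a Coxeter group with finite generating set $S$, Coxeter exponents $m_{st}$, length $\ell$, Bruhat order $\leq$. For $K\subseteq S$, $W_K$ is the standard parabolic subgroup generated by $K$ and $W^K$ the set of minimal length representatives of the cosets $W_K\backslash W$; every $w$ factors uniquely as $w=uv$ with $u\in W_K$, $v\in W^K$, $\ell(w)=\ell(u)+\ell(v)$ (the parabolic decomposition with respect to $K$). It is a BP-decomposition if $u$ is the unique maximal element of $\{x\le w\}\cap W_K$. $\operatorname{supp}(w)=\{x\le w : \ell(x)=1\}$ (the simple reflections appearing in a reduced word of $w$) and $\operatorname{pred}(w)=\{x\le w:\ell(x)=\ell(w)-1\}$. A Grassmannian factorization of $w$ is a parabolic decomposition $w=uv$ with respect to $J$ such that $J=\operatorname{supp}(u)$ and $|\operatorname{supp}(w)|=|\operatorname{supp}(u)|+1$. With $P_w(q)=\sum_{x\le w}q^{\ell(x)}=\sum a_iq^i$, $w$ is $k$-palindromic if $a_i=a_{\ell(w)-i}$ for $0\le i<k$. $W$ avoids the triangle $(a,b,c)$ if there are no distinct $r,s,t\in S$ with $(m_{rs},m_{rt},m_{st})=(a,b,c)$. -}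

module Defs where

open import Data.Nat using (ℕ; zero; suc; _+_; _∸_; _≤_; _<_)
open import Data.Fin using (Fin)
open import Data.Fin.Subset using (Subset; _∈_; ∣_∣)
open import Data.List using (List; []; _∷_; _++_; length; reverse)
open import Data.List.Relation.Unary.All using (All)
open import Data.List.Relation.Unary.Any using (Any)
open import Data.List.Relation.Unary.AllPairs using (AllPairs)
open import Data.Product using (Σ; _×_; ∃; ∃-syntax)
open import Data.Sum using (_⊎_)
open import Data.Unit using (⊤)
open import Relation.Nullary using (¬_)
open import Relation.Binary.PropositionalEquality using (_≡_; _≢_)

data ℕ∞ : Set where
  fin : ℕ → ℕ∞
  ∞   : ℕ∞

_≤∞_ : ℕ → ℕ∞ → Set
k ≤∞ fin m = k ≤ m
k ≤∞ ∞     = ⊤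

record CoxeterMatrix (n : ℕ) : Set where
  field
    m       : Fin n → Fin n → ℕ∞
    m-diag  : ∀ s → m s s ≡ fin 1
    m-sym   : ∀ s t → m s t ≡ m t s
    m-off   : ∀ s t → s ≢ t → 2 ≤∞ m s t

alt : ∀ {n} → Fin n → Fin n → ℕ → List (Fin n)
alt s t zero    = []
alt s t (suc k) = s ∷ alt t s k

spiral : ∀ {n} → Fin n → Fin n → Fin n → ℕ → List (Fin n)
spiral s t r zero    = []
spiral s t r (suc k) = s ∷ spiral t r s k

-- The Coxeter group W given by the presentation ⟨ S | s² = 1, braid relations ⟩.
-- Elements of W are words in S taken up to the congruence _≈_.

module Coxeter {n : ℕ} (M : CoxeterMatrix n) where
  open CoxeterMatrix M

  Word : Set
  Word = List (Fin n)

  -- defining relations (as monoid relations; the monoid so presented is W)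
  data Rel : Word → Word → Set where
    invol : ∀ s → Rel (s ∷ s ∷ []) []
    braid : ∀ s t k → m s t ≡ fin k → Rel (alt s t k) (alt t s k)

  infix 4 _≈_
  data _≈_ : Word → Word → Set where
    rel    : ∀ p q a b → Rel a b → (p ++ a ++ q) ≈ (p ++ b ++ q)
    ≈-refl  : ∀ {x} → x ≈ x
    ≈-sym   : ∀ {x y} → x ≈ y → y ≈ x
    ≈-trans : ∀ {x y z} → x ≈ y → y ≈ z → x ≈ z

  Len : Word → ℕ → Set
  Len x k = Σ Word λ y → (y ≈ x) × (length y ≡ k) × (∀ z → z ≈ x → k ≤ length z)

  _ℓ<_ : Word → Word → Set
  x ℓ< y = ∀ a b → Len x a → Len y b → a < b

  -- reflections: conjugates p s p⁻¹ of simple reflections (p⁻¹ = reverse p)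
  reflection : Word → Fin n → Word
  reflection p s = p ++ s ∷ reverse p

  BruhatStep : Word → Word → Set
  BruhatStep x y = ∃[ p ] ∃[ s ] (y ≈ x ++ reflection p s) × (x ℓ< y)

  infix 4 _≤B_
  data _≤B_ : Word → Word → Set where
    ≤B-refl : ∀ {x y} → x ≈ y → x ≤B y
    ≤B-step : ∀ {x y z} → x ≤B y → BruhatStep y z → x ≤B z

  InSupp : Word → Fin n → Set
  InSupp w s = (s ∷ []) ≤B w

  SuppIs : Word → Subset n → Set
  SuppIs w A = ∀ s → (s ∈ A → InSupp w s) × (InSupp w s → s ∈ A)

  InParabolic : Subset n → Word → Set
  InParabolic K x = Σ Word λ y → (y ≈ x) × All (_∈ K) y

  MinRep : Subset n → Word → Set
  MinRep K v = ∀ x → InParabolic K x → ∀ a b → Len v a → Len (x ++ v) b → a ≤ b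

  ParabolicDecomp : Subset n → Word → Word → Word → Set
  ParabolicDecomp K w u v =
    (w ≈ u ++ v) × InParabolic K u × MinRep K v ×
    (∀ a b c → Len w a → Len u b → Len v c → a ≡ b + c)

  MaximalIn : Subset n → Word → Word → Set
  MaximalIn K w x = (x ≤B w) × InParabolic K x ×
    (∀ y → y ≤B w → InParabolic K y → x ≤B y → y ≈ x)

  BPDecomp : Subset n → Word → Word → Word → Set
  BPDecomp K w u v = ParabolicDecomp K w u v × MaximalIn K w u ×
    (∀ x → MaximalIn K w x → x ≈ u)

  GrassmannianFact : Subset n → Word → Word → Word → Set
  GrassmannianFact J w u v = ParabolicDecomp J w u v × SuppIs u J ×
    (Σ (Subset n) λ A → SuppIs w A × (∣ A ∣ ≡ ∣ J ∣ + 1))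

  -- a_i = c, where P_w(q) = Σ_{x ≤ w} q^{ℓ(x)} = Σ a_i q^i :
  -- a list of c pairwise distinct elements exhausting {x ≤ w : ℓ(x) = i}
  Coeff : Word → ℕ → ℕ → Set
  Coeff w i c = Σ (List Word) λ L → (length L ≡ c) ×
    AllPairs (λ x y → ¬ (x ≈ y)) L ×
    All (λ x → (x ≤B w) × Len x i) L ×
    (∀ x → x ≤B w → Len x i → Any (x ≈_) L)

  -- k-palindromic: a_i = a_{ℓ(w)-i} for 0 ≤ i < k
  -- (for i > ℓ(w) both sides are 0, so only i ≤ ℓ(w) needs a condition)
  Palindromic : ℕ → Word → Set
  Palindromic k w = ∀ L → Len w L → ∀ i → i < k → i ≤ L →
    ∃[ c ] Coeff w i c × Coeff w (L ∸ i) c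

  AvoidsTriangle : ℕ∞ → ℕ∞ → ℕ∞ → Set
  AvoidsTriangle a b c = ¬ (∃[ r ] ∃[ s ] ∃[ t ] (r ≢ s) × (r ≢ t) × (s ≢ t) ×
    (m r s ≡ a) × (m r t ≡ b) × (m s t ≡ c))

  AvoidsT : Set
  AvoidsT = ∀ b c → 3 ≤ b → 3 ≤∞ c → AvoidsTriangle (fin 2) (fin b) c

  Case1 : Word → Fin n → Fin n → Fin n → Set
  Case1 v r s t = (m r t ≡ fin 3) × (3 ≤∞ m r s) ×
    (∃[ b ] (m s t ≡ fin b) × (3 ≤ b) × (v ≈ t ∷ r ∷ alt s t (b ∸ 1)))

  Case2 : Word → Fin n → Fin n → Fin n → Set
  Case2 v r s t = (m r s ≡ fin 3) × (m r t ≡ fin 3) ×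
    (∃[ b ] (m s t ≡ fin b) × (3 < b) × (v ≈ r ∷ s ∷ t ∷ r ∷ alt s t (b ∸ 1)))

  Case3 : Word → Fin n → Fin n → Fin n → Set
  Case3 v r s t = (m r s ≡ fin 3) × (m r t ≡ fin 3) × (m s t ≡ fin 3) ×
    (∃[ k ] (v ≈ spiral s t r (k + k)))

{-# OPTIONS --safe #-}

-- The coatoms of w = uv are the elements u′v and uv′ of length ℓ(w) − 1.  Since |pred(u)| ≥ |supp(u)| and
-- |pred(w)| = |supp(u)| + 1, no deletion in v except that of its last letter leaves a reduced product uv′; in
-- particular v has a single coatom among the minimal coset representatives W^J.  Write v = zd with d the longest
-- alternating tail in the last two letters p, q.  Comparing with the deletion of the first letter of d gives
-- zq = az for some a ∈ J ∩ D_R(u): geometrically, z is a gallery running along the wall of the simple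
-- reflection a, turning around one vertex of the wall after the other.  Avoidance of the triangles (2,b,c) makes
-- the letters p, q and the last letter c of z pairwise non-commuting, and in such a triangle an element that
-- is shortened by two generators cannot be shortened again by turning to the third one.  This rigidity shows that
-- z involves no further letter and that only the three listed shapes survive; in each of them one finds, for every
-- k ∈ supp(v) ∩ J, a deletion showing k ∈ D_R(u), which is the BP property by the lifting property.
--
-- That m(s,t) is the true order of st follows from the numbers game with values in functions on paths.  Reflection
-- counting modulo 2 then gives the exchange property, first up to double negation; this suffices to decide
-- descents, hence equality in W, and makes all later arguments constructive.

module Submission where

open import Defs
open import Data.Bool using (Bool; true; false; if_then_else_; not; _xor_)
open import Data.Bool.Properties using (not-involutive; xor-comm; xor-identityʳ) renaming (_≟_ to _≟ᵇ_)
open import Data.Empty using (⊥; ⊥-elim)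
open import Data.Fin using (Fin)
open import Data.Fin.Properties using (_≟_; any?; suc-injective)
open import Data.Integer as ℤ using (ℤ; 0ℤ; 1ℤ)
import Data.Integer.Properties as ℤ
open import Data.Integer.Tactic.RingSolver using (solve-∀)
open import Data.List using (List; []; _∷_; _++_; length; reverse; applyUpTo; applyDownFrom; map)
open import Data.List.Membership.Propositional.Properties using (∈-++⁺ʳ; ∈-++⁺ˡ)
open import Data.List.Properties using (++-assoc; ++-identityʳ; length-++; unfold-reverse; reverse-++; length-reverse; reverse-involutive; reverse-applyUpTo; ∷-injective; length-map)
open import Data.List.Relation.Binary.Pointwise as PW using (Pointwise; []; _∷_)
open import Data.List.Relation.Unary.All as All using (All; []; _∷_)
open import Data.List.Relation.Unary.All.Properties using (++⁺; ++⁻ˡ; ++⁻ʳ; map⁺)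
open import Data.List.Relation.Unary.AllPairs as AllPairs using (AllPairs; []; _∷_)
import Data.List.Relation.Unary.AllPairs.Properties as AllPairs
open import Data.List.Relation.Unary.Any as Any using (Any; here; there)
open import Data.Nat as ℕ using (ℕ; zero; suc; _+_; _≤_; _<_; z≤n; s≤s; _≡ᵇ_; pred; _∸_)
import Data.Nat.Properties as ℕ
open import Data.Product using (_×_; _,_; proj₁; proj₂; ∃-syntax)
open import Data.Sum using (_⊎_; inj₁; inj₂)
open import Data.Unit using (tt)
open import Relation.Binary.Bundles using (Setoid)
open import Relation.Binary.Definitions using (tri<; tri≈; tri>)
open import Relation.Binary.PropositionalEquality using (_≡_; _≢_; refl; sym; trans; cong; cong₂; subst; subst₂; module ≡-Reasoning; _≗_)
open import Relation.Nullary using (Dec; yes; no; ¬_; ¬?)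
open import Relation.Nullary.Decidable using (decidable-stable; _×-dec_; _⊎-dec_)

-- The coefficient hypothesis is spent entirely in `good`; from there on everything rests on one
-- dichotomy. By Deodhar's lemma (`RMin-or-shift`) a letter k that lengthens x in W^J either stays
-- there, kx in W^J, or slides through, kx = xa with a in J. Each coatom forbidden by `good`
-- therefore yields a sliding relation for some explicit word, and the classification follows such
-- relations and descent sets by induction on length. Chambers, walls and vertices are only a way of
-- reading these relations: a wall is a `Shift`, and turning around a vertex is one braid move.
--
-- For the order of st, the usual edge weight 2cos(π/m) would force real arithmetic. It is an
-- eigenvalue of the adjacency matrix of the path with m-1 vertices, and the matrix itself can serve
-- as the weight. All values stay integral, and the identities needed become polynomial identities
-- for one operator.
--
-- The statement about D_R(u) is carried along with the classification, because the same coatom that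
-- pins down a bond m(s,t) usually also exhibits the letter of J that has to shorten u.

-- Words modulo the relations, alternating words and the sign character.

module Words {n : ℕ} (M : CoxeterMatrix n) where
  open CoxeterMatrix M
  open Coxeter M

  ≡⇒≈ : ∀ {x y} → x ≡ y → x ≈ y
  ≡⇒≈ refl = ≈-refl

  ≈-setoid : Setoid _ _
  ≈-setoid = record
    { Carrier = Word
    ; _≈_ = _≈_
    ; isEquivalence = record { refl = ≈-refl ; sym = ≈-sym ; trans = ≈-trans }
    }

  module ≈-Reasoning where
    open import Relation.Binary.Reasoning.Setoid ≈-setoid public

  ≈-context : ∀ p q {x y} → x ≈ y → p ++ x ++ q ≈ p ++ y ++ q
  ≈-context p q (rel p′ q′ a b r) =
    subst₂ _≈_ (shift a) (shift b) (rel (p ++ p′) (q′ ++ q) a b r)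
    where
    shift : ∀ c → (p ++ p′) ++ c ++ q′ ++ q ≡ p ++ (p′ ++ c ++ q′) ++ q
    shift c = begin
      (p ++ p′) ++ c ++ q′ ++ q    ≡⟨ ++-assoc p p′ _ ⟩
      p ++ p′ ++ c ++ q′ ++ q      ≡⟨ cong (λ h → p ++ p′ ++ h) (++-assoc c q′ q) ⟨
      p ++ p′ ++ (c ++ q′) ++ q    ≡⟨ cong (p ++_) (++-assoc p′ (c ++ q′) q) ⟨
      p ++ (p′ ++ c ++ q′) ++ q    ∎
      where open ≡-Reasoning
  ≈-context p q ≈-refl = ≈-refl
  ≈-context p q (≈-sym e) = ≈-sym (≈-context p q e)
  ≈-context p q (≈-trans e f) = ≈-trans (≈-context p q e) (≈-context p q f)

  ++-congˡ : ∀ p {x y} → x ≈ y → p ++ x ≈ p ++ y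
  ++-congˡ p {x} {y} e =
    subst₂ _≈_ (cong (p ++_) (++-identityʳ x)) (cong (p ++_) (++-identityʳ y)) (≈-context p [] e)

  ++-congʳ : ∀ q {x y} → x ≈ y → x ++ q ≈ y ++ q
  ++-congʳ q e = ≈-context [] q e

  ++-cong : ∀ {x y z t} → x ≈ y → z ≈ t → x ++ z ≈ y ++ t
  ++-cong {y = y} {z} e f = ≈-trans (++-congʳ z e) (++-congˡ y f)

  ∷-cong : ∀ s {x y} → x ≈ y → s ∷ x ≈ s ∷ y
  ∷-cong s = ++-congˡ (s ∷ [])

  ss-cancel : ∀ s x → s ∷ s ∷ x ≈ x
  ss-cancel s x = rel [] x (s ∷ s ∷ []) [] (invol s)

  ∷-cancel : ∀ s {x y} → s ∷ x ≈ s ∷ y → x ≈ y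
  ∷-cancel s {x} {y} e = ≈-trans (≈-sym (ss-cancel s x)) (≈-trans (∷-cong s e) (ss-cancel s y))

  ∷-transpose : ∀ s {x y} → s ∷ x ≈ y → x ≈ s ∷ y
  ∷-transpose s {x} e = ≈-trans (≈-sym (ss-cancel s x)) (∷-cong s e)

  alt-braid : ∀ {s t k} → m s t ≡ fin k → ∀ x → alt s t k ++ x ≈ alt t s k ++ x
  alt-braid {s} {t} {k} e x = rel [] x (alt s t k) (alt t s k) (braid s t k e)

  reverse-∷ : ∀ (s : Fin n) x → reverse (s ∷ x) ≡ reverse x ++ s ∷ []
  reverse-∷ s x = unfold-reverse s x

  reverse-∷-++ : ∀ (s : Fin n) x y → reverse (s ∷ x) ++ y ≡ reverse x ++ s ∷ y
  reverse-∷-++ s x y = trans (cong (_++ y) (reverse-∷ s x)) (++-assoc (reverse x) (s ∷ []) y)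

  reverse-inverseˡ : ∀ x → reverse x ++ x ≈ []
  reverse-inverseˡ [] = ≈-refl
  reverse-inverseˡ (s ∷ x) = ≈-trans (≡⇒≈ (reverse-∷-++ s x (s ∷ x)))
    (≈-trans (++-congˡ (reverse x) (ss-cancel s x)) (reverse-inverseˡ x))

  reverse-inverseʳ : ∀ x → x ++ reverse x ≈ []
  reverse-inverseʳ x =
    subst (λ h → h ++ reverse x ≈ []) (reverse-involutive x) (reverse-inverseˡ (reverse x))

  ++-cancel : ∀ p {x y} → p ++ x ≈ p ++ y → x ≈ y
  ++-cancel [] e = e
  ++-cancel (s ∷ p) e = ++-cancel p (∷-cancel s e)

  ++-transposeˡ : ∀ p {x y} → p ++ x ≈ y → x ≈ reverse p ++ y
  ++-transposeˡ p {x} {y} e = ++-cancel p (≈-trans e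
    (≈-trans (++-congʳ y (≈-sym (reverse-inverseʳ p))) (≡⇒≈ (++-assoc p (reverse p) y))))

  ++-cancelʳ : ∀ p {x y} → x ++ p ≈ y ++ p → x ≈ y
  ++-cancelʳ p {x} {y} e = ≈-trans (≈-sym (undo x)) (≈-trans (++-congʳ (reverse p) e) (undo y))
    where
    undo : ∀ z → (z ++ p) ++ reverse p ≈ z
    undo z = ≈-trans (≡⇒≈ (++-assoc z p (reverse p)))
      (≈-trans (++-congˡ z (reverse-inverseʳ p)) (≡⇒≈ (++-identityʳ z)))

  ++-transposeʳ : ∀ p {x y} → x ++ p ≈ y → x ≈ y ++ reverse p
  ++-transposeʳ p {x} {y} e = ++-cancelʳ p (≈-trans e
    (≈-sym (≈-trans (≡⇒≈ (++-assoc y (reverse p) p))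
      (≈-trans (++-congˡ y (reverse-inverseˡ p)) (≡⇒≈ (++-identityʳ y))))))

  reverse-cong : ∀ {x y} → x ≈ y → reverse x ≈ reverse y
  reverse-cong {x} {y} e = ++-cancelʳ x
    (≈-trans (reverse-inverseˡ x)
      (≈-trans (≈-sym (reverse-inverseˡ y)) (++-congˡ (reverse y) (≈-sym e))))

  -- The letter that would prolong `alt s t k`; for positive k the last letter already present is
  -- `nth t s k`.
  nth : Fin n → Fin n → ℕ → Fin n
  nth s t zero = s
  nth s t (suc k) = nth t s k

  alt-snoc : ∀ s t k → alt s t (suc k) ≡ alt s t k ++ nth s t k ∷ []
  alt-snoc s t zero = refl
  alt-snoc s t (suc k) = cong (s ∷_) (alt-snoc t s k)

  length-alt : ∀ s t k → length (alt {n} s t k) ≡ k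
  length-alt s t zero = refl
  length-alt s t (suc k) = cong suc (length-alt t s k)

  reverse-alt : ∀ s t k → reverse (alt s t (suc k)) ≡ alt (nth s t k) (nth t s k) (suc k)
  reverse-alt s t zero = refl
  reverse-alt s t (suc k) = begin
    reverse (s ∷ alt t s (suc k))
      ≡⟨ reverse-∷ s (alt t s (suc k)) ⟩
    reverse (alt t s (suc k)) ++ s ∷ []
      ≡⟨ cong (_++ s ∷ []) (reverse-alt t s k) ⟩
    alt (nth t s k) (nth s t k) (suc k) ++ s ∷ []
      ≡⟨ cong (λ h → alt (nth t s k) (nth s t k) (suc k) ++ h ∷ []) (nth-nth t s k) ⟨
    alt (nth t s k) (nth s t k) (suc k) ++ nth (nth t s k) (nth s t k) (suc k) ∷ []
      ≡⟨ alt-snoc (nth t s k) (nth s t k) (suc k) ⟨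
    alt (nth t s k) (nth s t k) (suc (suc k)) ∎
    where
    open ≡-Reasoning
    nth-nth : ∀ a b k → nth (nth a b k) (nth b a k) (suc k) ≡ b
    nth-nth a b zero = refl
    nth-nth a b (suc k) = nth-nth a b k

  double : ℕ → ℕ
  double zero = zero
  double (suc k) = suc (suc (double k))

  double-+ : ∀ i j → double (i + j) ≡ double i + double j
  double-+ zero j = refl
  double-+ (suc i) j = cong (λ h → suc (suc h)) (double-+ i j)

  alt-double-snoc : ∀ (s t : Fin n) k → alt s t (double k) ++ s ∷ [] ≡ s ∷ alt t s (double k)
  alt-double-snoc s t zero = refl
  alt-double-snoc s t (suc k) = cong (λ h → s ∷ t ∷ h) (alt-double-snoc s t k)

  alt-++-reverse : ∀ (s t : Fin n) k → alt s t k ++ reverse (alt t s k) ≡ alt s t (double k)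
  alt-++-reverse s t zero = refl
  alt-++-reverse s t (suc k) = begin
    s ∷ alt t s k ++ reverse (t ∷ alt s t k)
      ≡⟨ cong (λ h → s ∷ alt t s k ++ h) (reverse-∷ t (alt s t k)) ⟩
    s ∷ alt t s k ++ reverse (alt s t k) ++ t ∷ []
      ≡⟨ cong (s ∷_) (++-assoc (alt t s k) (reverse (alt s t k)) (t ∷ [])) ⟨
    s ∷ (alt t s k ++ reverse (alt s t k)) ++ t ∷ []
      ≡⟨ cong (λ h → s ∷ h ++ t ∷ []) (alt-++-reverse t s k) ⟩
    s ∷ alt t s (double k) ++ t ∷ []
      ≡⟨ cong (s ∷_) (alt-double-snoc t s k) ⟩
    s ∷ t ∷ alt s t (double k) ∎
    where open ≡-Reasoning

  alt-double-++ : ∀ (s t : Fin n) j k → alt s t (double j + k) ≡ alt s t (double j) ++ alt s t k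
  alt-double-++ s t zero k = refl
  alt-double-++ s t (suc j) k = cong (λ h → s ∷ t ∷ h) (alt-double-++ s t j k)

  alt-double≈[] : ∀ {s t k} → m s t ≡ fin k → alt s t (double k) ≈ []
  alt-double≈[] {s} {t} {k} e = ≈-trans (≡⇒≈ (sym (alt-++-reverse s t k)))
    (≈-trans (alt-braid e (reverse (alt t s k))) (reverse-inverseʳ (alt t s k)))

  -- The sign character: a braid relation keeps the length and `s s` costs two. Padding both sides
  -- by even numbers expresses congruence modulo 2 and composes without case distinctions.
  length-parity : ∀ {x y} → x ≈ y → ∃[ i ] ∃[ j ] length x + double i ≡ length y + double j
  length-parity (rel p q a b r) = rel-parity r
    where
    len : ∀ c → length (p ++ c ++ q) ≡ length c + (length p + length q)
    len c = begin
      length (p ++ c ++ q)               ≡⟨ length-++ p ⟩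
      length p + length (c ++ q)         ≡⟨ cong (length p +_) (length-++ c) ⟩
      length p + (length c + length q)   ≡⟨ ℕ.+-assoc (length p) (length c) (length q) ⟨
      length p + length c + length q     ≡⟨ cong (_+ length q) (ℕ.+-comm (length p) (length c)) ⟩
      length c + length p + length q     ≡⟨ ℕ.+-assoc (length c) (length p) (length q) ⟩
      length c + (length p + length q)   ∎
      where open ≡-Reasoning
    rel-parity : ∀ {a b} → Rel a b →
      ∃[ i ] ∃[ j ] length (p ++ a ++ q) + double i ≡ length (p ++ b ++ q) + double j
    rel-parity (invol s) = 0 , 1 , (begin
      length (p ++ s ∷ s ∷ q) + 0         ≡⟨ ℕ.+-identityʳ _ ⟩
      length (p ++ s ∷ s ∷ q)             ≡⟨ len (s ∷ s ∷ []) ⟩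
      2 + (length p + length q)           ≡⟨ ℕ.+-comm 2 (length p + length q) ⟩
      length p + length q + 2             ≡⟨ cong (_+ 2) (len []) ⟨
      length (p ++ q) + 2                 ∎)
      where open ≡-Reasoning
    rel-parity (braid s t k e) = 0 , 0 , cong (_+ 0) (begin
      length (p ++ alt s t k ++ q)                    ≡⟨ len (alt s t k) ⟩
      length (alt s t k) + (length p + length q)      ≡⟨ cong (_+ (length p + length q)) (trans (length-alt s t k) (sym (length-alt t s k))) ⟩
      length (alt t s k) + (length p + length q)      ≡⟨ len (alt t s k) ⟨
      length (p ++ alt t s k ++ q)                    ∎)
      where open ≡-Reasoning
  length-parity ≈-refl = 0 , 0 , refl
  length-parity (≈-sym e) with length-parity e
  ... | i , j , eq = j , i , sym eq
  length-parity {x} {z} (≈-trans {y = y} e f) with length-parity e | length-parity f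
  ... | i , j , eq | i′ , j′ , eq′ = i + i′ , j + j′ , (begin
    length x + double (i + i′)          ≡⟨ cong (length x +_) (double-+ i i′) ⟩
    length x + (double i + double i′)   ≡⟨ ℕ.+-assoc (length x) _ _ ⟨
    length x + double i + double i′     ≡⟨ cong (_+ double i′) eq ⟩
    length y + double j + double i′     ≡⟨ swap (length y) (double j) (double i′) ⟩
    length y + double i′ + double j     ≡⟨ cong (_+ double j) eq′ ⟩
    length z + double j′ + double j     ≡⟨ swap (length z) (double j′) (double j) ⟩
    length z + double j + double j′     ≡⟨ ℕ.+-assoc (length z) _ _ ⟩
    length z + (double j + double j′)   ≡⟨ cong (length z +_) (double-+ j j′) ⟨
    length z + double (j + j′)          ∎)
    where
    open ≡-Reasoning
    swap : ∀ a b c → a + b + c ≡ a + c + b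
    swap a b c = trans (ℕ.+-assoc a b c) (trans (cong (a +_) (ℕ.+-comm b c)) (sym (ℕ.+-assoc a c b)))

  suc-length-≉ : ∀ {x y} → x ≈ y → length x ≢ suc (length y)
  suc-length-≉ {x} {y} e eq with length-parity e
  ... | i , j , p = odd≢even i j (ℕ.+-cancelˡ-≡ (length y) _ _ (begin
      length y + suc (double i)     ≡⟨ ℕ.+-suc (length y) (double i) ⟩
      suc (length y) + double i     ≡⟨ cong (_+ double i) eq ⟨
      length x + double i           ≡⟨ p ⟩
      length y + double j           ∎))
    where
    open ≡-Reasoning
    odd≢even : ∀ i j → suc (double i) ≢ double j
    odd≢even i zero ()
    odd≢even zero (suc j) ()
    odd≢even (suc i) (suc j) q = odd≢even i j (ℕ.suc-injective (ℕ.suc-injective q))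

-- Chebyshev polynomials in the adjacency operator of a path.

module PathAlgebra where

  Fun : Set
  Fun = ℕ → ℤ

  infixl 6 _⊕_
  _⊕_ : Fun → Fun → Fun
  (f ⊕ g) i = f i ℤ.+ g i

  ⊖_ : Fun → Fun
  (⊖ f) i = ℤ.- f i

  𝟘 : Fun
  𝟘 i = 0ℤ

  -- The path of `fin m` has the vertices 0, ..., m-2, so its last vertex p satisfies p + 1 = m - 1.
  atEnd : ℕ∞ → ℕ → Bool
  atEnd (fin m) p = suc p ≡ᵇ pred m
  atEnd ∞ p = false

  pos : ℕ∞ → ℕ → ℕ
  pos μ zero = 0
  pos μ (suc i) = if atEnd μ (pos μ i) then 0 else suc (pos μ i)

  left : ℕ → Fun → ℕ → ℤ
  left zero f i = 0ℤ
  left (suc _) f i = f (pred i)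

  -- ℕ is cut into consecutive paths of m-1 vertices (one infinite path if m = ∞);
  -- X is the adjacency operator, so that the (m-1)-st Chebyshev polynomial kills it.
  X : ℕ∞ → Fun → Fun
  X μ f i = left (pos μ i) f i ℤ.+ (if atEnd μ (pos μ i) then 0ℤ else f (suc i))

  -- This is U_{k-1}(X/2), with U the Chebyshev polynomials of the second kind. For k = m it is the
  -- characteristic polynomial of the path with m-1 vertices.
  cheb : ℕ∞ → ℕ → Fun → Fun
  cheb μ zero f = 𝟘
  cheb μ (suc zero) f = f
  cheb μ (suc (suc k)) f = X μ (cheb μ (suc k) f) ⊕ ⊖ cheb μ k f

  X-cong : ∀ μ {f g} → f ≗ g → X μ f ≗ X μ g
  X-cong μ {f} {g} e i = cong₂ ℤ._+_ (eqL (pos μ i)) (eqR (atEnd μ (pos μ i)))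
    where
    eqL : ∀ p → left p f i ≡ left p g i
    eqL zero = refl
    eqL (suc p) = e (pred i)
    eqR : ∀ b → (if b then 0ℤ else f (suc i)) ≡ (if b then 0ℤ else g (suc i))
    eqR true = refl
    eqR false = e (suc i)

  private
    interchange : ∀ a b c d → (a ℤ.+ b) ℤ.+ (c ℤ.+ d) ≡ (a ℤ.+ c) ℤ.+ (b ℤ.+ d)
    interchange = solve-∀

    neg-+ : ∀ a b → ℤ.- a ℤ.+ ℤ.- b ≡ ℤ.- (a ℤ.+ b)
    neg-+ = solve-∀

  X-⊕ : ∀ μ f g → X μ (f ⊕ g) ≗ X μ f ⊕ X μ g
  X-⊕ μ f g i = trans (cong₂ ℤ._+_ (eqL (pos μ i)) (eqR (atEnd μ (pos μ i))))
      (interchange (left (pos μ i) f i) (left (pos μ i) g i) _ _)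
    where
    eqL : ∀ p → left p (f ⊕ g) i ≡ left p f i ℤ.+ left p g i
    eqL zero = refl
    eqL (suc p) = refl
    eqR : ∀ b → (if b then 0ℤ else (f ⊕ g) (suc i)) ≡
      (if b then 0ℤ else f (suc i)) ℤ.+ (if b then 0ℤ else g (suc i))
    eqR true = refl
    eqR false = refl

  X-⊖ : ∀ μ f → X μ (⊖ f) ≗ ⊖ X μ f
  X-⊖ μ f i = trans (cong₂ ℤ._+_ (eqL (pos μ i)) (eqR (atEnd μ (pos μ i)))) (neg-+ (left (pos μ i) f i) _)
    where
    eqL : ∀ p → left p (⊖ f) i ≡ ℤ.- left p f i
    eqL zero = refl
    eqL (suc p) = refl
    eqR : ∀ b → (if b then 0ℤ else (⊖ f) (suc i)) ≡ ℤ.- (if b then 0ℤ else f (suc i))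
    eqR true = refl
    eqR false = refl

  X-𝟘 : ∀ μ → X μ 𝟘 ≗ 𝟘
  X-𝟘 μ i = cong₂ ℤ._+_ (eqL (pos μ i)) (eqR (atEnd μ (pos μ i)))
    where
    eqL : ∀ p → left p 𝟘 i ≡ 0ℤ
    eqL zero = refl
    eqL (suc p) = refl
    eqR : ∀ b → (if b then 0ℤ else 0ℤ) ≡ 0ℤ
    eqR true = refl
    eqR false = refl

  cheb-cong : ∀ μ k {f g} → f ≗ g → cheb μ k f ≗ cheb μ k g
  cheb-cong μ zero e i = refl
  cheb-cong μ (suc zero) e i = e i
  cheb-cong μ (suc (suc k)) e i =
    cong₂ (λ a b → a ℤ.+ ℤ.- b) (X-cong μ (cheb-cong μ (suc k) e) i) (cheb-cong μ k e i)

  X-⊕⊖ : ∀ μ f g → X μ (f ⊕ ⊖ g) ≗ X μ f ⊕ ⊖ X μ g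
  X-⊕⊖ μ f g i = trans (X-⊕ μ f (⊖ g) i) (cong (λ h → X μ f i ℤ.+ h) (X-⊖ μ g i))

  cheb-X : ∀ μ k f → cheb μ k (X μ f) ≗ X μ (cheb μ k f)
  cheb-X μ zero f i = sym (X-𝟘 μ i)
  cheb-X μ (suc zero) f i = refl
  cheb-X μ (suc (suc k)) f i = trans
    (cong₂ (λ a b → a ℤ.+ ℤ.- b) (X-cong μ (cheb-X μ (suc k) f) i) (cheb-X μ k f i))
    (sym (X-⊕⊖ μ (X μ (cheb μ (suc k) f)) (cheb μ k f) i))

  cheb-⊕⊖ : ∀ μ k f g → cheb μ k (f ⊕ ⊖ g) ≗ cheb μ k f ⊕ ⊖ cheb μ k g
  cheb-⊕⊖ μ zero f g i = refl
  cheb-⊕⊖ μ (suc zero) f g i = refl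
  cheb-⊕⊖ μ (suc (suc k)) f g i = trans
    (cong₂ (λ a b → a ℤ.+ ℤ.- b)
      (trans (X-cong μ (cheb-⊕⊖ μ (suc k) f g) i) (X-⊕⊖ μ (cheb μ (suc k) f) (cheb μ (suc k) g) i))
      (cheb-⊕⊖ μ k f g i))
    (rearrange (X μ (cheb μ (suc k) f) i) (X μ (cheb μ (suc k) g) i) (cheb μ k f i) (cheb μ k g i))
    where
    rearrange : ∀ a b c d → (a ℤ.+ ℤ.- b) ℤ.+ ℤ.- (c ℤ.+ ℤ.- d) ≡ (a ℤ.+ ℤ.- c) ℤ.+ ℤ.- (b ℤ.+ ℤ.- d)
    rearrange = solve-∀

  cheb-𝟘 : ∀ μ k → cheb μ k 𝟘 ≗ 𝟘
  cheb-𝟘 μ zero i = refl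
  cheb-𝟘 μ (suc zero) i = refl
  cheb-𝟘 μ (suc (suc k)) i = cong₂ (λ a b → a ℤ.+ ℤ.- b)
    (trans (X-cong μ (cheb-𝟘 μ (suc k)) i) (X-𝟘 μ i)) (cheb-𝟘 μ k i)

  cheb-cheb : ∀ μ j k f → cheb μ j (cheb μ k f) ≗ cheb μ k (cheb μ j f)
  cheb-cheb μ j zero f i = cheb-𝟘 μ j i
  cheb-cheb μ j (suc zero) f i = refl
  cheb-cheb μ j (suc (suc k)) f i = trans
    (cheb-⊕⊖ μ j (X μ (cheb μ (suc k) f)) (cheb μ k f) i)
    (cong₂ (λ a b → a ℤ.+ ℤ.- b)
      (trans (cheb-X μ j (cheb μ (suc k) f) i) (X-cong μ (cheb-cheb μ j (suc k) f) i))
      (cheb-cheb μ j k f i))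

  Inner : ℕ∞ → ℕ → Set
  Inner μ k = ∀ j → j < k → atEnd μ j ≡ false

  inner-pred : ∀ {μ k} → Inner μ (suc k) → Inner μ k
  inner-pred I j j<k = I j (ℕ.m<n⇒m<1+n j<k)

  pos-inner : ∀ {μ i k} → pos μ i ≡ 0 → Inner μ k → pos μ (i + k) ≡ k
  pos-inner {μ} {i} {zero} e I = trans (cong (pos μ) (ℕ.+-identityʳ i)) e
  pos-inner {μ} {i} {suc k} e I
    rewrite ℕ.+-suc i k | pos-inner {μ} {i} {k} e (inner-pred {μ} I) | I k ℕ.≤-refl = refl

  X-inner : ∀ {μ i k} f → pos μ i ≡ 0 → Inner μ k →
    X μ f (i + k) ≡ left k f (i + k) ℤ.+ (if atEnd μ k then 0ℤ else f (suc (i + k)))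
  X-inner {μ} {i} {k} f e I rewrite pos-inner {μ} {i} {k} e I = refl

  cheb-step : ∀ μ k f i → cheb μ (suc (suc k)) f i ≡ cheb μ (suc k) (X μ f) i ℤ.+ ℤ.- cheb μ k f i
  cheb-step μ k f i = cong (λ h → h ℤ.+ ℤ.- cheb μ k f i) (sym (cheb-X μ (suc k) f i))

  -- Seen from the first vertex of a path, `cheb` walks along it: in the recurrence the subtracted
  -- term cancels the left neighbour contributed by X. One step past the last vertex the walk reads
  -- 0, which is the point of `cheb-next`.
  cheb-start : ∀ {μ i k} f → pos μ i ≡ 0 → Inner μ k → cheb μ (suc k) f i ≡ f (i + k)
  cheb-next : ∀ {μ i} k f → pos μ i ≡ 0 → Inner μ k →
    cheb μ (suc (suc k)) f i ≡ (if atEnd μ k then 0ℤ else f (suc (i + k)))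

  cheb-start {μ} {i} {zero} f e I = cong f (sym (ℕ.+-identityʳ i))
  cheb-start {μ} {i} {suc k} f e I with cheb-next {μ} {i} k f e (inner-pred {μ} I)
  ... | h rewrite I k ℕ.≤-refl = trans h (cong f (sym (ℕ.+-suc i k)))

  cheb-next {μ} {i} zero f e I = trans (cheb-step μ 0 f i)
    (trans (cong (λ h → h ℤ.+ ℤ.- 0ℤ) (trans (cong (X μ f) (sym (ℕ.+-identityʳ i))) (X-inner {μ} {i} {0} f e I)))
      (simp _))
    where
    simp : ∀ a → (0ℤ ℤ.+ a) ℤ.+ ℤ.- 0ℤ ≡ a
    simp = solve-∀
  cheb-next {μ} {i} (suc k) f e I = trans (cheb-step μ (suc k) f i)
    (trans (cong₂ (λ a b → a ℤ.+ ℤ.- b)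
        (trans (cheb-start {μ} {i} {suc k} (X μ f) e I)
          (trans (X-inner {μ} {i} {suc k} f e I)
            (cong (λ h → f (pred h) ℤ.+ (if atEnd μ (suc k) then 0ℤ else f (suc (i + suc k)))) (ℕ.+-suc i k))))
        (cheb-start {μ} {i} {k} f e (inner-pred {μ} I)))
      (simp (f (i + k)) _))
    where
    simp : ∀ a b → (a ℤ.+ b) ℤ.+ ℤ.- a ≡ b
    simp = solve-∀

  start : ∀ μ i → ∃[ i₀ ] ∃[ p ] (i ≡ i₀ + p) × (pos μ i₀ ≡ 0) × Inner μ p × (pos μ i ≡ p)
  start μ zero = 0 , 0 , refl , refl , (λ j ()) , refl
  start μ (suc i) with start μ i
  ... | i₀ , p , e , e₀ , I , ep with atEnd μ p in eq
  ...   | true = suc i , 0 , sym (ℕ.+-identityʳ _) , posz , (λ j ()) , posz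
    where
    posz : pos μ (suc i) ≡ 0
    posz rewrite ep | eq = refl
  ...   | false = i₀ , suc p , trans (cong suc e) (sym (ℕ.+-suc i₀ p)) , e₀ , inner , poss
    where
    inner : Inner μ (suc p)
    inner j (s≤s j≤p) with ℕ.m≤n⇒m<n∨m≡n j≤p
    ... | inj₁ j<p = I j j<p
    ... | inj₂ refl = eq
    poss : pos μ (suc i) ≡ suc p
    poss rewrite ep | eq = refl

  ≡ᵇ-refl : ∀ k → (k ≡ᵇ k) ≡ true
  ≡ᵇ-refl zero = refl
  ≡ᵇ-refl (suc k) = ≡ᵇ-refl k

  <⇒≡ᵇ-false : ∀ {j k} → j < k → (j ≡ᵇ k) ≡ false
  <⇒≡ᵇ-false {zero} (s≤s _) = refl
  <⇒≡ᵇ-false {suc j} (s≤s p) = <⇒≡ᵇ-false p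

  inner-fin : ∀ {k j} → j ≤ k → Inner (fin (suc (suc k))) j
  inner-fin j≤k i i<j = <⇒≡ᵇ-false (ℕ.<-≤-trans i<j j≤k)

  -- The value at vertex p is read at the first vertex after applying `cheb (p+1)`. Polynomials in X
  -- commute, and at the first vertex `cheb m` already looks beyond the end.
  cheb-vanish : ∀ k f → cheb (fin (suc (suc k))) (suc (suc k)) f ≗ 𝟘
  cheb-vanish k f i with start (fin (suc (suc k))) i
  ... | i₀ , p , refl , e₀ , I , _ = begin
    cheb μ (suc (suc k)) f (i₀ + p)             ≡⟨ cheb-start {μ} {i₀} {p} (cheb μ (suc (suc k)) f) e₀ I ⟨
    cheb μ (suc p) (cheb μ (suc (suc k)) f) i₀  ≡⟨ cheb-cheb μ (suc p) (suc (suc k)) f i₀ ⟩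
    cheb μ (suc (suc k)) (cheb μ (suc p) f) i₀  ≡⟨ cheb-next {μ} {i₀} k (cheb μ (suc p) f) e₀ (inner-fin ℕ.≤-refl) ⟩
    (if atEnd μ k then 0ℤ else cheb μ (suc p) f (suc (i₀ + k)))
                                                ≡⟨ cong (λ b → if b then 0ℤ else cheb μ (suc p) f (suc (i₀ + k))) (≡ᵇ-refl k) ⟩
    0ℤ                                          ∎
    where
    open ≡-Reasoning
    μ = fin (suc (suc k))

  module Run (μ : ℕ∞) where
    -- Two nodes fire alternately, from α at the node that starts and β at the other. After k
    -- firings `next` and `last` are the values at the node whose turn it is and at the one fired
    -- before; the sums are the totals fired from each so far, which is what a third node receives.
    next last sumNext sumLast : ℕ → Fun → Fun → Fun
    next zero α β = α
    next (suc k) α β = last k α β ⊕ X μ (next k α β)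
    last zero α β = β
    last (suc k) α β = ⊖ next k α β
    sumNext zero α β = 𝟘
    sumNext (suc k) α β = sumLast k α β
    sumLast zero α β = 𝟘
    sumLast (suc k) α β = sumNext k α β ⊕ next k α β

    next-cheb : ∀ k α β → next k α β ≗ cheb μ (suc k) α ⊕ cheb μ k β
    next-cheb zero α β i = sym (ℤ.+-identityʳ (α i))
    next-cheb (suc zero) α β i = rearrange (β i) (X μ α i)
      where
      rearrange : ∀ b a → b ℤ.+ a ≡ (a ℤ.+ ℤ.- 0ℤ) ℤ.+ b
      rearrange = solve-∀
    next-cheb (suc (suc k)) α β i = trans
      (cong₂ (λ a b → ℤ.- a ℤ.+ b) (next-cheb k α β i)
        (trans (X-cong μ (next-cheb (suc k) α β) i) (X-⊕ μ (cheb μ (suc (suc k)) α) (cheb μ (suc k) β) i)))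
      (rearrange (cheb μ (suc k) α i) (cheb μ k β i) (X μ (cheb μ (suc (suc k)) α) i) (X μ (cheb μ (suc k) β) i))
      where
      rearrange : ∀ a b c d → ℤ.- (a ℤ.+ b) ℤ.+ (c ℤ.+ d) ≡ (c ℤ.+ ℤ.- a) ℤ.+ (d ℤ.+ ℤ.- b)
      rearrange = solve-∀

    -- Exchanging the starting node alters each total by a single `cheb μ k`, which disappears at k
    -- = m.
    sumNext-swap : ∀ k α β i → sumNext k α β i ℤ.+ cheb μ k β i ≡ sumLast k β α i
    sumLast-swap : ∀ k α β i → sumLast k α β i ≡ sumNext k β α i ℤ.+ cheb μ k α i
    sumNext-swap zero α β i = refl
    sumNext-swap (suc k) α β i = trans
      (cong (λ h → h ℤ.+ cheb μ (suc k) β i) (sumLast-swap k α β i))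
      (trans (rearrange (sumNext k β α i) (cheb μ k α i) (cheb μ (suc k) β i))
        (cong (λ h → sumNext k β α i ℤ.+ h) (sym (next-cheb k β α i))))
      where
      rearrange : ∀ a b c → (a ℤ.+ b) ℤ.+ c ≡ a ℤ.+ (c ℤ.+ b)
      rearrange = solve-∀
    sumLast-swap zero α β i = refl
    sumLast-swap (suc k) α β i = trans
      (cong (λ h → sumNext k α β i ℤ.+ h) (next-cheb k α β i))
      (trans (rearrange (sumNext k α β i) (cheb μ (suc k) α i) (cheb μ k β i))
        (cong (λ h → h ℤ.+ cheb μ (suc k) α i) (sumNext-swap k α β i)))
      where
      rearrange : ∀ a b c → a ℤ.+ (b ℤ.+ c) ≡ (a ℤ.+ c) ℤ.+ b
      rearrange = solve-∀

  module Vanish (k : ℕ) where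
    private
      μ = fin (suc (suc k))
      m = suc (suc k)
    open Run μ

    next-swap : ∀ α β → next m α β ≗ last m β α
    next-swap α β i = begin
      next m α β i
        ≡⟨ next-cheb m α β i ⟩
      (X μ (cheb μ m α) i ℤ.+ ℤ.- cheb μ (suc k) α i) ℤ.+ cheb μ m β i
        ≡⟨ cong₂ (λ a b → (a ℤ.+ ℤ.- cheb μ (suc k) α i) ℤ.+ b)
             (trans (X-cong μ (cheb-vanish k α) i) (X-𝟘 μ i)) (cheb-vanish k β i) ⟩
      (0ℤ ℤ.+ ℤ.- cheb μ (suc k) α i) ℤ.+ 0ℤ
        ≡⟨ simp (cheb μ (suc k) α i) ⟩
      ℤ.- (0ℤ ℤ.+ cheb μ (suc k) α i)
        ≡⟨ cong (λ h → ℤ.- (h ℤ.+ cheb μ (suc k) α i)) (cheb-vanish k β i) ⟨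
      ℤ.- (cheb μ m β i ℤ.+ cheb μ (suc k) α i)
        ≡⟨ cong ℤ.-_ (next-cheb (suc k) β α i) ⟨
      last m β α i ∎
      where
      open ≡-Reasoning
      simp : ∀ a → (0ℤ ℤ.+ ℤ.- a) ℤ.+ 0ℤ ≡ ℤ.- (0ℤ ℤ.+ a)
      simp = solve-∀

    sum-swap : ∀ α β → sumNext m α β ≗ sumLast m β α
    sum-swap α β i = trans (sym (ℤ.+-identityʳ _))
      (trans (cong (λ h → sumNext m α β i ℤ.+ h) (sym (cheb-vanish k β i))) (sumNext-swap m α β i))

-- The numbers game as a representation of W, and the order of st.

module Game {n : ℕ} (M : CoxeterMatrix n) where
  open CoxeterMatrix M
  open Coxeter M
  open Words M
  open PathAlgebra

  State : Set
  State = Fin n → Fun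

  _≐_ : State → State → Set
  σ ≐ τ = ∀ r → σ r ≗ τ r

  -- A move of Mozes' numbers game with operators as edge weights. In a braid relation only
  -- polynomials in the operator of that one bond are compared, so operators of different bonds may
  -- fail to commute.
  fire : Fin n → State → State
  fire s σ r with r ≟ s
  ... | yes _ = ⊖ σ s
  ... | no _ = σ r ⊕ X (m r s) (σ s)

  fire-same : ∀ s σ → fire s σ s ≗ ⊖ σ s
  fire-same s σ i with s ≟ s
  ... | yes _ = refl
  ... | no s≢s = ⊥-elim (s≢s refl)

  fire-other : ∀ {s r} σ → r ≢ s → fire s σ r ≗ σ r ⊕ X (m r s) (σ s)
  fire-other {s} {r} σ r≢s i with r ≟ s
  ... | yes e = ⊥-elim (r≢s e)
  ... | no _ = refl

  fire-cong : ∀ s {σ τ} → σ ≐ τ → fire s σ ≐ fire s τ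
  fire-cong s e r i with r ≟ s
  ... | yes _ = cong ℤ.-_ (e s i)
  ... | no _ = cong₂ ℤ._+_ (e r i) (X-cong (m r s) (e s) i)

  fire-fire : ∀ s σ → fire s (fire s σ) ≐ σ
  fire-fire s σ r i with r ≟ s
  ... | yes refl = trans (cong ℤ.-_ (fire-same s σ i)) (ℤ.neg-involutive (σ s i))
  ... | no r≢s = trans
    (cong₂ ℤ._+_ (fire-other σ r≢s i)
      (trans (X-cong (m r s) (fire-same s σ) i) (X-⊖ (m r s) (σ s) i)))
    (simp (σ r i) (X (m r s) (σ s) i))
    where
    simp : ∀ a b → (a ℤ.+ b) ℤ.+ ℤ.- b ≡ a
    simp = solve-∀

  act : Word → State → State
  act [] σ = σ
  act (s ∷ w) σ = act w (fire s σ)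

  act-cong : ∀ w {σ τ} → σ ≐ τ → act w σ ≐ act w τ
  act-cong [] e = e
  act-cong (s ∷ w) e = act-cong w (fire-cong s e)

  act-++ : ∀ x y σ → act (x ++ y) σ ≡ act y (act x σ)
  act-++ [] y σ = refl
  act-++ (s ∷ x) y σ = act-++ x y (fire s σ)

  nth-≢ : ∀ {s t : Fin n} k → s ≢ t → nth s t k ≢ nth t s k
  nth-≢ zero s≢t = s≢t
  nth-≢ (suc k) s≢t = nth-≢ k (λ e → s≢t (sym e))

  m-nth : ∀ s t k → m (nth s t k) (nth t s k) ≡ m s t
  m-nth s t zero = refl
  m-nth s t (suc k) = trans (m-nth t s k) (m-sym t s)

  ≢-nth : ∀ {r s t : Fin n} k → r ≢ s → r ≢ t → r ≢ nth s t k
  ≢-nth zero r≢s r≢t = r≢s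
  ≢-nth (suc k) r≢s r≢t = ≢-nth k r≢t r≢s

  module Alternate {s t : Fin n} (s≢t : s ≢ t) where
    open Run (m s t)

    record At (k : ℕ) (σ : State) : Set where
      field
        at-next : act (alt s t k) σ (nth s t k) ≗ next k (σ s) (σ t)
        at-last : act (alt s t k) σ (nth t s k) ≗ last k (σ s) (σ t)
        at-else : ∀ r → r ≢ s → r ≢ t → act (alt s t k) σ r ≗
          σ r ⊕ X (m r (nth s t k)) (sumNext k (σ s) (σ t)) ⊕ X (m r (nth t s k)) (sumLast k (σ s) (σ t))
    open At public

    act-alt-suc : ∀ k σ → act (alt s t (suc k)) σ ≡ fire (nth s t k) (act (alt s t k) σ)
    act-alt-suc k σ = trans (cong (λ w → act w σ) (alt-snoc s t k)) (act-++ (alt s t k) _ σ)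

    at : ∀ k σ → At k σ
    at zero σ = record
      { at-next = λ i → refl
      ; at-last = λ i → refl
      ; at-else = λ r _ _ i → sym (trans
          (cong₂ ℤ._+_ (cong (λ h → σ r i ℤ.+ h) (X-𝟘 (m r s) i)) (X-𝟘 (m r t) i))
          (simp (σ r i)))
      }
      where
      simp : ∀ a → (a ℤ.+ 0ℤ) ℤ.+ 0ℤ ≡ a
      simp = solve-∀
    at (suc k) σ = record
      { at-next = λ i → trans (step (nth t s k) i)
          (trans (fire-other τ (λ e → nth-≢ k s≢t (sym e)) i)
            (cong₂ ℤ._+_ (at-last h i)
              (trans (cong (λ μ → X μ (τ a) i) (trans (m-sym _ _) (m-nth s t k)))
                (X-cong (m s t) (at-next h) i))))
      ; at-last = λ i → trans (step a i) (trans (fire-same a τ i) (cong ℤ.-_ (at-next h i)))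
      ; at-else = λ r r≢s r≢t i → trans (step r i)
          (trans (fire-other τ (≢-nth k r≢s r≢t) i)
            (trans (cong₂ ℤ._+_ (at-else h r r≢s r≢t i) (X-cong (m r a) (at-next h) i))
              (trans (rearrange (σ r i) (X (m r a) (sumNext k (σ s) (σ t)) i) _ _)
                (cong (λ z → (σ r i ℤ.+ X (m r (nth t s k)) (sumLast k (σ s) (σ t)) i) ℤ.+ z)
                  (sym (X-⊕ (m r a) (sumNext k (σ s) (σ t)) (next k (σ s) (σ t)) i))))))
      }
      where
      a : Fin n
      a = nth s t k
      τ : State
      τ = act (alt s t k) σ
      h : At k σ
      h = at k σ
      step : ∀ r i → act (alt s t (suc k)) σ r i ≡ fire a τ r i
      step r i = cong (λ ρ → ρ r i) (act-alt-suc k σ)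
      rearrange : ∀ p x y z → ((p ℤ.+ x) ℤ.+ y) ℤ.+ z ≡ (p ℤ.+ y) ℤ.+ (x ℤ.+ z)
      rearrange = solve-∀

  nth-cover : ∀ (s t r : Fin n) k → (r ≡ nth s t k) ⊎ (r ≡ nth t s k) ⊎ (r ≢ s × r ≢ t)
  nth-cover s t r zero with r ≟ s | r ≟ t
  ... | yes e | _ = inj₁ e
  ... | no _ | yes e = inj₂ (inj₁ e)
  ... | no p | no q = inj₂ (inj₂ (p , q))
  nth-cover s t r (suc k) with nth-cover s t r k
  ... | inj₁ e = inj₂ (inj₁ e)
  ... | inj₂ (inj₁ e) = inj₁ e
  ... | inj₂ (inj₂ p) = inj₂ (inj₂ p)

  -- At s and t the two orders agree by `next-swap`; every other node has received the same totals
  -- from s and from t by `sum-swap`.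
  act-braid : ∀ s t k → m s t ≡ fin k → ∀ σ → act (alt s t k) σ ≐ act (alt t s k) σ
  act-braid s t k e σ with s ≟ t
  ... | yes refl = λ r i → refl
  ... | no s≢t = braid-off k e (subst (2 ≤∞_) e (m-off s t s≢t))
    where
    braid-off : ∀ k → m s t ≡ fin k → 2 ≤ k → act (alt s t k) σ ≐ act (alt t s k) σ
    braid-off (suc zero) e (s≤s ())
    braid-off (suc (suc k′)) e _ = eq
      where
      κ : ℕ
      κ = suc (suc k′)
      t≢s : t ≢ s
      t≢s p = s≢t (sym p)
      module S = Alternate s≢t
      module T = Alternate t≢s
      open Vanish k′
      e′ : m t s ≡ fin κ
      e′ = trans (m-sym t s) e
      hS : S.At κ σ
      hS = S.at κ σ
      hT : T.At κ σ
      hT = T.at κ σ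
      eq : act (alt s t κ) σ ≐ act (alt t s κ) σ
      eq r i with nth-cover s t r κ
      ... | inj₁ refl = trans (S.at-next hS i)
        (trans (cong (λ μ → Run.next μ κ (σ s) (σ t) i) e)
          (trans (next-swap (σ s) (σ t) i)
            (trans (cong (λ μ → Run.last μ κ (σ t) (σ s) i) (sym e′)) (sym (T.at-last hT i)))))
      ... | inj₂ (inj₁ refl) = trans (S.at-last hS i)
        (trans (cong (λ μ → Run.last μ κ (σ s) (σ t) i) e)
          (trans (sym (next-swap (σ t) (σ s) i))
            (trans (cong (λ μ → Run.next μ κ (σ t) (σ s) i) (sym e′)) (sym (T.at-next hT i)))))
      ... | inj₂ (inj₂ (r≢s , r≢t)) = trans (S.at-else hS r r≢s r≢t i)
        (trans (cong₂ (λ a b → (σ r i ℤ.+ a) ℤ.+ b)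
            (X-cong (m r (nth s t κ)) (λ j → trans (cong (λ μ → Run.sumNext μ κ (σ s) (σ t) j) e)
              (trans (sum-swap (σ s) (σ t) j) (cong (λ μ → Run.sumLast μ κ (σ t) (σ s) j) (sym e′)))) i)
            (X-cong (m r (nth t s κ)) (λ j → trans (cong (λ μ → Run.sumLast μ κ (σ s) (σ t) j) e)
              (trans (sym (sum-swap (σ t) (σ s) j)) (cong (λ μ → Run.sumNext μ κ (σ t) (σ s) j) (sym e′)))) i))
          (trans (rearrange (σ r i) _ _) (sym (T.at-else hT r r≢t r≢s i))))
        where
        rearrange : ∀ a b c → (a ℤ.+ b) ℤ.+ c ≡ (a ℤ.+ c) ℤ.+ b
        rearrange = solve-∀

  act-Rel : ∀ {a b} → Rel a b → ∀ σ → act a σ ≐ act b σ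
  act-Rel (invol s) σ = fire-fire s σ
  act-Rel (braid s t k e) σ = act-braid s t k e σ

  act-≈ : ∀ {x y} → x ≈ y → ∀ σ → act x σ ≐ act y σ
  act-≈ (rel p q a b r) σ
    rewrite act-++ p (a ++ q) σ | act-++ p (b ++ q) σ
          | act-++ a q (act p σ) | act-++ b q (act p σ) = act-cong q (act-Rel r (act p σ))
  act-≈ ≈-refl σ r i = refl
  act-≈ (≈-sym e) σ r i = sym (act-≈ e σ r i)
  act-≈ (≈-trans e f) σ r i = trans (act-≈ e σ r i) (act-≈ f σ r i)

  nth-double : ∀ (s t : Fin n) j → nth s t (double j) ≡ s
  nth-double s t zero = refl
  nth-double s t (suc j) = nth-double s t j

  -- Firing alternately from the values (0 at s, constant 1 at t): the vertex 0 of the path sees 1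
  -- at s before the m-th step, and -1 at t at the m-th step.
  alt-double-small : ∀ {s t} j → s ≢ t → 0 < j → double j ≤∞ m s t → ¬ alt s t (double j) ≈ []
  alt-double-small {s} {t} (suc j) s≢t _ bound e = distinguish (m s t) refl bound
    where
    open Alternate s≢t
    σ : State
    σ r i with r ≟ t
    ... | yes _ = 1ℤ
    ... | no _ = 0ℤ
    σs : σ s ≗ 𝟘
    σs i with s ≟ t
    ... | yes p = ⊥-elim (s≢t p)
    ... | no _ = refl
    σt : ∀ i → σ t i ≡ 1ℤ
    σt i with t ≟ t
    ... | yes _ = refl
    ... | no p = ⊥-elim (p refl)
    at-s : ∀ j → alt s t (double j) ≈ [] → Run.next (m s t) (double j) (σ s) (σ t) 0 ≡ 0ℤ
    at-s j e = trans (sym (at-next (at (double j) σ) 0))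
      (trans (cong (λ a → act (alt s t (double j)) σ a 0) (nth-double s t j))
        (trans (act-≈ e σ s 0) (σs 0)))
    at-t : ∀ j → alt s t (double j) ≈ [] → Run.last (m s t) (double j) (σ s) (σ t) 0 ≡ 1ℤ
    at-t j e = trans (sym (at-last (at (double j) σ) 0))
      (trans (cong (λ a → act (alt s t (double j)) σ a 0) (nth-double t s j))
        (trans (act-≈ e σ t 0) (σt 0)))
    value : ∀ μ k → Inner μ k → Run.next μ (suc k) (σ s) (σ t) 0 ≡ 1ℤ
    value μ k I = trans (Run.next-cheb μ (suc k) (σ s) (σ t) 0)
      (cong₂ ℤ._+_ (trans (cheb-cong μ (suc (suc k)) σs 0) (cheb-𝟘 μ (suc (suc k)) 0))
        (trans (cheb-start {μ} {0} {k} (σ t) refl I) (σt k)))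
    1≢0 : 1ℤ ≢ 0ℤ
    1≢0 ()
    -1≢1 : ℤ.- 1ℤ ≢ 1ℤ
    -1≢1 ()
    distinguish : ∀ μ → m s t ≡ μ → double (suc j) ≤∞ μ → ⊥
    distinguish ∞ eq _ = 1≢0 (trans (sym (value (m s t) (suc (double j)) inner)) (at-s (suc j) e))
      where
      inner : Inner (m s t) (suc (double j))
      inner i _ rewrite eq = refl
    distinguish (fin (suc (suc k))) eq (s≤s (s≤s 2j≤k)) with ℕ.m≤n⇒m<n∨m≡n 2j≤k
    ... | inj₁ 2j<k = 1≢0 (trans (sym (value (m s t) (suc (double j)) inner)) (at-s (suc j) e))
      where
      inner : Inner (m s t) (suc (double j))
      inner rewrite eq = inner-fin 2j<k
    ... | inj₂ refl = -1≢1 (trans (cong ℤ.-_ (sym (value (m s t) (double j) inner))) (at-t (suc j) e))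
      where
      inner : Inner (m s t) (double j)
      inner rewrite eq = inner-fin ℕ.≤-refl

  -- When 2j exceeds m, the relation (st)^m = 1 turns (st)^j = 1 into (st)^(m-j) = 1, where 2(m-j)
  -- is at most m and the game decides.
  alt-double≉[] : ∀ {s t} j → s ≢ t → 0 < j → suc j ≤∞ m s t → ¬ alt s t (double j) ≈ []
  alt-double≉[] {s} {t} j s≢t 0<j bound e with m s t in eq
  ... | ∞ = alt-double-small j s≢t 0<j (subst (double j ≤∞_) (sym eq) _) e
  ... | fin k with ℕ.≤-total (double j) k
  ...   | inj₁ 2j≤k = alt-double-small j s≢t 0<j (subst (double j ≤∞_) (sym eq) 2j≤k) e
  ...   | inj₂ k≤2j = alt-double-small (k ∸ j) s≢t (ℕ.m<n⇒0<n∸m bound)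
      (subst (double (k ∸ j) ≤∞_) (sym eq) small) rest
    where
    open ≡-Reasoning
    double≡ : ∀ i → double i ≡ i + i
    double≡ zero = refl
    double≡ (suc i) = cong suc (trans (cong suc (double≡ i)) (sym (ℕ.+-suc i i)))
    j+k-j : j + (k ∸ j) ≡ k
    j+k-j = ℕ.m+[n∸m]≡n (ℕ.<⇒≤ bound)
    small : double (k ∸ j) ≤ k
    small = subst₂ _≤_ (sym (double≡ (k ∸ j))) j+k-j
      (ℕ.+-monoˡ-≤ (k ∸ j) (ℕ.+-cancelˡ-≤ j (k ∸ j) j
        (subst₂ _≤_ (sym j+k-j) (double≡ j) k≤2j)))
    split : double k ≡ double j + double (k ∸ j)
    split = begin
      double k                        ≡⟨ cong double j+k-j ⟨
      double (j + (k ∸ j))            ≡⟨ double-+ j (k ∸ j) ⟩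
      double j + double (k ∸ j)       ∎
    rest : alt s t (double (k ∸ j)) ≈ []
    rest = ≈-trans (++-congʳ (alt s t (double (k ∸ j))) (≈-sym e))
      (≈-trans (≡⇒≈ (trans (sym (alt-double-++ s t j (double (k ∸ j)))) (cong (alt s t) (sym split))))
        (alt-double≈[] eq))

-- Reflections met by a word, counted modulo 2.

module Reflections {n : ℕ} (M : CoxeterMatrix n) where
  open CoxeterMatrix M
  open Coxeter M
  open Words M
  open Game M

  -- One reflection for each letter of x. For empty p, multiplying x on the left by the i-th of them
  -- deletes the i-th letter; p is the accumulated prefix.
  Φ : Word → Word → List Word
  Φ p [] = []
  Φ p (s ∷ x) = reflection p s ∷ Φ (p ++ s ∷ []) x

  Φ-++ : ∀ p x y → Φ p (x ++ y) ≡ Φ p x ++ Φ (p ++ x) y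
  Φ-++ p [] y = cong (λ h → Φ h y) (sym (++-identityʳ p))
  Φ-++ p (s ∷ x) y = cong (reflection p s ∷_)
    (trans (Φ-++ (p ++ s ∷ []) x y) (cong (λ h → Φ (p ++ s ∷ []) x ++ Φ h y) (++-assoc p (s ∷ []) x)))

  Φ-cong : ∀ {p p′} x → p ≈ p′ → Pointwise _≈_ (Φ p x) (Φ p′ x)
  Φ-cong [] e = []
  Φ-cong (s ∷ x) e = ++-cong e (∷-cong s (reverse-cong e)) ∷ Φ-cong x (++-congʳ (s ∷ []) e)

  Φ-any : ∀ {P : Word → Set} p x → Any P (Φ p x) →
    ∃[ a ] ∃[ b ] ∃[ c ] (x ≡ a ++ b ∷ c) × P (reflection (p ++ a) b)
  Φ-any {P} p (s ∷ x) (here h) = [] , s , x , refl ,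
    subst (λ q → P (reflection q s)) (sym (++-identityʳ p)) h
  Φ-any {P} p (s ∷ x) (there h) with Φ-any {P} (p ++ s ∷ []) x h
  ... | a , b , c , e , q = s ∷ a , b , c , cong (s ∷_) e ,
    subst (λ r → P (reflection r b)) (++-assoc p (s ∷ []) a) q

  -- A relation rather than a function, because equality in the group is not yet known to be decidable.
  data Count (t : Word) : List Word → Bool → Set where
    none : Count t [] false
    hit  : ∀ {x L b} → x ≈ t → Count t L b → Count t (x ∷ L) (not b)
    miss : ∀ {x L b} → ¬ x ≈ t → Count t L b → Count t (x ∷ L) b

  count-unique : ∀ {t L b b′} → Count t L b → Count t L b′ → b ≡ b′
  count-unique none none = refl
  count-unique (hit _ c) (hit _ c′) = cong not (count-unique c c′)
  count-unique (hit e _) (miss ¬e _) = ⊥-elim (¬e e)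
  count-unique (miss ¬e _) (hit e _) = ⊥-elim (¬e e)
  count-unique (miss _ c) (miss _ c′) = count-unique c c′

  ¬¬-dec : ∀ {A : Set} → ¬ ¬ Dec A
  ¬¬-dec k = k (no (λ a → k (yes a)))

  count-exists : ∀ t L → ¬ ¬ (∃[ b ] Count t L b)
  count-exists t [] k = k (false , none)
  count-exists t (x ∷ L) k = count-exists t L λ where
    (b , c) → ¬¬-dec λ where
      (yes e) → k (not b , hit e c)
      (no ¬e) → k (b , miss ¬e c)

  not-xor : ∀ a b → not a xor b ≡ not (a xor b)
  not-xor true b = sym (not-involutive b)
  not-xor false b = refl

  count-++⁻ : ∀ {t} L {L′ b} → Count t (L ++ L′) b →
    ∃[ b₁ ] ∃[ b₂ ] Count t L b₁ × Count t L′ b₂ × (b ≡ b₁ xor b₂)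
  count-++⁻ [] c = false , _ , none , c , refl
  count-++⁻ (x ∷ L) (hit e c) with count-++⁻ L c
  ... | b₁ , b₂ , c₁ , c₂ , eq = not b₁ , b₂ , hit e c₁ , c₂ , trans (cong not eq) (sym (not-xor b₁ b₂))
  count-++⁻ (x ∷ L) (miss e c) with count-++⁻ L c
  ... | b₁ , b₂ , c₁ , c₂ , eq = b₁ , b₂ , miss e c₁ , c₂ , eq

  count-++ : ∀ {t L L′ b b′} → Count t L b → Count t L′ b′ → Count t (L ++ L′) (b xor b′)
  count-++ none d = d
  count-++ {b′ = b′} (hit {b = b} e c) d = subst (Count _ _) (sym (not-xor b b′)) (hit e (count-++ c d))
  count-++ (miss e c) d = miss e (count-++ c d)

  count-pointwise : ∀ {t L L′ b} → Pointwise _≈_ L L′ → Count t L b → Count t L′ b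
  count-pointwise [] none = none
  count-pointwise (e ∷ es) (hit h c) = hit (≈-trans (≈-sym e) h) (count-pointwise es c)
  count-pointwise (e ∷ es) (miss h c) = miss (λ q → h (≈-trans e q)) (count-pointwise es c)

  count-reverse : ∀ {t} L {b} → Count t L b → Count t (reverse L) b
  count-reverse [] none = none
  count-reverse (x ∷ L) (hit {b = b} e c) = subst₂ (Count _) (sym (unfold-reverse x L))
    (xor-comm b true) (count-++ (count-reverse L c) (hit e none))
  count-reverse (x ∷ L) (miss {b = b} e c) = subst₂ (Count _) (sym (unfold-reverse x L))
    (xor-identityʳ b) (count-++ (count-reverse L c) (miss e none))

  count-absent : ∀ {t} L → ¬ Any (_≈ t) L → Count t L false
  count-absent [] _ = none
  count-absent (x ∷ L) ¬any = miss (λ e → ¬any (here e)) (count-absent L (λ a → ¬any (there a)))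

  count-odd : ∀ {t L b} → b ≡ true → Count t L b → Any (_≈ t) L
  count-odd _ (hit e c) = here e
  count-odd b (miss _ c) = there (count-odd b c)

  alt-palindrome : ∀ (s t : Fin n) i → reflection (alt s t i) (nth s t i) ≡ alt s t (suc (double i))
  alt-palindrome s t i = begin
    alt s t i ++ nth s t i ∷ reverse (alt s t i)
      ≡⟨ ++-assoc (alt s t i) (nth s t i ∷ []) (reverse (alt s t i)) ⟨
    (alt s t i ++ nth s t i ∷ []) ++ reverse (alt s t i)
      ≡⟨ cong (_++ reverse (alt s t i)) (alt-snoc s t i) ⟨
    s ∷ alt t s i ++ reverse (alt s t i)
      ≡⟨ cong (s ∷_) (alt-++-reverse t s i) ⟩
    s ∷ alt t s (double i) ∎
    where open ≡-Reasoning

  -- Odd alternating words are palindromes, so one side times the inverse of the other is the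
  -- alternating word (st)^(i+j+1) = (st)^m.
  alt-odd-braid : ∀ {s t} i j → m s t ≡ fin (suc (i + j)) →
    alt s t (suc (double i)) ≈ alt t s (suc (double j))
  alt-odd-braid {s} {t} i j e = ++-cancelʳ (reverse q) (≈-trans
    (≈-trans (≡⇒≈ product) (alt-double≈[] e)) (≈-sym (reverse-inverseʳ q)))
    where
    open ≡-Reasoning
    q : Word
    q = alt t s (suc (double j))
    product : alt s t (suc (double i)) ++ reverse q ≡ alt s t (double (suc (i + j)))
    product = begin
      alt s t (suc (double i)) ++ reverse q
        ≡⟨ cong (alt s t (suc (double i)) ++_) (reverse-alt t s (double j)) ⟩
      alt s t (suc (double i)) ++ alt (nth t s (double j)) (nth s t (double j)) (suc (double j))
        ≡⟨ cong₂ (λ a b → alt s t (suc (double i)) ++ alt a b (suc (double j))) (nth-double t s j) (nth-double s t j) ⟩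
      s ∷ alt t s (double i) ++ alt t s (suc (double j))
        ≡⟨ cong (s ∷_) (alt-double-++ t s i (suc (double j))) ⟨
      alt s t (suc (double i + suc (double j)))
        ≡⟨ cong (λ h → alt s t (suc h)) (trans (ℕ.+-suc (double i) (double j)) (cong suc (sym (double-+ i j)))) ⟩
      alt s t (double (suc (i + j))) ∎

  Φ-alt : ∀ p (s t : Fin n) i k → Pointwise _≈_ (Φ (p ++ alt s t i) (alt (nth s t i) (nth t s i) k))
    (applyUpTo (λ j → p ++ alt s t (suc (double (i + j))) ++ reverse p) k)
  Φ-alt p s t i zero = []
  Φ-alt p s t i (suc k) = ≡⇒≈ head ∷
    subst₂ (Pointwise _≈_)
      (cong (λ h → Φ h (alt (nth t s i) (nth s t i) k))
        (trans (cong (p ++_) (alt-snoc s t i)) (sym (++-assoc p (alt s t i) _))))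
      (cong-applyUpTo k (λ j → cong (λ h → p ++ alt s t (suc (double h)) ++ reverse p) (sym (ℕ.+-suc i j))))
      (Φ-alt p s t (suc i) k)
    where
    open ≡-Reasoning
    cong-applyUpTo : ∀ k {f g : ℕ → Word} → (∀ j → f j ≡ g j) → applyUpTo f k ≡ applyUpTo g k
    cong-applyUpTo zero e = refl
    cong-applyUpTo (suc k) e = cong₂ _∷_ (e 0) (cong-applyUpTo k (λ j → e (suc j)))
    head : reflection (p ++ alt s t i) (nth s t i) ≡ p ++ alt s t (suc (double (i + 0))) ++ reverse p
    head = begin
      (p ++ alt s t i) ++ nth s t i ∷ reverse (p ++ alt s t i)
        ≡⟨ cong (λ h → (p ++ alt s t i) ++ nth s t i ∷ h) (reverse-++ p (alt s t i)) ⟩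
      (p ++ alt s t i) ++ nth s t i ∷ reverse (alt s t i) ++ reverse p
        ≡⟨ ++-assoc p (alt s t i) _ ⟩
      p ++ alt s t i ++ nth s t i ∷ reverse (alt s t i) ++ reverse p
        ≡⟨ cong (p ++_) (++-assoc (alt s t i) (nth s t i ∷ reverse (alt s t i)) (reverse p)) ⟨
      p ++ reflection (alt s t i) (nth s t i) ++ reverse p
        ≡⟨ cong (λ h → p ++ h ++ reverse p) (alt-palindrome s t i) ⟩
      p ++ alt s t (suc (double i)) ++ reverse p
        ≡⟨ cong (λ h → p ++ alt s t (suc (double h)) ++ reverse p) (ℕ.+-identityʳ i) ⟨
      p ++ alt s t (suc (double (i + 0))) ++ reverse p ∎

  upTo-downFrom : ∀ {f g : ℕ → Word} i k → (∀ a b → suc (a + b) ≡ k → f (i + a) ≈ g b) →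
    Pointwise _≈_ (applyUpTo (λ a → f (i + a)) k) (applyDownFrom g k)
  upTo-downFrom i zero e = []
  upTo-downFrom {f} {g} i (suc k) e = e 0 k refl ∷
    PW.transitive ≈-trans (≡-pointwise k) (upTo-downFrom {f} {g} (suc i) k
      (λ a b eq → ≈-trans (≡⇒≈ (cong f (sym (ℕ.+-suc i a)))) (e (suc a) b (cong suc eq))))
    where
    ≡-pointwise : ∀ k → Pointwise _≈_ (applyUpTo (λ a → f (i + suc a)) k) (applyUpTo (λ a → f (suc i + a)) k)
    ≡-pointwise k = up k (λ a → ≡⇒≈ (cong f (ℕ.+-suc i a)))
      where
      up : ∀ k {f g : ℕ → Word} → (∀ a → f a ≈ g a) → Pointwise _≈_ (applyUpTo f k) (applyUpTo g k)
      up zero e = []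
      up (suc k) e = e 0 ∷ up k (λ a → e (suc a))

  -- The two sides of a braid relation meet the same m reflections of the dihedral group in opposite
  -- orders, so no parity changes.
  Φ-braid : ∀ {s t k} p → m s t ≡ fin k → Pointwise _≈_ (Φ p (alt s t k)) (reverse (applyUpTo (λ j → p ++ alt t s (suc (double j)) ++ reverse p) k))
  Φ-braid {s} {t} {k} p e = PW.transitive ≈-trans
    (subst (λ h → Pointwise _≈_ (Φ h (alt s t k)) (applyUpTo (λ j → p ++ alt s t (suc (double j)) ++ reverse p) k))
      (++-identityʳ p) (Φ-alt p s t 0 k))
    (subst (Pointwise _≈_ _) (sym (reverse-applyUpTo _ k))
      (upTo-downFrom 0 k (λ a b eq → ≈-context p (reverse p)
        (alt-odd-braid a b (trans e (cong fin (sym eq)))))))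

  reflection-snoc : ∀ p s → reflection p s ≈ reflection (p ++ s ∷ []) s
  reflection-snoc p s = ≈-sym (≈-trans
    (≡⇒≈ (trans (++-assoc p (s ∷ []) _) (cong (λ h → p ++ s ∷ s ∷ h) (reverse-++ p (s ∷ [])))))
    (++-congˡ p (ss-cancel s (s ∷ reverse p))))

  count-Rel : ∀ {a b} p → Rel a b → ∀ {t c c′} → Count t (Φ p a) c → Count t (Φ p b) c′ → c ≡ c′
  count-Rel p (invol s) (hit _ (hit _ none)) none = refl
  count-Rel p (invol s) (hit e (miss ¬e none)) none = ⊥-elim (¬e (≈-trans (≈-sym (reflection-snoc p s)) e))
  count-Rel p (invol s) (miss ¬e (hit e none)) none = ⊥-elim (¬e (≈-trans (reflection-snoc p s) e))
  count-Rel p (invol s) (miss _ (miss _ none)) none = refl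
  count-Rel p (braid s t k e) c c′ = count-unique
    (subst (λ L → Count _ L _) (reverse-involutive _) (count-reverse _ (count-pointwise (Φ-braid p e) c)))
    (count-pointwise (subst (λ h → Pointwise _≈_ (Φ h (alt t s k)) (applyUpTo (λ j → p ++ alt t s (suc (double j)) ++ reverse p) k))
      (++-identityʳ p) (Φ-alt p t s 0 k)) c′)

  count-≈ : ∀ {x y} → x ≈ y → ∀ {t b b′} → Count t (Φ [] x) b → Count t (Φ [] y) b′ → b ≡ b′
  count-≈ (rel p q a b r) {t} c c′
    with count-++⁻ (Φ [] p) (subst (λ L → Count t L _) (Φ-++ [] p (a ++ q)) c)
       | count-++⁻ (Φ [] p) (subst (λ L → Count t L _) (Φ-++ [] p (b ++ q)) c′)
  ... | _ , _ , p₁ , aq , refl | _ , _ , p₂ , bq , refl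
    with count-++⁻ (Φ p a) (subst (λ L → Count t L _) (Φ-++ p a q) aq)
       | count-++⁻ (Φ p b) (subst (λ L → Count t L _) (Φ-++ p b q) bq)
  ... | _ , _ , a₁ , q₁ , refl | _ , _ , b₁ , q₂ , refl =
    cong₂ _xor_ (count-unique p₁ p₂)
      (cong₂ _xor_ (count-Rel p r a₁ b₁)
        (count-unique (count-pointwise (Φ-cong q (++-congˡ p a≈b)) q₁) q₂))
    where
    a≈b : a ≈ b
    a≈b = subst₂ _≈_ (++-identityʳ a) (++-identityʳ b) (rel [] [] a b r)
  count-≈ ≈-refl c c′ = count-unique c c′
  count-≈ (≈-sym e) c c′ = sym (count-≈ e c′ c)
  -- A count for the intermediate word `y` is available only up to double negation; equality of
  -- Booleans is stable, so that is enough.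
  count-≈ (≈-trans {y = y} e f) {t} {b} {b′} c c′ = decidable-stable (b ≟ᵇ b′) λ ¬eq →
    count-exists t (Φ [] y) λ where (_ , d) → ¬eq (trans (count-≈ e c d) (count-≈ f d c′))

++-split : ∀ {A : Set} (a : List A) {b c} p {q} → a ++ b ∷ c ≡ p ++ q →
  (∃[ c′ ] (p ≡ a ++ b ∷ c′) × (c ≡ c′ ++ q)) ⊎ (∃[ a′ ] (a ≡ p ++ a′) × (q ≡ a′ ++ b ∷ c))
++-split a [] e = inj₂ (a , refl , sym e)
++-split [] (x ∷ p) refl = inj₁ (p , refl , refl)
++-split (y ∷ a) (x ∷ p) e with ∷-injective e
... | refl , e′ with ++-split a p e′
...   | inj₁ (c′ , refl , eq) = inj₁ (c′ , refl , eq)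
...   | inj₂ (a′ , refl , eq) = inj₂ (a′ , refl , eq)

-- The exchange property up to double negation, and the word problem.

module Decidability {n : ℕ} (M : CoxeterMatrix n) where
  open CoxeterMatrix M
  open Coxeter M
  open Words M
  open Game M
  open Reflections M

  Red : Word → Set
  Red x = ∀ z → z ≈ x → length x ≤ length z

  LD : Fin n → Word → Set
  LD s x = ∃[ y ] (x ≈ s ∷ y) × (suc (length y) ≡ length x)

  red-≈ : ∀ {x y} → x ≈ y → length y ≡ length x → Red x → Red y
  red-≈ e len R z z≈y = subst (_≤ length z) (sym len) (R z (≈-trans z≈y (≈-sym e)))

  red-suffix : ∀ p {y} → Red (p ++ y) → Red y
  red-suffix p {y} R z z≈y = ℕ.+-cancelˡ-≤ (length p) (length y) (length z)
    (subst₂ _≤_ (length-++ p) (length-++ p) (R (p ++ z) (++-congˡ p z≈y)))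

  red-prefix : ∀ {y} q → Red (y ++ q) → Red y
  red-prefix {y} q R z z≈y = ℕ.+-cancelʳ-≤ (length q) (length y) (length z)
    (subst₂ _≤_ (length-++ y) (length-++ z) (R (z ++ q) (++-congʳ q z≈y)))

  reflection-delete : ∀ a b c {t} → reflection a b ≈ t → t ++ a ++ b ∷ c ≈ a ++ c
  reflection-delete a b c {t} e = begin
    t ++ a ++ b ∷ c                              ≈⟨ ++-congʳ (a ++ b ∷ c) e ⟨
    (a ++ b ∷ reverse a) ++ a ++ b ∷ c           ≡⟨ ++-assoc a (b ∷ reverse a) (a ++ b ∷ c) ⟩
    a ++ b ∷ reverse a ++ a ++ b ∷ c             ≡⟨ cong (λ h → a ++ b ∷ h) (++-assoc (reverse a) a (b ∷ c)) ⟨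
    a ++ b ∷ (reverse a ++ a) ++ b ∷ c           ≈⟨ ++-congˡ a (∷-cong b (++-congʳ (b ∷ c) (reverse-inverseˡ a))) ⟩
    a ++ b ∷ b ∷ c                               ≈⟨ ++-congˡ a (ss-cancel b c) ⟩
    a ++ c                                       ∎
    where open ≈-Reasoning

  length-delete : ∀ (a : Word) b c → length (a ++ b ∷ c) ≡ suc (length (a ++ c))
  length-delete a b c = trans (length-++ a)
    (trans (ℕ.+-suc (length a) (length c)) (cong suc (sym (length-++ a))))

  -- In the reduced word s y the reflection s is met by the first letter and by no other, since
  -- another occurrence would allow a deletion below the length of x. Its odd count is transported
  -- to the word x, where it must occur.
  exchange-¬¬ : ∀ {s x} → Red x → LD s x →
    ¬ ¬ (∃[ a ] ∃[ b ] ∃[ c ] (x ≡ a ++ b ∷ c) × reflection a b ≈ s ∷ [])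
  exchange-¬¬ {s} {x} R (y , x≈sy , len) k = count-exists (s ∷ []) (Φ [] x) λ where
      (b , c) → k (Φ-any [] x (count-odd (sym (count-≈ (≈-sym x≈sy) once c)) c))
    where
    absent : ¬ Any (_≈ s ∷ []) (Φ (s ∷ []) y)
    absent h with Φ-any (s ∷ []) y h
    ... | a , b , c , refl , e = ℕ.<⇒≱ shorter (R (a ++ c) (≈-sym (≈-trans x≈sy sy≈ac)))
      where
      e′ : reflection a b ≈ s ∷ []
      e′ = ++-cancelʳ (s ∷ []) (∷-cancel s (≈-trans
        (≡⇒≈ (cong (s ∷_) (trans (++-assoc a _ _) (cong (λ h → a ++ b ∷ h) (sym (reverse-∷ s a))))))
        (≈-trans e (≈-sym (ss-cancel s (s ∷ []))))))
      sy≈ac : s ∷ a ++ b ∷ c ≈ a ++ c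
      sy≈ac = reflection-delete a b c e′
      shorter : length (a ++ c) < length x
      shorter = subst (length (a ++ c) <_) len
        (s≤s (subst (length (a ++ c) ≤_) (sym (length-delete a b c)) (ℕ.n≤1+n _)))
    once : Count (s ∷ []) (Φ [] (s ∷ y)) true
    once = hit ≈-refl (count-absent _ absent)

  alt-prefix : ∀ (s t : Fin n) k a {b c} → alt s t k ≡ a ++ b ∷ c →
    (a ≡ alt s t (length a)) × (b ≡ nth s t (length a)) × (length a < k)
  alt-prefix s t (suc k) [] refl = refl , refl , s≤s z≤n
  alt-prefix s t (suc k) (x ∷ a) e with ∷-injective e
  ... | refl , e′ with alt-prefix t s k a e′
  ...   | p , q , r = cong (s ∷_) p , q , s≤s r

  ≤∞-trans : ∀ {i j} μ → i ≤ j → j ≤∞ μ → i ≤∞ μ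
  ≤∞-trans (fin k) p q = ℕ.≤-trans p q
  ≤∞-trans ∞ p q = tt

  -- Given a prefix alternating from t, exchange for s deletes one letter. A deletion inside the
  -- prefix would make a power of st below the m-th trivial; so the deleted letter lies behind the
  -- prefix, and the prefix grows by s.
  dihedral-¬¬ : ∀ {s t x} → Red x → s ≢ t → LD s x → LD t x → ∀ j → j ≤∞ m s t →
    ¬ ¬ (∃[ z ] (x ≈ alt s t j ++ z) × (j + length z ≡ length x))
  dihedral-¬¬ {x = x} R s≢t ds dt zero _ k = k (x , ≈-refl , refl)
  dihedral-¬¬ R s≢t (y , e , len) dt (suc zero) _ k = k (y , e , len)
  dihedral-¬¬ {s} {t} {x} R s≢t ds@(y , x≈sy , len) dt (suc (suc j)) bound k =
    dihedral-¬¬ R (λ e → s≢t (sym e)) dt ds (suc j)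
      (subst (suc j ≤∞_) (m-sym s t) (≤∞-trans (m s t) (ℕ.n≤1+n _) bound)) λ where
        (z , x≈Xz , lenX) → exchange-¬¬ {s} {alt t s (suc j) ++ z}
          (red-≈ x≈Xz (lenXz z lenX) R)
          (y , ≈-trans (≈-sym x≈Xz) x≈sy , trans len (sym (lenXz z lenX)))
          (finish z x≈Xz lenX)
    where
    lenXz : ∀ z → suc j + length z ≡ length x → length (alt t s (suc j) ++ z) ≡ length x
    lenXz z e = trans (length-++ (alt t s (suc j))) (trans (cong (_+ length z) (length-alt t s (suc j))) e)
    finish : ∀ z → x ≈ alt t s (suc j) ++ z → suc j + length z ≡ length x →
      ¬ (∃[ a ] ∃[ b ] ∃[ c ] (alt t s (suc j) ++ z ≡ a ++ b ∷ c) × reflection a b ≈ s ∷ [])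
    finish z x≈Xz lenX (a , b , c , eq , e) with ++-split a (alt t s (suc j)) (sym eq)
    ... | inj₁ (c′ , eq′ , _) with alt-prefix t s (suc j) a eq′
    ...   | pa , pb , i<1+j = alt-double≉[] (suc (length a)) s≢t (s≤s z≤n)
      (≤∞-trans (m s t) (s≤s i<1+j) bound) (begin
        s ∷ alt t s (suc (double (length a)))
          ≡⟨ cong (s ∷_) (alt-palindrome t s (length a)) ⟨
        s ∷ reflection (alt t s (length a)) (nth t s (length a))
          ≡⟨ cong₂ (λ u v → s ∷ reflection u v) pa pb ⟨
        s ∷ reflection a b
          ≈⟨ ∷-cong s e ⟩
        s ∷ s ∷ []
          ≈⟨ ss-cancel s [] ⟩
        [] ∎)
      where open ≈-Reasoning
    finish z x≈Xz lenX (a , b , c , eq , e) | inj₂ (a′ , refl , refl) = k (a′ ++ c ,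
      (begin
        x
          ≈⟨ ss-cancel s x ⟨
        s ∷ s ∷ x
          ≈⟨ ∷-cong s (∷-cong s x≈Xz) ⟩
        s ∷ s ∷ alt t s (suc j) ++ a′ ++ b ∷ c
          ≡⟨ cong (λ h → s ∷ s ∷ h) eq ⟩
        s ∷ s ∷ (alt t s (suc j) ++ a′) ++ b ∷ c
          ≈⟨ ∷-cong s (reflection-delete (alt t s (suc j) ++ a′) b c e) ⟩
        s ∷ (alt t s (suc j) ++ a′) ++ c
          ≡⟨ cong (s ∷_) (++-assoc (alt t s (suc j)) a′ c) ⟩
        s ∷ alt t s (suc j) ++ a′ ++ c ∎) ,
      trans (cong suc (sym (trans (cong (j +_) (length-delete a′ b c)) (ℕ.+-suc j _)))) lenX)
      where open ≈-Reasoning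

  Strip : ℕ → Fin n → Fin n → Word → Set
  Strip j s t y = ∃[ z ] (y ≈ alt s t j ++ z) × (j + length z ≡ length y)

  strip? : ∀ f → (∀ y → length y ≤ f → Red y → ∀ s → Dec (LD s y)) →
    ∀ j s t y → length y ≤ f → Red y → Dec (Strip j s t y)
  strip? f d zero s t y _ R = yes (y , ≈-refl , refl)
  strip? f d (suc j) s t y y≤f R with d y y≤f R s
  ... | no ¬ld = no λ where
    (z , e , len) → ¬ld (alt t s j ++ z , e ,
      trans (cong suc (trans (length-++ (alt t s j)) (cong (_+ length z) (length-alt t s j)))) len)
  ... | yes (y′ , e , len) with strip? f d j t s y′
        (ℕ.≤-trans (ℕ.n≤1+n _) (subst (_≤ f) (sym len) y≤f)) (red-suffix (s ∷ []) (red-≈ e len R))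
  ...   | yes (z , e′ , len′) = yes (z , ≈-trans e (∷-cong s e′) , trans (cong suc len′) len)
  ...   | no ¬st = no λ where
    (z , e′ , len′) → ¬st (z , ∷-cancel s (≈-trans (≈-sym e) e′) ,
      ℕ.suc-injective (trans len′ (sym len)))

  -- For s different from the first letter t, s is a descent exactly if the word starts with the
  -- full alternating word of length m(s,t). That is a search over shorter words; the converse
  -- implication only has to refute a failed search, where double negation does no harm.
  descent? : ∀ f y → length y ≤ f → Red y → ∀ s → Dec (LD s y)
  descent? f [] _ R s = no λ where (_ , _ , ())
  descent? (suc f) x@(t ∷ y) (s≤s y≤f) R s with s ≟ t
  ... | yes refl = yes (y , ≈-refl , refl)
  ... | no s≢t with m t s in eq
  ...   | ∞ = no λ ld → dihedral-¬¬ R (λ e → s≢t (sym e)) (y , ≈-refl , refl) ld (suc (length x))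
              (subst (suc (length x) ≤∞_) (sym eq) tt)
              λ where (z , _ , len) → ℕ.1+n≰n (ℕ.≤-trans (ℕ.m≤m+n _ (length z)) (ℕ.≤-reflexive len))
  ...   | fin zero = ⊥-elim (off (subst (2 ≤∞_) eq (m-off t s (λ e → s≢t (sym e)))))
    where
    off : ¬ 2 ≤ 0
    off ()
  ...   | fin (suc k) with strip? f (descent? f) k s t y y≤f (red-suffix (t ∷ []) R)
  ...     | yes (z , e , len) = yes (alt t s k ++ z , ≈-trans (∷-cong t e) (alt-braid eq z) ,
              cong suc (trans (length-++ (alt t s k)) (trans (cong (_+ length z) (length-alt t s k)) len)))
  ...     | no ¬st = no λ ld → dihedral-¬¬ R (λ e → s≢t (sym e)) (y , ≈-refl , refl) ld (suc k)
              (subst (suc k ≤∞_) (sym eq) ℕ.≤-refl)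
              λ where (z , e , len) → ¬st (z , ∷-cancel t e , ℕ.suc-injective len)

  abstract
    reduce : ∀ x → ∃[ y ] (y ≈ x) × Red y
    reduce [] = [] , ≈-refl , λ _ _ → z≤n
    reduce (s ∷ x) with reduce x
    ... | r , r≈x , R with descent? (length r) r ℕ.≤-refl R s
    ...   | yes (y , r≈sy , len) = y , ≈-trans (∷-transpose s (≈-sym r≈sy)) (∷-cong s r≈x) ,
              red-suffix (s ∷ []) (red-≈ r≈sy len R)
    ...   | no ¬ld = s ∷ r , ∷-cong s r≈x , R′
      where
      R′ : Red (s ∷ r)
      R′ z z≈sr with ℕ.<-cmp (length z) (length r)
      ... | tri> _ _ r<z = r<z
      ... | tri≈ _ e _ = ⊥-elim (suc-length-≉ (≈-sym z≈sr) (cong suc (sym e)))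
      ... | tri< z<r _ _ = ⊥-elim (¬ld (z , ≈-sym sz≈r ,
              ℕ.≤-antisym z<r (R (s ∷ z) sz≈r)))
        where
        sz≈r : s ∷ z ≈ r
        sz≈r = ≈-sym (∷-transpose s (≈-sym z≈sr))

  infix 4 _≈?_
  _≈?_ : ∀ x y → Dec (x ≈ y)
  x ≈? y with reduce (x ++ reverse y)
  ... | [] , e , R = yes (++-cancelʳ (reverse y) (≈-trans (≈-sym e) (≈-sym (reverse-inverseʳ y))))
  ... | s ∷ r , e , R = no λ x≈y → ℕ.1+n≰n (ℕ.≤-trans (s≤s z≤n)
          (R [] (≈-sym (≈-trans e (≈-trans (++-congʳ (reverse y) x≈y) (reverse-inverseʳ y))))))

-- Length, descents and the strong exchange property.

module LengthFunction {n : ℕ} (M : CoxeterMatrix n) where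
  open CoxeterMatrix M
  open Coxeter M
  open Words M
  open Game M
  open Reflections M
  open Decidability M

  -- Some reduced word, computed from the given spelling. Equal elements can receive different ones,
  -- so only its length `ℓ` respects `≈`.
  nf : Word → Word
  nf x = proj₁ (reduce x)

  nf≈ : ∀ x → nf x ≈ x
  nf≈ x = proj₁ (proj₂ (reduce x))

  nf-red : ∀ x → Red (nf x)
  nf-red x = proj₂ (proj₂ (reduce x))

  ℓ : Word → ℕ
  ℓ x = length (nf x)

  ℓ-min : ∀ {z x} → z ≈ x → ℓ x ≤ length z
  ℓ-min {z} {x} e = nf-red x z (≈-trans e (≈-sym (nf≈ x)))

  ℓ-cong : ∀ {x y} → x ≈ y → ℓ x ≡ ℓ y
  ℓ-cong {x} {y} e = ℕ.≤-antisym (ℓ-min (≈-trans (nf≈ y) (≈-sym e))) (ℓ-min (≈-trans (nf≈ x) e))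

  ℓ≤length : ∀ x → ℓ x ≤ length x
  ℓ≤length x = ℓ-min ≈-refl

  red⇒ℓ : ∀ {x} → Red x → ℓ x ≡ length x
  red⇒ℓ {x} R = ℕ.≤-antisym (ℓ≤length x) (R (nf x) (nf≈ x))

  ℓ⇒red : ∀ {x} → ℓ x ≡ length x → Red x
  ℓ⇒red e z z≈x = subst (_≤ length z) e (ℓ-min z≈x)

  ℓ-++ : ∀ x y → ℓ (x ++ y) ≤ ℓ x + ℓ y
  ℓ-++ x y = ℕ.≤-trans (ℓ-min (++-cong (nf≈ x) (nf≈ y))) (ℕ.≤-reflexive (length-++ (nf x)))

  ℓ[] : ℓ [] ≡ 0
  ℓ[] = ℕ.n≤0⇒n≡0 (ℓ≤length [])

  ℓ≡0⇒[] : ∀ {x} → ℓ x ≡ 0 → x ≈ []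
  ℓ≡0⇒[] {x} e with nf x | nf≈ x
  ... | [] | q = ≈-sym q

  ℓ-reverse : ∀ x → ℓ (reverse x) ≡ ℓ x
  ℓ-reverse x = ℕ.≤-antisym (half x)
    (subst (λ h → ℓ h ≤ ℓ (reverse x)) (reverse-involutive x) (half (reverse x)))
    where
    half : ∀ x → ℓ (reverse x) ≤ ℓ x
    half x = ℕ.≤-trans (ℓ-min (reverse-cong (nf≈ x))) (ℕ.≤-reflexive (length-reverse (nf x)))

  D : Fin n → Word → Set
  D s x = ℓ x ≡ suc (ℓ (s ∷ x))

  ℓ-∷ : ∀ s x → D s x ⊎ (ℓ (s ∷ x) ≡ suc (ℓ x))
  ℓ-∷ s x with ℕ.<-cmp (ℓ (s ∷ x)) (ℓ x)
  ... | tri< lt _ _ = inj₁ (ℕ.≤-antisym (ℓ-min e) lt)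
    where
    e : s ∷ nf (s ∷ x) ≈ x
    e = ≈-sym (∷-transpose s (≈-sym (nf≈ (s ∷ x))))
  ... | tri≈ _ eq _ = ⊥-elim (suc-length-≉ {s ∷ nf x} {nf (s ∷ x)}
      (≈-trans (∷-cong s (nf≈ x)) (≈-sym (nf≈ (s ∷ x)))) (cong suc (sym eq)))
  ... | tri> _ _ gt = inj₂ (ℕ.≤-antisym (ℓ-min (∷-cong s (nf≈ x))) gt)

  D? : ∀ s x → Dec (D s x)
  D? s x = ℓ x ℕ.≟ suc (ℓ (s ∷ x))

  ¬D⇒ascent : ∀ {s x} → ¬ D s x → ℓ (s ∷ x) ≡ suc (ℓ x)
  ¬D⇒ascent {s} {x} ¬d with ℓ-∷ s x
  ... | inj₁ d = ⊥-elim (¬d d)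
  ... | inj₂ e = e

  ascent⇒¬D : ∀ {s x} → ℓ (s ∷ x) ≡ suc (ℓ x) → ¬ D s x
  ascent⇒¬D {s} {x} e d = ℕ.m≢1+m+n (ℓ x) {1} (trans d (trans (cong suc e) (cong suc (ℕ.+-comm 1 (ℓ x)))))

  D-resp : ∀ {s x y} → x ≈ y → D s x → D s y
  D-resp {s} e d = trans (ℓ-cong (≈-sym e)) (trans d (cong suc (ℓ-cong (∷-cong s e))))

  D-flip : ∀ {s x} → ¬ D s x → D s (s ∷ x)
  D-flip {s} {x} ¬d = trans (¬D⇒ascent ¬d) (cong suc (ℓ-cong (≈-sym (ss-cancel s x))))

  ¬D-flip : ∀ {s x} → D s x → ¬ D s (s ∷ x)
  ¬D-flip {s} {x} d = ascent⇒¬D (trans (ℓ-cong (ss-cancel s x)) d)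

  <⇒D : ∀ {s x} → ℓ (s ∷ x) < ℓ x → D s x
  <⇒D {s} {x} lt with ℓ-∷ s x
  ... | inj₁ d = d
  ... | inj₂ e = ⊥-elim (ℕ.<⇒≱ lt (subst (ℓ x ≤_) (sym e) (ℕ.n≤1+n _)))

  ¬D[] : ∀ {s} → ¬ D s []
  ¬D[] e = ℕ.0≢1+n (trans (sym ℓ[]) e)

  ℓ-singleton : ∀ s → ℓ (s ∷ []) ≡ 1
  ℓ-singleton s = trans (¬D⇒ascent ¬D[]) (cong suc ℓ[])

  D-red : ∀ {s x} → Red (s ∷ x) → D s (s ∷ x)
  D-red {s} {x} R = D-flip (λ d → ℕ.1+n≰n (ℕ.≤-trans (s≤s (ℓ≤length x))
    (ℕ.≤-trans (ℕ.≤-reflexive (sym (red⇒ℓ R))) (ℕ.≤-trans (ℕ.n≤1+n _) (ℕ.≤-reflexive (sym d))))))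

  ∷-injective-≈ : ∀ {s t} → s ∷ [] ≈ t ∷ [] → s ≡ t
  ∷-injective-≈ {s} {t} e with s ≟ t
  ... | yes p = p
  ... | no s≢t = ⊥-elim (alt-double≉[] 1 s≢t (s≤s z≤n) (m-off s t s≢t)
    (≈-trans (∷-cong s (≈-sym e)) (ss-cancel s [])))

  count : ∀ t L → ∃[ b ] Count t L b
  count t [] = false , none
  count t (x ∷ L) with count t L | x ≈? t
  ... | b , c | yes e = not b , hit e c
  ... | b , c | no ¬e = b , miss ¬e c

  reflection-++ : ∀ q p c → reflection (q ++ p) c ≡ q ++ reflection p c ++ reverse q
  reflection-++ q p c = begin
    (q ++ p) ++ c ∷ reverse (q ++ p)           ≡⟨ ++-assoc q p _ ⟩
    q ++ p ++ c ∷ reverse (q ++ p)             ≡⟨ cong (λ h → q ++ p ++ c ∷ h) (reverse-++ q p) ⟩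
    q ++ p ++ c ∷ reverse p ++ reverse q       ≡⟨ cong (q ++_) (++-assoc p (c ∷ reverse p) (reverse q)) ⟨
    q ++ reflection p c ++ reverse q           ∎
    where open ≡-Reasoning

  count-conj : ∀ q {t t′} → q ++ t′ ++ reverse q ≈ t → ∀ p x {b} →
    Count t′ (Φ p x) b → Count t (Φ (q ++ p) x) b
  count-conj q e p [] none = none
  count-conj q e p (c ∷ x) (hit h k) = hit
    (≈-trans (≡⇒≈ (reflection-++ q p c)) (≈-trans (≈-context q (reverse q) h) e))
    (subst (λ r → Count _ (Φ r x) _) (sym (++-assoc q p (c ∷ []))) (count-conj q e (p ++ c ∷ []) x k))
  count-conj q {t} {t′} e p (c ∷ x) (miss h k) = miss
    (λ g → h (++-cancelʳ (reverse q) (++-cancel q (≈-trans (≡⇒≈ (sym (reflection-++ q p c)))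
      (≈-trans g (≈-sym e))))))
    (subst (λ r → Count _ (Φ r x) _) (sym (++-assoc q p (c ∷ []))) (count-conj q e (p ++ c ∷ []) x k))

  reflection-reverse : ∀ p s → reverse (reflection p s) ≡ reflection p s
  reflection-reverse p s = begin
    reverse (p ++ s ∷ reverse p)                    ≡⟨ reverse-++ p (s ∷ reverse p) ⟩
    reverse (s ∷ reverse p) ++ reverse p            ≡⟨ cong (_++ reverse p) (reverse-∷ s (reverse p)) ⟩
    (reverse (reverse p) ++ s ∷ []) ++ reverse p    ≡⟨ cong (λ h → (h ++ s ∷ []) ++ reverse p) (reverse-involutive p) ⟩
    (p ++ s ∷ []) ++ reverse p                      ≡⟨ ++-assoc p (s ∷ []) (reverse p) ⟩
    p ++ s ∷ reverse p                              ∎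
    where open ≡-Reasoning

  reflection-square : ∀ p s → reflection p s ++ reflection p s ≈ []
  reflection-square p s = subst (λ h → reflection p s ++ h ≈ []) (reflection-reverse p s)
    (reverse-inverseʳ (reflection p s))

  -- By conjugation the inner letters of a r a meet the reflection an odd number of times. The first
  -- and the last letter meet it under the same condition, a = r, and cancel modulo 2.
  count-self : ∀ p s → Count (reflection p s) (Φ [] (reflection p s)) true
  count-self [] s = hit ≈-refl none
  count-self (a ∷ p) s = subst (λ h → Count h (Φ [] h) true) (sym shape) body
    where
    r : Word
    r = reflection p s
    shape : reflection (a ∷ p) s ≡ a ∷ r ++ a ∷ []
    shape = reflection-++ (a ∷ []) p s
    middle : Count (a ∷ r ++ a ∷ []) (Φ (a ∷ []) r) true
    middle = count-conj (a ∷ []) {t′ = r} ≈-refl [] r (count-self p s)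
    first : a ∷ [] ≈ r → a ∷ [] ≈ a ∷ r ++ a ∷ []
    first e = ∷-transpose a (≈-trans (ss-cancel a []) (≈-trans (≈-sym (ss-cancel a [])) (++-congʳ (a ∷ []) e)))
    first⁻ : a ∷ [] ≈ a ∷ r ++ a ∷ [] → a ∷ [] ≈ r
    first⁻ e = ++-cancelʳ (a ∷ []) (≈-trans (ss-cancel a []) (∷-cancel a e))
    third : a ∷ [] ≈ r → reflection (a ∷ r) a ≈ a ∷ r ++ a ∷ []
    third e = ≈-trans (≡⇒≈ (reflection-++ (a ∷ []) r a)) (≈-context (a ∷ []) (a ∷ [])
      (≈-trans (++-congˡ r (++-cong e ≈-refl)) (≈-trans (++-congˡ r (reverse-inverseʳ r)) (≡⇒≈ (++-identityʳ r)))))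
    third⁻ : reflection (a ∷ r) a ≈ a ∷ r ++ a ∷ [] → a ∷ [] ≈ r
    third⁻ e = ++-cancelʳ (reverse r) (++-cancel r (≈-trans
      (++-cancelʳ (a ∷ []) (∷-cancel a (≈-trans (≡⇒≈ (sym (reflection-++ (a ∷ []) r a))) e)))
      (≈-sym (≈-trans (++-congˡ r (reverse-inverseʳ r)) (≡⇒≈ (++-identityʳ r))))))
    list : Φ [] (a ∷ r ++ a ∷ []) ≡ (a ∷ []) ∷ Φ (a ∷ []) r ++ reflection (a ∷ r) a ∷ []
    list = cong ((a ∷ []) ∷_) (Φ-++ (a ∷ []) r (a ∷ []))
    body : Count (a ∷ r ++ a ∷ []) (Φ [] (a ∷ r ++ a ∷ [])) true
    body with a ∷ [] ≈? r
    ... | yes e = subst (λ L → Count (a ∷ r ++ a ∷ []) L true) (sym list)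
      (hit (first e) (count-++ middle (hit (third e) none)))
    ... | no ¬e = subst (λ L → Count (a ∷ r ++ a ∷ []) L true) (sym list)
      (miss (λ h → ¬e (first⁻ h)) (count-++ middle (miss (λ h → ¬e (third⁻ h)) none)))

  -- If w met the reflection t an even number of times, then t w would meet it an odd number of
  -- times by `count-self`. A reduced word of t w could then be shortened to w, against the assumed
  -- inequality.
  strong-exchange : ∀ p s w → ℓ (reflection p s ++ w) < ℓ w →
    ∃[ a ] ∃[ b ] ∃[ c ] (w ≡ a ++ b ∷ c) × (reflection p s ++ w ≈ a ++ c)
  strong-exchange p s w lt with count (reflection p s) (Φ [] w)
  ... | true , k with Φ-any [] w (count-odd refl k)
  ...   | a , b , c , refl , e = a , b , c , refl , reflection-delete a b c e
  strong-exchange p s w lt | false , k = ⊥-elim (longer (count t (Φ [] r)))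
    where
    t r : Word
    t = reflection p s
    r = nf (t ++ w)
    odd-tw : Count t (Φ [] (t ++ w)) true
    odd-tw = subst (λ L → Count t L true) (sym (Φ-++ [] t w))
      (count-++ (count-self p s)
        (subst (λ h → Count t (Φ h w) false) (++-identityʳ t)
          (count-conj t {t′ = t} (≈-trans (++-congˡ t (reverse-inverseʳ t)) (≡⇒≈ (++-identityʳ t))) [] w k)))
    longer : ¬ (∃[ b ] Count t (Φ [] r) b)
    longer (b , c) with Φ-any [] r (count-odd (sym (count-≈ (≈-sym (nf≈ (t ++ w))) odd-tw c)) c)
    ... | x , y , z , r≡ , e = ℕ.<⇒≱ lt (ℕ.<⇒≤ (longer-by-one (trans (sym (length-delete x y z)) (cong length (sym r≡)))))
      where
      w≈xz : x ++ z ≈ w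
      w≈xz = begin
        x ++ z             ≈⟨ reflection-delete x y z e ⟨
        t ++ x ++ y ∷ z    ≡⟨ cong (t ++_) r≡ ⟨
        t ++ r             ≈⟨ ++-congˡ t (nf≈ (t ++ w)) ⟩
        t ++ t ++ w        ≡⟨ ++-assoc t t w ⟨
        (t ++ t) ++ w      ≈⟨ ++-congʳ w (reflection-square p s) ⟩
        w                  ∎
        where open ≈-Reasoning
      longer-by-one : suc (length (x ++ z)) ≡ length r → ℓ w < ℓ (t ++ w)
      longer-by-one eq = ℕ.≤-trans (s≤s (ℓ-min w≈xz)) (ℕ.≤-reflexive eq)

  strong-exchangeʳ : ∀ p s w → ℓ (w ++ reflection p s) < ℓ w →
    ∃[ a ] ∃[ b ] ∃[ c ] (w ≡ a ++ b ∷ c) × (w ++ reflection p s ≈ a ++ c)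
  strong-exchangeʳ p s w lt with strong-exchange p s (reverse w)
    (subst₂ _<_ (trans (sym (ℓ-reverse _)) (cong ℓ rev-w)) (sym (ℓ-reverse w)) lt)
    where
    rev-w : reverse (w ++ reflection p s) ≡ reflection p s ++ reverse w
    rev-w = trans (reverse-++ w (reflection p s)) (cong (_++ reverse w) (reflection-reverse p s))
  ... | a , b , c , eq , e = reverse c , b , reverse a ,
      trans (trans (sym (reverse-involutive w)) (cong reverse eq)) rev-abc ,
      ≈-trans (≡⇒≈ (trans (sym (reverse-involutive _)) (cong reverse rev-w)))
        (≈-trans (reverse-cong e) (≡⇒≈ (reverse-++ a c)))
    where
    rev-w : reverse (w ++ reflection p s) ≡ reflection p s ++ reverse w
    rev-w = trans (reverse-++ w (reflection p s)) (cong (_++ reverse w) (reflection-reverse p s))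
    rev-abc : reverse (a ++ b ∷ c) ≡ reverse c ++ b ∷ reverse a
    rev-abc = trans (reverse-++ a (b ∷ c)) (reverse-∷-++ b c (reverse a))

  exchange : ∀ {s} w → D s w → ∃[ a ] ∃[ b ] ∃[ c ] (w ≡ a ++ b ∷ c) × (s ∷ w ≈ a ++ c)
  exchange {s} w d = strong-exchange [] s w (ℕ.≤-reflexive (sym d))

  exchangeʳ : ∀ {s} w → ℓ (w ++ s ∷ []) < ℓ w →
    ∃[ a ] ∃[ b ] ∃[ c ] (w ≡ a ++ b ∷ c) × (w ++ s ∷ [] ≈ a ++ c)
  exchangeʳ {s} w lt = strong-exchangeʳ [] s w lt

  Alt : ℕ → Fin n → Fin n → Word → Set
  Alt j s t x = ∃[ z ] (x ≈ alt s t j ++ z) × (ℓ x ≡ j + ℓ z)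

  Alt-resp : ∀ {j s t x y} → x ≈ y → Alt j s t x → Alt j s t y
  Alt-resp e (z , x≈ , len) = z , ≈-trans (≈-sym e) x≈ , trans (ℓ-cong (≈-sym e)) len

  ℓ-alt-++ : ∀ j s t z → ℓ (alt s t j ++ z) ≤ j + ℓ z
  ℓ-alt-++ j s t z = ℕ.≤-trans (ℓ-++ (alt s t j) z) (ℕ.+-monoˡ-≤ (ℓ z)
    (ℕ.≤-trans (ℓ≤length (alt s t j)) (ℕ.≤-reflexive (length-alt s t j))))

  alt-D : ∀ {j s t x} → Alt (suc j) s t x → D s x
  alt-D {j} {s} {t} {x} (z , e , len) = <⇒D (subst (ℓ (s ∷ x) <_) (sym len)
    (s≤s (subst (_≤ j + ℓ z) (ℓ-cong (∷-transpose s (≈-sym e))) (ℓ-alt-++ j t s z))))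

  alt-tail : ∀ {j s t x} → Alt (suc j) s t x → Alt j t s (s ∷ x)
  alt-tail {j} {s} {t} {x} A@(z , e , len) = z , ≈-sym (∷-transpose s (≈-sym e)) ,
    ℕ.suc-injective (trans (sym (alt-D A)) len)

  D⇒LD : ∀ {s x} → D s x → LD s (nf x)
  D⇒LD {s} {x} d = nf (s ∷ x) , ≈-trans (nf≈ x) (∷-transpose s (≈-sym (nf≈ (s ∷ x)))) , sym d

  -- `strip?` decides this conclusion, which removes the double negation left by `dihedral-¬¬`.
  D-alt : ∀ {s t x} → s ≢ t → D s x → D t x → ∀ j → j ≤∞ m s t → Alt j s t x
  D-alt {s} {t} {x} s≢t ds dt j bound with decidable-stable
      (strip? (ℓ x) (descent? (ℓ x)) j s t (nf x) ℕ.≤-refl (nf-red x))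
      (dihedral-¬¬ (nf-red x) s≢t (D⇒LD ds) (D⇒LD dt) j bound)
  ... | z , e , len = z , ≈-trans (≈-sym (nf≈ x)) e , trans (sym len) (cong (j +_) (sym (red⇒ℓ R)))
    where
    R : Red z
    R = red-suffix (alt s t j) (red-≈ e
      (trans (length-++ (alt s t j)) (trans (cong (_+ length z) (length-alt s t j)) len)) (nf-red x))

  D-finite : ∀ {s t x} → s ≢ t → D s x → D t x → m s t ≢ ∞
  D-finite {s} {t} {x} s≢t ds dt e with D-alt s≢t ds dt (suc (ℓ x)) (subst (suc (ℓ x) ≤∞_) (sym e) tt)
  ... | z , _ , len = ℕ.1+n≰n (ℕ.≤-trans (ℕ.m≤m+n _ (ℓ z)) (ℕ.≤-reflexive (sym len)))

-- Parabolic subgroups, minimal coset representatives and sliding letters.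

module Parabolic {n : ℕ} (M : CoxeterMatrix n) where
  open Coxeter M
  open Words M
  open Decidability M
  open LengthFunction M

  All-delete : ∀ {K : Fin n → Set} a {b c} → All K (a ++ b ∷ c) → All K (a ++ c)
  All-delete a ks with ++⁻ʳ a ks
  ... | _ ∷ cs = ++⁺ (++⁻ˡ a ks) cs

  reverse⁺ : ∀ {K : Fin n → Set} {x} → All K x → All K (reverse x)
  reverse⁺ {K} {[]} [] = []
  reverse⁺ {K} {s ∷ x} (k ∷ ks) = subst (All K) (sym (reverse-∷ s x)) (++⁺ (reverse⁺ ks) (k ∷ []))

  reduce-in : ∀ {K : Fin n → Set} x → All K x → ∃[ y ] (y ≈ x) × All K y × (length y ≡ ℓ x)
  reduce-in [] [] = [] , ≈-refl , [] , sym ℓ[]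
  reduce-in (s ∷ x) (k ∷ ks) with reduce-in x ks
  ... | y , e , Ky , len with D? s y
  ...   | no ¬d = s ∷ y , ∷-cong s e , k ∷ Ky , trans (cong suc (trans len (ℓ-cong (≈-sym e))))
            (trans (sym (¬D⇒ascent ¬d)) (ℓ-cong (∷-cong s e)))
  ...   | yes d with exchange y d
  ...     | a , b , c , refl , f = a ++ c , ≈-trans (≈-sym f) (∷-cong s e) , All-delete a Ky ,
              ℕ.suc-injective (trans (sym (length-delete a b c))
                (trans len (trans (ℓ-cong (≈-sym e)) (trans d (cong suc (ℓ-cong (∷-cong s e)))))))

  -- Exchange writes the first letter of `Y` as a quotient of two K-words. Reducing that quotient
  -- with letters of K only leaves one letter, which has to be this first letter.
  red-in : ∀ {K : Fin n → Set} Y Y′ → Red Y → Y ≈ Y′ → All K Y′ → All K Y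
  red-in [] Y′ R e ks = []
  red-in {K} (s ∷ Y) Y′ R e ks with reduce-in Y′ ks
  ... | y , f , Ky , len with exchange y (D-resp (≈-trans e (≈-sym f)) (D-red R))
  ...   | a , b , c , refl , g with reduce-in ((a ++ c) ++ reverse (a ++ b ∷ c)) (++⁺ (All-delete a Ky) (reverse⁺ Ky))
  ...     | z , z≈ , Kz , lenz = letter z s≈z Kz (trans lenz (trans (ℓ-cong (≈-sym s≈)) (ℓ-singleton s))) ∷
              red-in Y (a ++ c) (red-suffix (s ∷ []) R) Y≈ (All-delete a Ky)
    where
    s≈ : s ∷ [] ≈ (a ++ c) ++ reverse (a ++ b ∷ c)
    s≈ = ++-transposeʳ (a ++ b ∷ c) g
    s≈z : s ∷ [] ≈ z
    s≈z = ≈-trans s≈ (≈-sym z≈)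
    letter : ∀ z → s ∷ [] ≈ z → All K z → length z ≡ 1 → K s
    letter (k ∷ []) e (Kk ∷ []) _ = subst K (sym (∷-injective-≈ e)) Kk
    Y≈ : Y ≈ a ++ c
    Y≈ = ≈-trans (∷-transpose s (≈-trans e (≈-sym f))) g

  -- Generating sets are predicates here, because later ones such as `_≢ t` or `ShiftJ z` arise as
  -- conditions on letters.
  LMin : (Fin n → Set) → Word → Set
  LMin K x = ∀ k → K k → ¬ D k x

  module _ {K : Fin n → Set} (K? : ∀ k → Dec (K k)) where

    decompose-fuel : ∀ f x → ℓ x ≤ f →
      ∃[ y ] ∃[ z ] (x ≈ y ++ z) × All K y × LMin K z × (ℓ x ≡ ℓ y + ℓ z)
    decompose-fuel f x x≤f with any? (λ k → K? k ×-dec D? k x)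
    ... | no ¬∃ = [] , x , ≈-refl , [] , (λ k Kk d → ¬∃ (k , Kk , d)) , cong (_+ ℓ x) (sym ℓ[])
    decompose-fuel zero x x≤0 | yes (k , Kk , d) = ⊥-elim (ℕ.0≢1+n (trans (sym (ℕ.n≤0⇒n≡0 x≤0)) d))
    decompose-fuel (suc f) x x≤f | yes (k , Kk , d)
      with decompose-fuel f (k ∷ x) (ℕ.≤-pred (subst (_≤ suc f) d x≤f))
    ... | y , z , e , Ky , L , len = k ∷ y , z , x≈ , Kk ∷ Ky , L , ℕ.≤-antisym
        (ℕ.≤-trans (ℕ.≤-reflexive (ℓ-cong x≈)) (ℓ-++ (k ∷ y) z))
        (ℕ.≤-trans (ℕ.+-monoˡ-≤ (ℓ z) (ℓ-∷-≤ k y)) (ℕ.≤-reflexive (trans (cong suc (sym len)) (sym d))))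
      where
      x≈ : x ≈ k ∷ y ++ z
      x≈ = ∷-transpose k e
      ℓ-∷-≤ : ∀ k y → ℓ (k ∷ y) ≤ suc (ℓ y)
      ℓ-∷-≤ k y = ℓ-min (∷-cong k (nf≈ y))

    decompose : ∀ x → ∃[ y ] ∃[ z ] (x ≈ y ++ z) × All K y × LMin K z × (ℓ x ≡ ℓ y + ℓ z)
    decompose x = decompose-fuel (ℓ x) x ℕ.≤-refl

    private
      -- If some reduced K-word Y made Y x non-reduced, exchange would put a shorter element in the
      -- coset of x; its minimal representative shows that x has a descent in K.
      Additive : Word → Set
      Additive x = ∀ y → All K y → ℓ (y ++ x) ≡ ℓ y + ℓ x

      min-red : ∀ x → (∀ x₀ → ℓ x₀ < ℓ x → LMin K x₀ → Additive x₀) → LMin K x →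
        ∀ Y → All K Y → Red Y → ℓ (Y ++ x) ≡ length Y + ℓ x
      min-red x IH L [] _ _ = refl
      min-red x IH L (a ∷ Y) (Ka ∷ KY) R with D? a (Y ++ x)
      ... | no ¬d = trans (¬D⇒ascent ¬d) (cong suc (min-red x IH L Y KY (red-suffix (a ∷ []) R)))
      ... | yes d with exchange (Y ++ nf x) (D-resp (++-congˡ Y (≈-sym (nf≈ x))) d)
      ...   | p , b , c , eq , e with ++-split p Y (sym eq)
      ...     | inj₁ (c′ , refl , refl) = ⊥-elim (ℕ.1+n≰n (ℕ.≤-trans
                  (ℕ.≤-trans (ℕ.n≤1+n _) (ℕ.≤-reflexive (cong suc (sym (length-delete p b c′)))))
                  (R (p ++ c′) (≈-sym (++-cancelʳ (nf x) (≈-trans e (≡⇒≈ (sym (++-assoc p c′ (nf x))))))))))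
      ...     | inj₂ (p′ , refl , nx) with decompose (p′ ++ c)
      ...       | y₀ , x₀ , e₀ , K₀ , L₀ , len₀ with reduce-in (T ++ y₀) (++⁺ KT K₀)
        where
        T : Word
        T = reverse (a ∷ Y) ++ Y
        KT : All K T
        KT = ++⁺ (reverse⁺ (Ka ∷ KY)) KY
      ...         | r , er , Kr , lenr = ⊥-elim (descend r er Kr lenr)
        where
        T : Word
        T = reverse (a ∷ Y) ++ Y
        x≈ : x ≈ (T ++ y₀) ++ x₀
        x≈ = begin
          x                                         ≈⟨ nf≈ x ⟨
          nf x                                      ≈⟨ ++-transposeˡ (a ∷ Y) e ⟩
          reverse (a ∷ Y) ++ (Y ++ p′) ++ c         ≡⟨ cong (reverse (a ∷ Y) ++_) (++-assoc Y p′ c) ⟩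
          reverse (a ∷ Y) ++ Y ++ p′ ++ c           ≡⟨ ++-assoc (reverse (a ∷ Y)) Y (p′ ++ c) ⟨
          T ++ p′ ++ c                              ≈⟨ ++-congˡ T e₀ ⟩
          T ++ y₀ ++ x₀                             ≡⟨ ++-assoc T y₀ x₀ ⟨
          (T ++ y₀) ++ x₀                           ∎
          where open ≈-Reasoning
        x₀<x : ℓ x₀ < ℓ x
        x₀<x = ℕ.≤-trans (s≤s (ℕ.≤-trans (ℕ.m≤n+m (ℓ x₀) (ℓ y₀))
            (ℕ.≤-trans (ℕ.≤-reflexive (sym len₀)) (ℓ≤length (p′ ++ c)))))
          (ℕ.≤-reflexive (trans (sym (length-delete p′ b c)) (cong length (sym nx))))
        additive : ∀ y → All K y → ℓ (y ++ x₀) ≡ ℓ y + ℓ x₀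
        additive = IH x₀ x₀<x L₀
        descend : ∀ r → r ≈ T ++ y₀ → All K r → length r ≡ ℓ (T ++ y₀) → ⊥
        descend [] er Kr lenr = ℕ.<⇒≢ x₀<x (ℓ-cong (≈-sym (≈-trans x≈ (++-congʳ x₀ (≈-sym er)))))
        descend (k ∷ r) er (Kk ∷ Kr) lenr = L k Kk (<⇒D (subst₂ _<_
          (sym (trans (ℓ-cong kx≈) (additive r Kr)))
          (sym (trans (ℓ-cong x≈kr) (additive (k ∷ r) (Kk ∷ Kr))))
          (ℕ.+-monoˡ-< (ℓ x₀) (ℕ.≤-trans (s≤s (ℓ≤length r)) (ℕ.≤-reflexive (trans lenr (ℓ-cong (≈-sym er))))))))
          where
          x≈kr : x ≈ k ∷ r ++ x₀
          x≈kr = ≈-trans x≈ (++-congʳ x₀ (≈-sym er))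
          kx≈ : k ∷ x ≈ r ++ x₀
          kx≈ = ≈-sym (∷-transpose k (≈-sym x≈kr))

      min-additive : ∀ f x → ℓ x < f → LMin K x → Additive x
      min-additive (suc f) x (s≤s x≤f) L y Ky with reduce-in y Ky
      ... | Y , e , KY , len = trans (ℓ-cong (++-congʳ x (≈-sym e)))
        (trans (min-red x (λ x₀ x₀<x → min-additive f x₀ (ℕ.<-≤-trans x₀<x x≤f)) L Y KY
            (ℓ⇒red (trans (ℓ-cong e) (sym len))))
          (cong (_+ ℓ x) len))

    LMin-additive : ∀ {x y} → LMin K x → All K y → ℓ (y ++ x) ≡ ℓ y + ℓ x
    LMin-additive {x} {y} L Ky = min-additive (suc (ℓ x)) x ℕ.≤-refl L y Ky

    -- With t = y′⁻¹y, additivity on both cosets gives ℓ(x′) = ℓ(t) + ℓ(x) and ℓ(x) = ℓ(t⁻¹) +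
    -- ℓ(x′), so t is trivial.
    LMin-unique : ∀ {x y x′ y′} → LMin K x → LMin K x′ → All K y → All K y′ →
      y ++ x ≈ y′ ++ x′ → x ≈ x′
    LMin-unique {x} {y} {x′} {y′} L L′ Ky Ky′ e = ≈-sym (≈-trans x′≈ (++-congʳ x (ℓ≡0⇒[] ℓt≡0)))
      where
      t : Word
      t = reverse y′ ++ y
      Kt : All K t
      Kt = ++⁺ (reverse⁺ Ky′) Ky
      x′≈ : x′ ≈ t ++ x
      x′≈ = ≈-trans (++-transposeˡ y′ (≈-sym e)) (≡⇒≈ (sym (++-assoc (reverse y′) y x)))
      ℓt≡0 : ℓ t ≡ 0
      ℓt≡0 = ℕ.n≤0⇒n≡0 (ℕ.+-cancelʳ-≤ (ℓ x) (ℓ t) 0 (begin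
        ℓ t + ℓ x             ≡⟨ trans (ℓ-cong x′≈) (LMin-additive L Kt) ⟨
        ℓ x′                  ≤⟨ ℕ.m≤n+m (ℓ x′) _ ⟩
        ℓ (reverse t) + ℓ x′  ≡⟨ trans (ℓ-cong (++-transposeˡ t (≈-sym x′≈))) (LMin-additive L′ (reverse⁺ Kt)) ⟨
        ℓ x                   ∎))
        where open ℕ.≤-Reasoning

  RMin : (Fin n → Set) → Word → Set
  RMin J x = ∀ a → J a → ℓ (x ++ a ∷ []) ≡ suc (ℓ x)

  ℓ-snoc : ∀ x a → ℓ (x ++ a ∷ []) ≡ ℓ (a ∷ reverse x)
  ℓ-snoc x a = trans (sym (ℓ-reverse (x ++ a ∷ []))) (cong ℓ (reverse-++ x (a ∷ [])))

  RMin-resp : ∀ {J x y} → x ≈ y → RMin J x → RMin J y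
  RMin-resp e R a Ja = trans (ℓ-cong (++-congʳ (a ∷ []) (≈-sym e))) (trans (R a Ja) (cong suc (ℓ-cong e)))

  RMin⇒LMin : ∀ {J x} → RMin J x → LMin J (reverse x)
  RMin⇒LMin {x = x} R a Ja = ascent⇒¬D (trans (sym (ℓ-snoc x a)) (trans (R a Ja) (cong suc (sym (ℓ-reverse x)))))

  LMin⇒RMin : ∀ {J x} → LMin J (reverse x) → RMin J x
  LMin⇒RMin {x = x} L a Ja = trans (ℓ-snoc x a) (trans (¬D⇒ascent (L a Ja)) (cong suc (ℓ-reverse x)))

  ascentʳ? : ∀ x a → (ℓ (x ++ a ∷ []) ≡ suc (ℓ x)) ⊎ (ℓ x ≡ suc (ℓ (x ++ a ∷ [])))
  ascentʳ? x a with ℓ-∷ a (reverse x)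
  ... | inj₁ d = inj₂ (trans (sym (ℓ-reverse x)) (trans d (cong suc (sym (ℓ-snoc x a)))))
  ... | inj₂ e = inj₁ (trans (ℓ-snoc x a) (trans e (cong suc (ℓ-reverse x))))

  -- Exchange for q x must delete the leading q: a deletion inside x would make x a shorter than x.
  shift : ∀ {x} q a → ℓ (x ++ a ∷ []) ≡ suc (ℓ x) → ℓ (q ∷ x) ≡ suc (ℓ (q ∷ x ++ a ∷ [])) →
    q ∷ x ≈ x ++ a ∷ []
  shift {x} q a asc e = resolve (exchangeʳ {a} (q ∷ nf x) shorter)
    where
    shorter : ℓ (q ∷ nf x ++ a ∷ []) < ℓ (q ∷ nf x)
    shorter = ℕ.≤-reflexive (begin
      suc (ℓ (q ∷ nf x ++ a ∷ []))    ≡⟨ cong suc (ℓ-cong (∷-cong q (++-congʳ (a ∷ []) (nf≈ x)))) ⟩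
      suc (ℓ (q ∷ x ++ a ∷ []))       ≡⟨ e ⟨
      ℓ (q ∷ x)                       ≡⟨ ℓ-cong (∷-cong q (nf≈ x)) ⟨
      ℓ (q ∷ nf x)                    ∎)
      where open ≡-Reasoning
    impossible : ∀ p b c → nf x ≡ p ++ b ∷ c → ¬ nf x ++ a ∷ [] ≈ p ++ c
    impossible p b c nx f = ℕ.<⇒≱ (ℕ.≤-reflexive (sym asc)) (begin
      ℓ (x ++ a ∷ [])       ≡⟨ ℓ-cong (++-congʳ (a ∷ []) (nf≈ x)) ⟨
      ℓ (nf x ++ a ∷ [])    ≤⟨ ℓ-min (≈-sym f) ⟩
      length (p ++ c)       ≤⟨ ℕ.n≤1+n _ ⟩
      suc (length (p ++ c)) ≡⟨ length-delete p b c ⟨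
      length (p ++ b ∷ c)   ≡⟨ cong length nx ⟨
      ℓ x                   ∎)
      where open ℕ.≤-Reasoning
    resolve : ∃[ p ] ∃[ b ] ∃[ c ] (q ∷ nf x ≡ p ++ b ∷ c) × (q ∷ nf x ++ a ∷ [] ≈ p ++ c) → q ∷ x ≈ x ++ a ∷ []
    resolve ([] , b , c , eq , f) = ≈-sym (∷-transpose q (≈-trans (∷-cong q (++-congʳ (a ∷ []) (≈-sym (nf≈ x))))
      (≈-trans f (≈-trans (≡⇒≈ (sym (proj₂ (∷-injective eq)))) (nf≈ x)))))
    resolve (q′ ∷ p , b , c , eq , f) with ∷-injective eq
    ... | refl , nx = ⊥-elim (impossible p b c nx (∷-cancel q f))

  module _ {J : Fin n → Set} (J? : ∀ a → Dec (J a)) where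

    RMin-additive : ∀ {x y} → RMin J x → All J y → ℓ (x ++ y) ≡ ℓ x + ℓ y
    RMin-additive {x} {y} R Jy = begin
      ℓ (x ++ y)                       ≡⟨ ℓ-reverse (x ++ y) ⟨
      ℓ (reverse (x ++ y))             ≡⟨ cong ℓ (reverse-++ x y) ⟩
      ℓ (reverse y ++ reverse x)       ≡⟨ LMin-additive J? (RMin⇒LMin R) (reverse⁺ Jy) ⟩
      ℓ (reverse y) + ℓ (reverse x)    ≡⟨ cong₂ _+_ (ℓ-reverse y) (ℓ-reverse x) ⟩
      ℓ y + ℓ x                        ≡⟨ ℕ.+-comm (ℓ y) (ℓ x) ⟩
      ℓ x + ℓ y                        ∎
      where open ≡-Reasoning

    RMin-unique : ∀ {x y x′ y′} → RMin J x → RMin J x′ → All J y → All J y′ →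
      x ++ y ≈ x′ ++ y′ → x ≈ x′
    RMin-unique {x} {y} {x′} {y′} R R′ Jy Jy′ e =
      subst₂ _≈_ (reverse-involutive x) (reverse-involutive x′)
        (reverse-cong (LMin-unique J? (RMin⇒LMin R) (RMin⇒LMin R′) (reverse⁺ Jy) (reverse⁺ Jy′)
          (subst₂ _≈_ (reverse-++ x y) (reverse-++ x′ y′) (reverse-cong e))))

    decomposeʳ : ∀ x → ∃[ z ] ∃[ y ] (x ≈ z ++ y) × RMin J z × All J y × (ℓ x ≡ ℓ z + ℓ y)
    decomposeʳ x with decompose J? (reverse x)
    ... | y , z , e , Jy , L , len = reverse z , reverse y ,
        subst₂ _≈_ (reverse-involutive x) (reverse-++ y z) (reverse-cong e) ,
        LMin⇒RMin (subst (LMin J) (sym (reverse-involutive z)) L) , reverse⁺ Jy ,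
        trans (sym (ℓ-reverse x)) (trans len (trans (ℕ.+-comm (ℓ y) (ℓ z))
          (cong₂ _+_ (sym (ℓ-reverse z)) (sym (ℓ-reverse y)))))

    -- Deodhar's lemma. A letter a of J that shortens q x lengthens x, so `shift` applies.
    RMin-or-shift : ∀ {x} q → RMin J x → ¬ D q x →
      RMin J (q ∷ x) ⊎ (∃[ a ] J a × (q ∷ x ≈ x ++ a ∷ []))
    RMin-or-shift {x} q R ¬d
      with any? (λ a → J? a ×-dec (ℓ (q ∷ x) ℕ.≟ suc (ℓ (q ∷ x ++ a ∷ []))))
    ... | no ¬∃ = inj₁ λ a Ja → asc a Ja (ascentʳ? (q ∷ x) a)
      where
      asc : ∀ a → J a → (ℓ (q ∷ x ++ a ∷ []) ≡ suc (ℓ (q ∷ x))) ⊎ (ℓ (q ∷ x) ≡ suc (ℓ (q ∷ x ++ a ∷ []))) → ℓ (q ∷ x ++ a ∷ []) ≡ suc (ℓ (q ∷ x))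
      asc a Ja (inj₁ e) = e
      asc a Ja (inj₂ e) = ⊥-elim (¬∃ (a , Ja , e))
    ... | yes (a , Ja , e) = inj₂ (a , Ja , shift q a (R a Ja) e)

  RMin-suffix : ∀ {J p x} → RMin J (p ++ x) → ℓ (p ++ x) ≡ ℓ p + ℓ x → RMin J x
  RMin-suffix {J} {p} {x} R len a Ja with ascentʳ? x a
  ... | inj₁ e = e
  ... | inj₂ e = ⊥-elim (ℕ.1+n≰n (begin
      suc (suc (ℓ p + ℓ (x ++ a ∷ [])))    ≡⟨ cong suc (ℕ.+-suc (ℓ p) _) ⟨
      suc (ℓ p + suc (ℓ (x ++ a ∷ [])))    ≡⟨ cong (λ h → suc (ℓ p + h)) e ⟨
      suc (ℓ p + ℓ x)                      ≡⟨ cong suc len ⟨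
      suc (ℓ (p ++ x))                     ≡⟨ R a Ja ⟨
      ℓ ((p ++ x) ++ a ∷ [])               ≡⟨ cong ℓ (++-assoc p x (a ∷ [])) ⟩
      ℓ (p ++ x ++ a ∷ [])                 ≤⟨ ℓ-++ p (x ++ a ∷ []) ⟩
      ℓ p + ℓ (x ++ a ∷ [])                ≤⟨ ℕ.n≤1+n _ ⟩
      suc (ℓ p + ℓ (x ++ a ∷ []))          ∎))
    where open ℕ.≤-Reasoning

  RMin-∷ : ∀ {J x} q → RMin J x → D q x → RMin J (q ∷ x)
  RMin-∷ {J} {x} q R d = RMin-suffix {J} {q ∷ []} {q ∷ x} (RMin-resp (≈-sym (ss-cancel q x)) R)
    (trans (ℓ-cong (ss-cancel q x)) (trans d (cong (_+ ℓ (q ∷ x)) (sym (ℓ-singleton q)))))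

  module _ {J K : Fin n → Set} (J? : ∀ a → Dec (J a)) (K? : ∀ k → Dec (K k)) where

    -- Here z is minimal in W_K z W_J. If a letter a of J shortens y z, exchange cannot delete
    -- inside z. A deletion inside y gives z a = ρ z with ρ in W_K of length one, that is, a letter
    -- k sliding through z; but then y k would be shorter than y.
    RMin-double : ∀ {y z} → RMin J z → LMin K z → All K y →
      (∀ k a → K k → J a → k ∷ z ≈ z ++ a ∷ [] → ℓ (y ++ k ∷ []) ≡ suc (ℓ y)) → RMin J (y ++ z)
    RMin-double {y} {z} R L Ky no-shift a Ja = resolve (ascentʳ? (y ++ z) a)
      where
      Y : Word
      Y = proj₁ (reduce-in y Ky)
      Y≈y : Y ≈ y
      Y≈y = proj₁ (proj₂ (reduce-in y Ky))
      KY : All K Y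
      KY = proj₁ (proj₂ (proj₂ (reduce-in y Ky)))
      lenY : length Y ≡ ℓ y
      lenY = proj₂ (proj₂ (proj₂ (reduce-in y Ky)))
      Yz≈ : Y ++ nf z ≈ y ++ z
      Yz≈ = ++-cong Y≈y (nf≈ z)
      z-impossible : ∀ p b c → nf z ≡ p ++ b ∷ c → ¬ nf z ++ a ∷ [] ≈ p ++ c
      z-impossible p b c nz f = ℕ.<⇒≱ (ℕ.≤-reflexive (sym (R a Ja))) (begin
        ℓ (z ++ a ∷ [])        ≡⟨ ℓ-cong (++-congʳ (a ∷ []) (nf≈ z)) ⟨
        ℓ (nf z ++ a ∷ [])     ≤⟨ ℓ-min (≈-sym f) ⟩
        length (p ++ c)        ≤⟨ ℕ.n≤1+n _ ⟩
        suc (length (p ++ c))  ≡⟨ length-delete p b c ⟨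
        length (p ++ b ∷ c)    ≡⟨ cong length nz ⟨
        ℓ z                    ∎)
        where open ℕ.≤-Reasoning
      y-impossible : ∀ p b c → Y ≡ p ++ b ∷ c → ¬ nf z ++ a ∷ [] ≈ reverse Y ++ (p ++ c) ++ nf z
      y-impossible p b c eq f = single (proj₁ r) (proj₁ (proj₂ r)) (proj₁ (proj₂ (proj₂ r)))
          (trans (proj₂ (proj₂ (proj₂ r))) ℓρ)
        where
        ρ : Word
        ρ = reverse Y ++ p ++ c
        Kρ : All K ρ
        Kρ = ++⁺ (reverse⁺ KY) (All-delete p (subst (All K) eq KY))
        r : ∃[ r ] (r ≈ ρ) × All K r × (length r ≡ ℓ ρ)
        r = reduce-in ρ Kρ
        za≈ : z ++ a ∷ [] ≈ ρ ++ z
        za≈ = begin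
          z ++ a ∷ []                        ≈⟨ ++-congʳ (a ∷ []) (nf≈ z) ⟨
          nf z ++ a ∷ []                     ≈⟨ f ⟩
          reverse Y ++ (p ++ c) ++ nf z      ≡⟨ ++-assoc (reverse Y) (p ++ c) (nf z) ⟨
          ρ ++ nf z                          ≈⟨ ++-congˡ ρ (nf≈ z) ⟩
          ρ ++ z                             ∎
          where open ≈-Reasoning
        ℓρ : ℓ ρ ≡ 1
        ℓρ = ℕ.+-cancelʳ-≡ (ℓ z) (ℓ ρ) 1 (begin
          ℓ ρ + ℓ z             ≡⟨ LMin-additive K? L Kρ ⟨
          ℓ (ρ ++ z)            ≡⟨ ℓ-cong za≈ ⟨
          ℓ (z ++ a ∷ [])       ≡⟨ R a Ja ⟩
          suc (ℓ z)             ∎)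
          where open ≡-Reasoning
        single : ∀ r → r ≈ ρ → All K r → length r ≡ 1 → ⊥
        single (k ∷ []) r≈ (Kk ∷ []) _ = ℕ.<⇒≱ (ℕ.n<1+n (ℓ y)) (begin
          suc (ℓ y)              ≡⟨ no-shift k a Kk Ja (≈-trans (++-congʳ z r≈) (≈-sym za≈)) ⟨
          ℓ (y ++ k ∷ [])        ≤⟨ ℓ-min (≈-sym yk≈) ⟩
          length (p ++ c)        ≤⟨ ℕ.n≤1+n _ ⟩
          suc (length (p ++ c))  ≡⟨ length-delete p b c ⟨
          length (p ++ b ∷ c)    ≡⟨ cong length eq ⟨
          length Y               ≡⟨ lenY ⟩
          ℓ y                    ∎)
          where
          open ℕ.≤-Reasoning
          yk≈ : y ++ k ∷ [] ≈ p ++ c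
          yk≈ = ≈-trans (++-cong (≈-sym Y≈y) r≈) (≈-trans (≡⇒≈ (sym (++-assoc Y (reverse Y) (p ++ c))))
            (++-congʳ (p ++ c) (reverse-inverseʳ Y)))
      located : ∃[ p ] ∃[ b ] ∃[ c ] (Y ++ nf z ≡ p ++ b ∷ c) × ((Y ++ nf z) ++ a ∷ [] ≈ p ++ c) → ⊥
      located (p , b , c , eq , f) with ++-split p Y (sym eq)
      ... | inj₁ (c′ , eqY , refl) = y-impossible p b c′ eqY (≈-trans
          (++-transposeˡ Y (≈-trans (≡⇒≈ (sym (++-assoc Y (nf z) (a ∷ [])))) f))
          (≡⇒≈ (cong (reverse Y ++_) (sym (++-assoc p c′ (nf z))))))
      ... | inj₂ (p′ , eqp , nz) = z-impossible p′ b c nz (++-cancel Y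
          (≈-trans (≡⇒≈ (sym (++-assoc Y (nf z) (a ∷ []))))
            (≈-trans f (≡⇒≈ (trans (cong (_++ c) eqp) (++-assoc Y p′ c))))))
      resolve : (ℓ ((y ++ z) ++ a ∷ []) ≡ suc (ℓ (y ++ z))) ⊎ (ℓ (y ++ z) ≡ suc (ℓ ((y ++ z) ++ a ∷ []))) →
        ℓ ((y ++ z) ++ a ∷ []) ≡ suc (ℓ (y ++ z))
      resolve (inj₁ e) = e
      resolve (inj₂ e) = ⊥-elim (located (exchangeʳ {a} (Y ++ nf z) shorter))
        where
        shorter : ℓ ((Y ++ nf z) ++ a ∷ []) < ℓ (Y ++ nf z)
        shorter = ℕ.≤-reflexive (begin
          suc (ℓ ((Y ++ nf z) ++ a ∷ []))   ≡⟨ cong suc (ℓ-cong (++-congʳ (a ∷ []) Yz≈)) ⟩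
          suc (ℓ ((y ++ z) ++ a ∷ []))      ≡⟨ e ⟨
          ℓ (y ++ z)                        ≡⟨ ℓ-cong Yz≈ ⟨
          ℓ (Y ++ nf z)                     ∎)
          where open ≡-Reasoning

-- Many coatoms inside W^J.

module Coatoms {n : ℕ} (M : CoxeterMatrix n) where
  open Coxeter M
  open Words M
  open Decidability M
  open LengthFunction M
  open Parabolic M
  open import Data.List.Membership.Propositional using (_∈_; _∉_)
  open import Data.List.Membership.DecPropositional (_≟_ {n}) using (_∈?_)

  Unique : List (Fin n) → Set
  Unique = AllPairs _≢_

  Coat : Word → Word → Set
  Coat y y′ = ∃[ a ] ∃[ b ] ∃[ c ] (y ≈ a ++ b ∷ c) × (y′ ≈ a ++ c) × (ℓ y ≡ suc (ℓ y′))

  -- The deletion may refer to another spelling of y; strong exchange transfers it to the K-word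
  -- `Y`.
  coat-in : ∀ {K : Fin n → Set} {y y′} Y → y ≈ Y → All K Y → Coat y y′ → ∃[ Y′ ] (y′ ≈ Y′) × All K Y′
  coat-in {K} {y} {y′} Y y≈Y KY (a , b , c , e , e′ , len) = located (strong-exchange a b Y shorter)
    where
    deleted : reflection a b ++ Y ≈ y′
    deleted = ≈-trans (++-congˡ (reflection a b) (≈-trans (≈-sym y≈Y) e))
      (≈-trans (reflection-delete a b c ≈-refl) (≈-sym e′))
    shorter : ℓ (reflection a b ++ Y) < ℓ Y
    shorter = ℕ.≤-reflexive (trans (cong suc (ℓ-cong deleted)) (trans (sym len) (ℓ-cong y≈Y)))
    located : ∃[ p ] ∃[ q ] ∃[ r ] (Y ≡ p ++ q ∷ r) × (reflection a b ++ Y ≈ p ++ r) → ∃[ Y′ ] (y′ ≈ Y′) × All K Y′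
    located (p , q , r , eq , f) = p ++ r , ≈-trans (≈-sym deleted) f , All-delete p (subst (All K) eq KY)

  unique-split : ∀ (T₁ : List (Fin n)) {t T₂} → Unique (T₁ ++ t ∷ T₂) →
    All (_≢ t) (T₁ ++ T₂) × Unique (T₁ ++ T₂)
  unique-split [] (p ∷ ps) = All.map (λ ne e → ne (sym e)) p , ps
  unique-split (x ∷ T₁) {t} {T₂} (p ∷ ps) with unique-split T₁ ps | ++⁻ʳ T₁ p
  ... | q , qs | x≢t ∷ _ = x≢t ∷ q , All-delete T₁ p ∷ qs

  -- Read `Y` from the left and stop as soon as the remainder misses a letter of `T`. The letter
  -- just read is that one, and all others still occur behind it.
  last-letter : ∀ (Y T : List (Fin n)) → T ≢ [] → Unique T → All (_∈ Y) T →
    ∃[ T₁ ] ∃[ t ] ∃[ T₂ ] ∃[ Y₁ ] ∃[ Y₂ ] (T ≡ T₁ ++ t ∷ T₂) × (Y ≡ Y₁ ++ t ∷ Y₂) × (t ∉ Y₂) × All (_∈ Y₂) (T₁ ++ T₂)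
  last-letter [] [] T≢[] U A = ⊥-elim (T≢[] refl)
  last-letter [] (t ∷ T) T≢[] U (() ∷ _)
  last-letter (b ∷ Y) T T≢[] U A with All.all? (_∈? Y) T
  ... | yes A′ with last-letter Y T T≢[] U A′
  ...   | T₁ , t , T₂ , Y₁ , Y₂ , eT , eY , t∉ , rest = T₁ , t , T₂ , b ∷ Y₁ , Y₂ , eT , cong (b ∷_) eY , t∉ , rest
  last-letter (b ∷ Y) T T≢[] U A | no ¬A = found (¬All⇒∃ T A ¬A)
    where
    ¬All⇒∃ : ∀ T → All (_∈ b ∷ Y) T → ¬ All (_∈ Y) T → ∃[ T₁ ] ∃[ T₂ ] (T ≡ T₁ ++ b ∷ T₂) × b ∉ Y
    ¬All⇒∃ [] _ ¬a = ⊥-elim (¬a [])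
    ¬All⇒∃ (t ∷ T) (t∈ ∷ a) ¬a with t ∈? Y
    ... | yes t∈Y with ¬All⇒∃ T a (λ a′ → ¬a (t∈Y ∷ a′))
    ...   | T₁ , T₂ , e , b∉ = t ∷ T₁ , T₂ , cong (t ∷_) e , b∉
    ¬All⇒∃ (t ∷ T) (here refl ∷ a) ¬a | no t∉Y = [] , T , refl , t∉Y
    ¬All⇒∃ (t ∷ T) (there t∈Y ∷ a) ¬a | no t∉Y = ⊥-elim (t∉Y t∈Y)
    tail : ∀ {t} → (t ∈ b ∷ Y) × (t ≢ b) → t ∈ Y
    tail (here e , ne) = ⊥-elim (ne e)
    tail (there p , _) = p
    found : ∃[ T₁ ] ∃[ T₂ ] (T ≡ T₁ ++ b ∷ T₂) × b ∉ Y → _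
    found (T₁ , T₂ , e , b∉) = T₁ , b , T₂ , [] , Y , e , refl , b∉ ,
      All.zipWith tail (All-delete T₁ (subst (All (_∈ b ∷ Y)) e A) , proj₁ (unique-split T₁ (subst Unique e U)))

  RMin-++ : ∀ {J K z u} (K? : ∀ k → Dec (K k)) → (∀ a → J a → K a) → RMin K z → All K u → RMin J u → RMin J (z ++ u)
  RMin-++ {z = z} {u} K? J⊆K Rz Ku Ru a Ja = begin
    ℓ ((z ++ u) ++ a ∷ [])    ≡⟨ cong ℓ (++-assoc z u (a ∷ [])) ⟩
    ℓ (z ++ u ++ a ∷ [])      ≡⟨ RMin-additive K? Rz (++⁺ Ku (J⊆K a Ja ∷ [])) ⟩
    ℓ z + ℓ (u ++ a ∷ [])     ≡⟨ cong (ℓ z +_) (Ru a Ja) ⟩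
    ℓ z + suc (ℓ u)           ≡⟨ ℕ.+-suc (ℓ z) (ℓ u) ⟩
    suc (ℓ z + ℓ u)           ≡⟨ cong suc (RMin-additive K? Rz Ku) ⟨
    suc (ℓ (z ++ u))          ∎
    where open ≡-Reasoning

  occurs-in : ∀ {y k} Y → Red Y → Y ≈ y → k ∈ Y → k ∈ nf y
  occurs-in {y} Y R e k∈ = All.lookup (red-in Y (nf y) R (≈-trans e (≈-sym (nf≈ y))) (All.tabulate (λ p → p))) k∈

  occurs-all : ∀ {K : Fin n → Set} {y k} Y → y ≈ Y → All K Y → k ∈ nf y → K k
  occurs-all {K} {y} Y e KY k∈ = All.lookup (red-in (nf y) Y (nf-red y) (≈-trans (nf≈ y) e) KY) k∈

  module _ {J : Fin n → Set} (J? : ∀ a → Dec (J a)) where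

    Independent : Word → List Word → Set
    Independent y L = AllPairs (λ x x′ → ¬ x ≈ x′) L × All (λ x → Coat y x × RMin J x) L

    private
      module Step {t : Fin n} (¬Jt : ¬ J t) (y z u : Word) (y≈ : y ≈ z ++ u) (t∈y : t ∈ nf y)
        (Rz : RMin (_≢ t) z) (Ku : All (_≢ t) u) (Ry : RMin J y) where

        K : Fin n → Set
        K k = k ≢ t

        K? : ∀ k → Dec (K k)
        K? k = ¬? (k ≟ t)

        J⊆K : ∀ a → J a → K a
        J⊆K a Ja refl = ¬Jt Ja

        ℓ-zu : ℓ (z ++ u) ≡ ℓ z + ℓ u
        ℓ-zu = RMin-additive K? Rz Ku

        Ru : RMin J u
        Ru = RMin-suffix {J} {z} {u} (RMin-resp y≈ Ry) ℓ-zu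

        first : ∀ Z → Z ≡ nf z → ∃[ b ] ∃[ z⁻ ] nf z ≡ b ∷ z⁻
        -- With z trivial, y would equal u and avoid the letter t, which occurs in it.
        first [] e = ⊥-elim (occurs-all u (≈-trans y≈ (++-congʳ u (≈-trans (≈-sym (nf≈ z)) (≡⇒≈ (sym e))))) Ku t∈y refl)
        first (b ∷ z⁻) e = b , z⁻ , sym e

        b : Fin n
        b = proj₁ (first (nf z) refl)
        z⁻ : Word
        z⁻ = proj₁ (proj₂ (first (nf z) refl))
        z≈ : z ≈ b ∷ z⁻
        z≈ = ≈-trans (≈-sym (nf≈ z)) (≡⇒≈ (proj₂ (proj₂ (first (nf z) refl))))
        R-bz⁻ : Red (b ∷ z⁻)
        R-bz⁻ = subst Red (proj₂ (proj₂ (first (nf z) refl))) (nf-red z)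
        ℓz : ℓ z ≡ suc (ℓ z⁻)
        ℓz = trans (ℓ-cong z≈) (trans (red⇒ℓ R-bz⁻) (cong suc (sym (red⇒ℓ (red-suffix (b ∷ []) R-bz⁻)))))
        Rz⁻ : RMin K z⁻
        Rz⁻ = RMin-suffix {K} {b ∷ []} {z⁻} (RMin-resp z≈ Rz)
          (trans (ℓ-cong (≈-sym z≈)) (trans ℓz (cong (_+ ℓ z⁻) (sym (ℓ-singleton b)))))

        head-coat : Coat y (z⁻ ++ u)
        head-coat = [] , b , z⁻ ++ u , ≈-trans y≈ (++-congʳ u z≈) , ≈-refl ,
          trans (ℓ-cong y≈) (trans ℓ-zu (trans (cong (_+ ℓ u) ℓz) (cong suc (sym (RMin-additive K? Rz⁻ Ku)))))

        lift : ∀ {u′} → Coat u u′ × RMin J u′ → Coat y (z ++ u′) × RMin J (z ++ u′) × ¬ (z⁻ ++ u ≈ z ++ u′)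
        lift {u′} (cu@(p , q , r , e , e′ , len) , R′) = inner (coat-in u ≈-refl Ku cu)
          where
          inner : ∃[ U ] (u′ ≈ U) × All K U → Coat y (z ++ u′) × RMin J (z ++ u′) × ¬ (z⁻ ++ u ≈ z ++ u′)
          inner (U , u′≈U , KU) =
            (z ++ p , q , r , ≈-trans y≈ (≈-trans (++-congˡ z e) (≡⇒≈ (sym (++-assoc z p (q ∷ r))))) ,
              ≈-trans (++-congˡ z e′) (≡⇒≈ (sym (++-assoc z p r))) , ℓeq) ,
            RMin-resp (++-congˡ z (≈-sym u′≈U)) (RMin-++ K? J⊆K Rz KU (RMin-resp u′≈U R′)) ,
            λ eq → ℕ.1+n≢n (trans (sym ℓz) (ℓ-cong (≈-sym (RMin-unique K? Rz⁻ Rz Ku KU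
              (≈-trans eq (++-congˡ z u′≈U))))))
            where
            open ≡-Reasoning
            ℓeq : ℓ y ≡ suc (ℓ (z ++ u′))
            ℓeq = begin
              ℓ y                    ≡⟨ trans (ℓ-cong y≈) ℓ-zu ⟩
              ℓ z + ℓ u              ≡⟨ cong (ℓ z +_) len ⟩
              ℓ z + suc (ℓ u′)       ≡⟨ ℕ.+-suc (ℓ z) (ℓ u′) ⟩
              suc (ℓ z + ℓ u′)       ≡⟨ cong (λ h → suc (ℓ z + h)) (ℓ-cong u′≈U) ⟩
              suc (ℓ z + ℓ U)        ≡⟨ cong suc (RMin-additive K? Rz KU) ⟨
              suc (ℓ (z ++ U))       ≡⟨ cong suc (ℓ-cong (++-congˡ z (≈-sym u′≈U))) ⟩
              suc (ℓ (z ++ u′))      ∎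

        -- Coatoms z u′ come from coatoms u′ of u, and one more arises by dropping the first letter
        -- of z. The latter is new because its representative in W^K is shorter than z.
        extend : ∀ L → Independent u L → Independent y ((z⁻ ++ u) ∷ map (z ++_) L)
        extend L (pairs , coats) =
          map⁺ (All.map (λ c → proj₂ (proj₂ (lift c))) coats) ∷
            AllPairs.map⁺ (AllPairs.map (λ ¬e e → ¬e (++-cancel z e)) pairs) ,
          (head-coat , RMin-++ K? J⊆K Rz⁻ Ku Ru) ∷
            map⁺ (All.map (λ c → proj₁ (lift c) , proj₁ (proj₂ (lift c))) coats)

    -- Split off the letter t of T whose last occurrence in a reduced word of y comes first: the factor
    -- of y in W_{S∖t} still contains all other letters of T.
    coatoms : ∀ k T → length T ≡ k → ∀ y → RMin J y → Unique T → All (λ t → (t ∈ nf y) × ¬ J t) T →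
      ∃[ L ] (length L ≡ k) × Independent y L
    coatoms zero T _ y R U A = [] , refl , [] , []
    coatoms (suc k) T lenT y R U A = build (last-letter (nf y) T T≢[] U (All.map proj₁ A))
      where
      T≢[] : T ≢ []
      T≢[] refl = ℕ.0≢1+n lenT
      build : ∃[ T₁ ] ∃[ t ] ∃[ T₂ ] ∃[ Y₁ ] ∃[ Y₂ ] (T ≡ T₁ ++ t ∷ T₂) × (nf y ≡ Y₁ ++ t ∷ Y₂) × (t ∉ Y₂) × All (_∈ Y₂) (T₁ ++ T₂) →
        ∃[ L ] (length L ≡ suc k) × Independent y L
      build (T₁ , t , T₂ , Y₁ , Y₂ , eT , eY , t∉ , rest) = assemble (decomposeʳ K? (Y₁ ++ t ∷ []))
        where
        K : Fin n → Set
        K = _≢ t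
        K? : ∀ k → Dec (K k)
        K? k = ¬? (k ≟ t)
        KY₂ : All K Y₂
        KY₂ = All.tabulate λ p e → t∉ (subst (_∈ Y₂) e p)
        eY′ : nf y ≡ (Y₁ ++ t ∷ []) ++ Y₂
        eY′ = trans eY (sym (++-assoc Y₁ (t ∷ []) Y₂))
        t-info : All (λ t → (t ∈ nf y) × ¬ J t) (t ∷ T₂)
        t-info = ++⁻ʳ T₁ (subst (All _) eT A)
        assemble : ∃[ z ] ∃[ u ] (Y₁ ++ t ∷ [] ≈ z ++ u) × RMin K z × All K u × (ℓ (Y₁ ++ t ∷ []) ≡ ℓ z + ℓ u) →
          ∃[ L ] (length L ≡ suc k) × Independent y L
        assemble (z , u , e , Rz , Ku , len) = finish (coatoms k (T₁ ++ T₂) lenT′ (u ++ Y₂) S.Ru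
            (proj₂ (unique-split T₁ (subst Unique eT U))) (All.zipWith occ (rest , All-delete T₁ (subst (All _) eT A))))
          where
          open ≡-Reasoning
          y≈ : y ≈ z ++ u ++ Y₂
          y≈ = ≈-trans (≈-sym (nf≈ y)) (≈-trans (≡⇒≈ eY′)
            (≈-trans (++-congʳ Y₂ e) (≡⇒≈ (++-assoc z u Y₂))))
          module S = Step (proj₂ (All.head t-info)) y z (u ++ Y₂) y≈ (proj₁ (All.head t-info)) Rz (++⁺ Ku KY₂) R
          lenT′ : length (T₁ ++ T₂) ≡ k
          lenT′ = ℕ.suc-injective (trans (sym (length-delete T₁ t T₂)) (trans (cong length (sym eT)) lenT))
          R-pre : Red ((Y₁ ++ t ∷ []) ++ Y₂)
          R-pre = subst Red eY′ (nf-red y)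
          R-uY₂ : Red (nf u ++ Y₂)
          R-uY₂ = red-suffix (nf z) (red-≈ {nf y} (≈-trans (nf≈ y) (≈-trans y≈
              (++-cong (≈-sym (nf≈ z)) (++-congʳ Y₂ (≈-sym (nf≈ u)))))) (begin
            length (nf z ++ nf u ++ Y₂)            ≡⟨ length-++ (nf z) ⟩
            ℓ z + length (nf u ++ Y₂)              ≡⟨ cong (ℓ z +_) (length-++ (nf u)) ⟩
            ℓ z + (ℓ u + length Y₂)                ≡⟨ ℕ.+-assoc (ℓ z) (ℓ u) (length Y₂) ⟨
            ℓ z + ℓ u + length Y₂                  ≡⟨ cong (_+ length Y₂) len ⟨
            ℓ (Y₁ ++ t ∷ []) + length Y₂           ≡⟨ cong (_+ length Y₂) (red⇒ℓ (red-prefix Y₂ R-pre)) ⟩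
            length (Y₁ ++ t ∷ []) + length Y₂      ≡⟨ length-++ (Y₁ ++ t ∷ []) ⟨
            length ((Y₁ ++ t ∷ []) ++ Y₂)          ≡⟨ cong length eY′ ⟨
            length (nf y)                          ∎) (nf-red y))
          occ : ∀ {t′} → (t′ ∈ Y₂) × (t′ ∈ nf y) × ¬ J t′ → (t′ ∈ nf (u ++ Y₂)) × ¬ J t′
          occ (p , _ , ¬Jt′) = occurs-in (nf u ++ Y₂) R-uY₂ (++-congʳ Y₂ (nf≈ u)) (∈-++⁺ʳ (nf u) p) , ¬Jt′
          finish : ∃[ L ] (length L ≡ k) × Independent (u ++ Y₂) L → ∃[ L ] (length L ≡ suc k) × Independent y L
          finish (L , lenL , ind) = (S.z⁻ ++ u ++ Y₂) ∷ map (z ++_) L ,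
            cong suc (trans (length-map (z ++_) L) lenL) , S.extend L ind

-- Bruhat order: lifting and subwords.

module Bruhat {n : ℕ} (M : CoxeterMatrix n) where
  open Coxeter M
  open Words M
  open Decidability M
  open LengthFunction M
  open Parabolic M
  open Coatoms M
  open import Data.List.Membership.Propositional using (_∈_)

  len : ∀ x → Len x (ℓ x)
  len x = nf x , nf≈ x , refl , λ z e → ℓ-min e

  len-unique : ∀ {x k} → Len x k → k ≡ ℓ x
  len-unique {x} (y , y≈x , leny , min) = ℕ.≤-antisym (min (nf x) (nf≈ x)) (subst (ℓ x ≤_) leny (ℓ-min y≈x))

  <⇒ℓ< : ∀ {x y} → ℓ x < ℓ y → x ℓ< y
  <⇒ℓ< lt a b la lb = subst₂ _<_ (sym (len-unique la)) (sym (len-unique lb)) lt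

  ℓ<⇒< : ∀ {x y} → x ℓ< y → ℓ x < ℓ y
  ℓ<⇒< {x} {y} lt = lt (ℓ x) (ℓ y) (len x) (len y)

  ≤B-respʳ : ∀ {x y z} → y ≈ z → x ≤B y → x ≤B z
  ≤B-respʳ e (≤B-refl f) = ≤B-refl (≈-trans f e)
  ≤B-respʳ e (≤B-step b (p , s , f , lt)) =
    ≤B-step b (p , s , ≈-trans (≈-sym e) f , <⇒ℓ< (subst (_ <_) (ℓ-cong e) (ℓ<⇒< lt)))

  ≤B-respˡ : ∀ {x y z} → x ≈ y → x ≤B z → y ≤B z
  ≤B-respˡ e (≤B-refl f) = ≤B-refl (≈-trans (≈-sym e) f)
  ≤B-respˡ e (≤B-step b st) = ≤B-step (≤B-respˡ e b) st

  ≤B-trans : ∀ {x y z} → x ≤B y → y ≤B z → x ≤B z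
  ≤B-trans a (≤B-refl e) = ≤B-respʳ e a
  ≤B-trans a (≤B-step b st) = ≤B-step (≤B-trans a b) st

  ≤B-ℓ : ∀ {x y} → x ≤B y → ℓ x ≤ ℓ y
  ≤B-ℓ (≤B-refl e) = ℕ.≤-reflexive (ℓ-cong e)
  ≤B-ℓ (≤B-step b (_ , _ , _ , lt)) = ℕ.≤-trans (≤B-ℓ b) (ℕ.<⇒≤ (ℓ<⇒< lt))

  ≤B-antisym : ∀ {x y} → x ≤B y → ℓ y ≤ ℓ x → x ≈ y
  ≤B-antisym (≤B-refl e) _ = e
  ≤B-antisym (≤B-step b (_ , _ , _ , lt)) le = ⊥-elim (ℕ.<⇒≱ (ℓ<⇒< lt) (ℕ.≤-trans le (≤B-ℓ b)))

  ≤B-delete : ∀ {x y} a b c → y ≈ a ++ b ∷ c → x ≈ a ++ c → ℓ x < ℓ y → x ≤B y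
  ≤B-delete {x} {y} a b c e f lt = ≤B-step (≤B-refl ≈-refl) (reverse c , b , y≈ , <⇒ℓ< lt)
    where
    y≈ : y ≈ x ++ reflection (reverse c) b
    y≈ = begin
      y                                            ≈⟨ e ⟩
      a ++ b ∷ c                                   ≈⟨ ++-congˡ a (++-congʳ (b ∷ c) (reverse-inverseʳ c)) ⟨
      a ++ (c ++ reverse c) ++ b ∷ c               ≡⟨ cong (a ++_) (++-assoc c (reverse c) (b ∷ c)) ⟩
      a ++ c ++ reverse c ++ b ∷ c                 ≡⟨ ++-assoc a c (reverse c ++ b ∷ c) ⟨
      (a ++ c) ++ reverse c ++ b ∷ c               ≈⟨ ++-congʳ (reverse c ++ b ∷ c) f ⟨
      x ++ reverse c ++ b ∷ c                      ≡⟨ cong (λ h → x ++ reverse c ++ b ∷ h) (reverse-involutive c) ⟨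
      x ++ reflection (reverse c) b                ∎
      where open ≈-Reasoning

  step-inverse : ∀ {x y} p s → y ≈ x ++ reflection p s → x ≈ y ++ reflection p s
  step-inverse {x} {y} p s e = begin
    x                                               ≡⟨ ++-identityʳ x ⟨
    x ++ []                                         ≈⟨ ++-congˡ x (reflection-square p s) ⟨
    x ++ reflection p s ++ reflection p s           ≡⟨ ++-assoc x (reflection p s) (reflection p s) ⟨
    (x ++ reflection p s) ++ reflection p s         ≈⟨ ++-congʳ (reflection p s) e ⟨
    y ++ reflection p s                             ∎
    where open ≈-Reasoning

  step-delete : ∀ {x y} Y → BruhatStep x y → y ≈ Y → ∃[ a ] ∃[ b ] ∃[ c ] (Y ≡ a ++ b ∷ c) × (x ≈ a ++ c)
  step-delete {x} {y} Y (p , s , e , lt) y≈Y = found (strong-exchangeʳ p s Y shorter)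
    where
    x≈ : x ≈ Y ++ reflection p s
    x≈ = ≈-trans (step-inverse p s e) (++-congʳ (reflection p s) y≈Y)
    shorter : ℓ (Y ++ reflection p s) < ℓ Y
    shorter = subst₂ _<_ (ℓ-cong x≈) (ℓ-cong y≈Y) (ℓ<⇒< lt)
    found : ∃[ a ] ∃[ b ] ∃[ c ] (Y ≡ a ++ b ∷ c) × (Y ++ reflection p s ≈ a ++ c) →
      ∃[ a ] ∃[ b ] ∃[ c ] (Y ≡ a ++ b ∷ c) × (x ≈ a ++ c)
    found (a , b , c , eq , f) = a , b , c , eq , ≈-trans x≈ f

  snoc-snoc : ∀ x s → (x ++ s ∷ []) ++ s ∷ [] ≈ x
  snoc-snoc x s = ≈-trans (≡⇒≈ (++-assoc x (s ∷ []) (s ∷ []))) (≈-trans (++-congˡ x (ss-cancel s [])) (≡⇒≈ (++-identityʳ x)))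

  ≤B-snoc-up : ∀ {x s} → ℓ x < ℓ (x ++ s ∷ []) → x ≤B x ++ s ∷ []
  ≤B-snoc-up {x} {s} lt = ≤B-delete x s [] ≈-refl (≡⇒≈ (sym (++-identityʳ x))) lt

  ≤B-snoc-down : ∀ {x s} → ℓ (x ++ s ∷ []) < ℓ x → x ++ s ∷ [] ≤B x
  ≤B-snoc-down {x} {s} lt = ≤B-delete (x ++ s ∷ []) s [] (≈-sym (snoc-snoc x s)) (≡⇒≈ (sym (++-identityʳ _))) lt

  snoc-< : ∀ x s → (ℓ x < ℓ (x ++ s ∷ [])) ⊎ (ℓ (x ++ s ∷ []) < ℓ x)
  snoc-< x s with ascentʳ? x s
  ... | inj₁ e = inj₁ (ℕ.≤-reflexive (sym e))
  ... | inj₂ e = inj₂ (ℕ.≤-reflexive (sym e))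

  -- The lifting property, by induction along the chain. The delicate case is a step y′ < y with ys
  -- < y and y′ < y′s. In a reduced word of y ending in s, the step deletes either that s, and then
  -- y′s = y, or an earlier letter, and then y′s is below ys.
  lift-down : ∀ {x y s} → x ≤B y → ℓ (y ++ s ∷ []) < ℓ y → x ++ s ∷ [] ≤B y
  lift-up : ∀ {x y s} → x ≤B y → ℓ y < ℓ (y ++ s ∷ []) → x ++ s ∷ [] ≤B y ++ s ∷ []

  lift-down {x} {y} {s} (≤B-refl e) lt = ≤B-respˡ (++-congʳ (s ∷ []) (≈-sym e)) (≤B-snoc-down lt)
  lift-down {x} {y} {s} (≤B-step {y = y′} b st@(p , r , e , y′<y)) lt with snoc-< y′ s
  ... | inj₂ y′s< = ≤B-step (lift-down b y′s<) st
  ... | inj₁ y′s> = ≤B-trans (lift-up b y′s>) (compare (step-delete (ys ++ s ∷ []) st (≈-trans (≈-sym (snoc-snoc y s)) (++-congʳ (s ∷ []) (≈-sym (nf≈ _))))))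
    where
    ys : Word
    ys = nf (y ++ s ∷ [])
    compare : ∃[ a ] ∃[ b ] ∃[ c ] (ys ++ s ∷ [] ≡ a ++ b ∷ c) × (y′ ≈ a ++ c) → y′ ++ s ∷ [] ≤B y
    compare (a , b , c , eq , f) with ++-split a ys (sym eq)
    ... | inj₁ (c′ , eqys , refl) = ≤B-trans
        (≤B-delete a b c′ (≈-trans (≈-sym (nf≈ _)) (≡⇒≈ eqys)) y′s≈ (ℕ.≤-trans (s≤s (ℓ-min (≈-sym y′s≈)))
          (ℕ.≤-reflexive (trans (sym (length-delete a b c′)) (cong length (sym eqys))))))
        (≤B-snoc-down lt)
      where
      y′s≈ : y′ ++ s ∷ [] ≈ a ++ c′
      y′s≈ = ≈-trans (++-congʳ (s ∷ []) (≈-trans f (≡⇒≈ (sym (++-assoc a c′ (s ∷ [])))))) (snoc-snoc (a ++ c′) s)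
    ... | inj₂ ([] , eqa , refl) = ≤B-refl (≈-trans (++-congʳ (s ∷ []) (≈-trans f
          (≈-trans (≡⇒≈ (trans (++-identityʳ a) (trans eqa (++-identityʳ ys)))) (nf≈ _)))) (snoc-snoc y s))
    ... | inj₂ (_ ∷ [] , _ , ())
    ... | inj₂ (_ ∷ _ ∷ _ , _ , ())

  lift-up {x} {y} {s} (≤B-refl e) lt = ≤B-refl (++-congʳ (s ∷ []) e)
  lift-up {x} {y} {s} (≤B-step {y = y′} b st@(p , r , e , y′<y)) lt with snoc-< y′ s
  ... | inj₂ y′s< = ≤B-trans (≤B-step (lift-down b y′s<) st) (≤B-snoc-up lt)
  ... | inj₁ y′s> = ≤B-step (lift-up b y′s>) (s ∷ p , r , ys≈ , <⇒ℓ< (subst₂ _<_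
          (sym (up y′ y′s>)) (sym (up y lt)) (s≤s (ℓ<⇒< y′<y))))
    where
    up : ∀ z → ℓ z < ℓ (z ++ s ∷ []) → ℓ (z ++ s ∷ []) ≡ suc (ℓ z)
    up z z< with ascentʳ? z s
    ... | inj₁ eq = eq
    ... | inj₂ eq = ⊥-elim (ℕ.<⇒≱ z< (subst (ℓ (z ++ s ∷ []) ≤_) (sym eq) (ℕ.n≤1+n _)))
    ys≈ : y ++ s ∷ [] ≈ (y′ ++ s ∷ []) ++ reflection (s ∷ p) r
    ys≈ = begin
      y ++ s ∷ []                                       ≈⟨ ++-congʳ (s ∷ []) e ⟩
      (y′ ++ reflection p r) ++ s ∷ []                  ≡⟨ ++-assoc y′ (reflection p r) (s ∷ []) ⟩
      y′ ++ reflection p r ++ s ∷ []                    ≈⟨ ++-congˡ y′ (ss-cancel s _) ⟨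
      y′ ++ s ∷ s ∷ reflection p r ++ s ∷ []            ≡⟨ ++-assoc y′ (s ∷ []) _ ⟨
      (y′ ++ s ∷ []) ++ s ∷ reflection p r ++ s ∷ []    ≡⟨ cong ((y′ ++ s ∷ []) ++_) (reflection-++ (s ∷ []) p r) ⟨
      (y′ ++ s ∷ []) ++ reflection (s ∷ p) r            ∎
      where open ≈-Reasoning

  infix 4 _⊑_
  data _⊑_ : Word → Word → Set where
    []   : [] ⊑ []
    skip : ∀ {x y} s → x ⊑ y → x ⊑ s ∷ y
    keep : ∀ {x y} s → x ⊑ y → s ∷ x ⊑ s ∷ y

  ⊑-refl : ∀ x → x ⊑ x
  ⊑-refl [] = []
  ⊑-refl (s ∷ x) = keep s (⊑-refl x)

  ⊑-trans : ∀ {x y z} → x ⊑ y → y ⊑ z → x ⊑ z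
  ⊑-trans p [] = p
  ⊑-trans p (skip s q) = skip s (⊑-trans p q)
  ⊑-trans (skip .s p) (keep s q) = skip s (⊑-trans p q)
  ⊑-trans (keep .s p) (keep s q) = keep s (⊑-trans p q)

  ⊑-delete : ∀ a b c → a ++ c ⊑ a ++ b ∷ c
  ⊑-delete [] b c = skip b (⊑-refl c)
  ⊑-delete (s ∷ a) b c = keep s (⊑-delete a b c)

  ⊑-++⁻ : ∀ {x} p {q} → x ⊑ p ++ q → ∃[ x₁ ] ∃[ x₂ ] (x ≡ x₁ ++ x₂) × (x₁ ⊑ p) × (x₂ ⊑ q)
  ⊑-++⁻ {x} [] h = [] , x , refl , [] , h
  ⊑-++⁻ (s ∷ p) (skip .s h) with ⊑-++⁻ p h
  ... | x₁ , x₂ , e , a , b = x₁ , x₂ , e , skip s a , b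
  ⊑-++⁻ (s ∷ p) (keep .s h) with ⊑-++⁻ p h
  ... | x₁ , x₂ , e , a , b = s ∷ x₁ , x₂ , cong (s ∷_) e , keep s a , b

  ⊑-All : ∀ {K : Fin n → Set} {x y} → x ⊑ y → All K y → All K x
  ⊑-All [] [] = []
  ⊑-All (skip s p) (_ ∷ ks) = ⊑-All p ks
  ⊑-All (keep s p) (k ∷ ks) = k ∷ ⊑-All p ks

  reduce-⊑ : ∀ x → ∃[ y ] (y ⊑ x) × (y ≈ x) × Red y
  reduce-⊑ [] = [] , [] , ≈-refl , λ _ _ → z≤n
  reduce-⊑ (s ∷ x) with reduce-⊑ x
  ... | y , y⊑x , y≈x , R with D? s y
  ...   | no ¬d = s ∷ y , keep s y⊑x , ∷-cong s y≈x , ℓ⇒red (trans (¬D⇒ascent ¬d) (cong suc (red⇒ℓ R)))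
  ...   | yes d = found (exchange y d)
    where
    found : ∃[ a ] ∃[ b ] ∃[ c ] (y ≡ a ++ b ∷ c) × (s ∷ y ≈ a ++ c) → ∃[ z ] (z ⊑ s ∷ x) × (z ≈ s ∷ x) × Red z
    found (a , b , c , refl , f) = a ++ c , skip s (⊑-trans (⊑-delete a b c) y⊑x) , ≈-trans (≈-sym f) (∷-cong s y≈x) ,
      ℓ⇒red (ℕ.suc-injective (trans (cong suc (ℓ-cong (≈-sym f))) (trans (sym d) (trans (red⇒ℓ R) (length-delete a b c)))))

  reverse-delete : ∀ (a : Word) b c → reverse (a ++ b ∷ c) ≡ reverse c ++ b ∷ reverse a
  reverse-delete a b c = trans (reverse-++ a (b ∷ c)) (reverse-∷-++ b c (reverse a))

  -- `Y` spells y backwards: lifting adds letters on the right, whereas lists grow on the left.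
  ≤B⇒subword : ∀ {x y} Y → x ≤B y → y ≈ reverse Y → ∃[ X ] (X ⊑ Y) × (x ≈ reverse X)
  ≤B⇒subword Y (≤B-refl e) y≈ = Y , ⊑-refl Y , ≈-trans e y≈
  ≤B⇒subword {x} {y} Y (≤B-step {y = y′} b st) y≈ = found (step-delete (reverse Y) st y≈)
    where
    found : ∃[ a ] ∃[ b ] ∃[ c ] (reverse Y ≡ a ++ b ∷ c) × (y′ ≈ a ++ c) → ∃[ X ] (X ⊑ Y) × (x ≈ reverse X)
    found (a , c , d , eq , f) with ≤B⇒subword (reverse d ++ reverse a) b
      (≈-trans f (≡⇒≈ (sym (trans (cong reverse (sym (reverse-++ a d))) (reverse-involutive (a ++ d))))))
    ... | X , X⊑ , e = X , ⊑-trans X⊑ (subst (reverse d ++ reverse a ⊑_)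
        (trans (sym (reverse-delete a c d)) (trans (cong reverse (sym eq)) (reverse-involutive Y)))
        (⊑-delete (reverse d) c (reverse a))) , e

  subword⇒≤B : ∀ {X Y} → X ⊑ Y → Red (reverse Y) → reverse X ≤B reverse Y
  subword⇒≤B [] R = ≤B-refl ≈-refl
  subword⇒≤B {X} {s ∷ Y} (skip s h) R = subst (reverse X ≤B_) (sym (reverse-∷ s Y))
    (≤B-trans (subword⇒≤B h R′) (≤B-snoc-up ascending))
    where
    R⁺ : Red (reverse Y ++ s ∷ [])
    R⁺ = subst Red (reverse-∷ s Y) R
    R′ : Red (reverse Y)
    R′ = red-prefix (s ∷ []) R⁺
    ascending : ℓ (reverse Y) < ℓ (reverse Y ++ s ∷ [])
    ascending = ℕ.≤-reflexive (trans (cong suc (red⇒ℓ R′)) (sym (trans (red⇒ℓ R⁺)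
      (trans (length-++ (reverse Y)) (ℕ.+-comm (length (reverse Y)) 1)))))
  subword⇒≤B {s ∷ X} {s ∷ Y} (keep s h) R = subst₂ _≤B_ (sym (reverse-∷ s X)) (sym (reverse-∷ s Y))
    (lift-up (subword⇒≤B h R′) ascending)
    where
    R⁺ : Red (reverse Y ++ s ∷ [])
    R⁺ = subst Red (reverse-∷ s Y) R
    R′ : Red (reverse Y)
    R′ = red-prefix (s ∷ []) R⁺
    ascending : ℓ (reverse Y) < ℓ (reverse Y ++ s ∷ [])
    ascending = ℕ.≤-reflexive (trans (cong suc (red⇒ℓ R′)) (sym (trans (red⇒ℓ R⁺)
      (trans (length-++ (reverse Y)) (ℕ.+-comm (length (reverse Y)) 1)))))

  ∈-reverse : ∀ {s : Fin n} {x} → s ∈ x → s ∈ reverse x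
  ∈-reverse {x = x} p = All.lookup (subst (All (_∈ reverse x)) (reverse-involutive x) (reverse⁺ {x = reverse x} (All.tabulate (λ q → q)))) p

  supp⇒∈nf : ∀ {w s} → InSupp w s → s ∈ nf w
  supp⇒∈nf {w} {s} h = found (≤B⇒subword (reverse (nf w)) h (≈-trans (≈-sym (nf≈ w)) (≡⇒≈ (sym (reverse-involutive (nf w))))))
    where
    found : ∃[ X ] (X ⊑ reverse (nf w)) × (s ∷ [] ≈ reverse X) → s ∈ nf w
    found (X , X⊑ , e) = All.head (red-in (s ∷ []) (reverse X) (ℓ⇒red (ℓ-singleton s)) e
      (reverse⁺ (⊑-All X⊑ (reverse⁺ {x = nf w} (All.tabulate (λ q → q))))))

  -- A subword of u v lying in W_J is a subword of u followed by letters of supp(v) ∩ J,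
  -- which are absorbed one at a time by lifting.
  below-in-parabolic : ∀ {J : Fin n → Set} {w u v} → w ≈ u ++ v → All J (nf u) →
    (∀ k → J k → k ∈ nf v → ℓ (u ++ k ∷ []) < ℓ u) →
    ∀ {y} Y → y ≤B w → Y ≈ y → All J Y → y ≤B u
  below-in-parabolic {J} {w} {u} {v} w≈ Ju absorb {y} Y y≤w Y≈y JY =
    found (≤B⇒subword (reverse (nf v) ++ reverse (nf u)) y≤w w≈rev)
    where
    w≈rev : w ≈ reverse (reverse (nf v) ++ reverse (nf u))
    w≈rev = ≈-trans w≈ (≈-trans (++-cong (≈-sym (nf≈ u)) (≈-sym (nf≈ v)))
      (≡⇒≈ (trans (sym (reverse-involutive (nf u ++ nf v))) (cong reverse (reverse-++ (nf u) (nf v))))))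
    absorb-all : ∀ x z → x ≤B u → All (λ k → J k × k ∈ nf v) z → x ++ z ≤B u
    absorb-all x [] h [] = subst (_≤B u) (sym (++-identityʳ x)) h
    absorb-all x (k ∷ z) h ((Jk , k∈) ∷ ks) = subst (_≤B u) (++-assoc x (k ∷ []) z)
      (absorb-all (x ++ k ∷ []) z (lift-down h (absorb k Jk k∈)) ks)
    found : ∃[ X ] (X ⊑ reverse (nf v) ++ reverse (nf u)) × (y ≈ reverse X) → y ≤B u
    found (X , X⊑ , y≈) with reduce-⊑ X
    ... | Z , Z⊑X , Z≈X , RZ with ⊑-++⁻ (reverse (nf v)) (⊑-trans Z⊑X X⊑)
    ...   | Z₁ , Z₂ , refl , Z₁⊑ , Z₂⊑ = ≤B-respˡ
        (≈-trans (≡⇒≈ (sym (reverse-++ Z₁ Z₂))) (≈-trans (reverse-cong Z≈X) (≈-sym y≈)))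
        (absorb-all (reverse Z₂) (reverse Z₁)
          (≤B-respʳ (≈-trans (≡⇒≈ (reverse-involutive (nf u))) (nf≈ u))
            (subword⇒≤B Z₂⊑ (subst Red (sym (reverse-involutive (nf u))) (nf-red u))))
          (reverse⁺ (All.zip (++⁻ˡ Z₁ JZ , ⊑-All Z₁⊑ (reverse⁺ {x = nf v} (All.tabulate (λ q → q)))))))
      where
      JZ : All J (Z₁ ++ Z₂)
      JZ = red-in (Z₁ ++ Z₂) (reverse Y) RZ
        (≈-trans Z≈X (subst (_≈ reverse Y) (reverse-involutive X) (reverse-cong (≈-trans (≈-sym y≈) (≈-sym Y≈y)))))
        (reverse⁺ JY)

-- Descents and walls among three pairwise non-commuting generators.

module RankThree {n : ℕ} (M : CoxeterMatrix n) where
  open CoxeterMatrix M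
  open Coxeter M
  open Words M
  open Decidability M
  open LengthFunction M
  open Parabolic M

  ≤∞-sym : ∀ {k s t} → k ≤∞ m s t → k ≤∞ m t s
  ≤∞-sym {k} {s} {t} = subst (k ≤∞_) (m-sym s t)

  ≤∞-split : ∀ k μ → k ≤∞ μ → (μ ≡ fin k) ⊎ (suc k ≤∞ μ)
  ≤∞-split k ∞ _ = inj₂ tt
  ≤∞-split k (fin j) p with ℕ.m≤n⇒m<n∨m≡n p
  ... | inj₁ lt = inj₂ lt
  ... | inj₂ eq = inj₁ (cong fin (sym eq))

  ≥3⇒≢ : ∀ {s t} → 3 ≤∞ m s t → s ≢ t
  ≥3⇒≢ {s} p refl with subst (3 ≤∞_) (m-diag s) p
  ... | s≤s ()

  -- Two descents force an alternating prefix of length m(s,t) in either order. This family reads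
  -- off which descent remains after its first letters are stripped.
  D-both₂ : ∀ {s t x} → s ≢ t → D s x → D t x → D t (s ∷ x)
  D-both₂ {s} {t} s≢t ds dt = alt-D {0} {t} {s} (alt-tail {1} {s} {t} (D-alt s≢t ds dt 2 (m-off _ _ s≢t)))

  D-both₃ : ∀ {s t x} → 3 ≤∞ m s t → D s x → D t x → D s (t ∷ s ∷ x)
  D-both₃ {s} {t} b ds dt = alt-D {0} {s} {t} (alt-tail {1} {t} {s} (alt-tail {2} {s} {t} (D-alt (≥3⇒≢ b) ds dt 3 b)))

  D-both₄ : ∀ {s t x} → 4 ≤∞ m s t → D s x → D t x → D t (s ∷ t ∷ s ∷ x)
  D-both₄ {s} {t} b ds dt = alt-D {0} {t} {s} (alt-tail {1} {s} {t} (alt-tail {2} {t} {s} (alt-tail {3} {s} {t}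
    (D-alt (≥3⇒≢ (≤∞-trans (m s t) (ℕ.n≤1+n 3) b)) ds dt 4 b))))

  -- The wall of the simple reflection a passes along x : q x = x a.
  record Shift (a : Fin n) (x : Word) (q : Fin n) : Set where
    constructor _,_
    field
      shifts : q ∷ x ≈ x ++ a ∷ []
      ascends : ¬ D q x
  open Shift public

  Shift-resp : ∀ {a x y q} → x ≈ y → Shift a x q → Shift a y q
  Shift-resp {a} {q = q} e (s , ¬d) =
    ≈-trans (∷-cong q (≈-sym e)) (≈-trans s (++-congʳ (a ∷ []) e)) , λ d → ¬d (D-resp (≈-sym e) d)

  -- c q x = c x a is at most one longer than c x, while q x is two longer than c x.
  shift-D : ∀ {a x q c} → Shift a x q → D c x → D c (q ∷ x)
  shift-D {a} {x} {q} {c} (e , ¬d) dc = <⇒D (begin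
    suc (ℓ (c ∷ q ∷ x))          ≡⟨ cong suc (ℓ-cong (∷-cong c e)) ⟩
    suc (ℓ (c ∷ x ++ a ∷ []))    ≤⟨ s≤s (ℓ-++ (c ∷ x) (a ∷ [])) ⟩
    suc (ℓ (c ∷ x) + ℓ (a ∷ [])) ≡⟨ cong (λ h → suc (ℓ (c ∷ x) + h)) (ℓ-singleton a) ⟩
    suc (ℓ (c ∷ x) + 1)          ≡⟨ cong suc (ℕ.+-comm (ℓ (c ∷ x)) 1) ⟩
    suc (suc (ℓ (c ∷ x)))        ≡⟨ cong suc dc ⟨
    suc (ℓ x)                    ≡⟨ ¬D⇒ascent ¬d ⟨
    ℓ (q ∷ x)                    ∎)
    where open ℕ.≤-Reasoning

  shift-≢ : ∀ {a x q c} → Shift a x q → D c x → q ≢ c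
  shift-≢ (_ , ¬d) dc refl = ¬d dc

  -- Both q and c are descents of q x, whose alternating prefix may be taken to start with q;
  -- removing that q leaves a prefix of x.
  shift-alt : ∀ {a x q c} → Shift a x q → D c x → ∀ j → suc j ≤∞ m q c → Alt j c q x
  shift-alt {x = x} {q} s@(_ , ¬d) dc j b = Alt-resp (ss-cancel q x)
    (alt-tail (D-alt (shift-≢ s dc) (D-flip ¬d) (shift-D s dc) (suc j) b))

  shift-finite : ∀ {a x q c} → Shift a x q → D c x → m q c ≢ ∞
  shift-finite s@(_ , ¬d) dc = D-finite (shift-≢ s dc) (D-flip ¬d) (shift-D s dc)

  shift-D₃ : ∀ {a x q c} → 3 ≤∞ m q c → Shift a x q → D c x → D q (c ∷ x)
  shift-D₃ {q = q} {c} b s dc = alt-D {0} {q} {c} (alt-tail {1} {c} {q} (shift-alt s dc 2 b))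

  shift-D₄ : ∀ {a x q c} → 4 ≤∞ m q c → Shift a x q → D c x → D c (q ∷ c ∷ x)
  shift-D₄ {q = q} {c} b s dc = alt-D {0} {c} {q} (alt-tail {1} {q} {c} (alt-tail {2} {c} {q} (shift-alt s dc 3 b)))

  shift-D₅ : ∀ {a x q c} → 5 ≤∞ m q c → Shift a x q → D c x → D q (c ∷ q ∷ c ∷ x)
  shift-D₅ {q = q} {c} b s dc = alt-D {0} {q} {c} (alt-tail {1} {c} {q} (alt-tail {2} {q} {c} (alt-tail {3} {c} {q} (shift-alt s dc 4 b))))

  -- Walking around a vertex of the wall: q c q ⋯ = c q c ⋯ moves the shift to the far end.
  shift-around : ∀ {a x q c} k z → m q c ≡ fin (suc k) → Shift a x q →
    x ≈ alt c q k ++ z → ℓ x ≡ k + ℓ z → Shift a z (nth c q k)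
  shift-around {a} {x} {q} {c} k z eq (e , ¬d) x≈ len = z-shift , ascent⇒¬D (ℕ.≤-antisym
      (ℓ-min (∷-cong r (nf≈ z))) (ℕ.+-cancelˡ-≤ k (suc (ℓ z)) (ℓ (r ∷ z)) (begin
        k + suc (ℓ z)             ≡⟨ ℕ.+-suc k (ℓ z) ⟩
        suc (k + ℓ z)             ≡⟨ cong suc len ⟨
        suc (ℓ x)                 ≡⟨ ¬D⇒ascent ¬d ⟨
        ℓ (q ∷ x)                 ≡⟨ ℓ-cong qx≈ ⟩
        ℓ (alt c q k ++ r ∷ z)    ≤⟨ ℓ-alt-++ k c q (r ∷ z) ⟩
        k + ℓ (r ∷ z)             ∎)))
    where
    open ℕ.≤-Reasoning
    r : Fin n
    r = nth c q k
    qx≈ : q ∷ x ≈ alt c q k ++ r ∷ z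
    qx≈ = ≈-trans (∷-cong q x≈) (≈-trans (alt-braid eq z)
      (≡⇒≈ (trans (cong (_++ z) (alt-snoc c q k)) (++-assoc (alt c q k) (r ∷ []) z))))
    z-shift : r ∷ z ≈ z ++ a ∷ []
    z-shift = ++-cancel (alt c q k) (≈-trans (≈-sym qx≈) (≈-trans e
      (≈-trans (++-congʳ (a ∷ []) x≈) (≡⇒≈ (++-assoc (alt c q k) z (a ∷ []))))))

  around₂ : ∀ {a x q c} → m q c ≡ fin 2 → Shift a x q → D c x → Shift a (c ∷ x) q
  around₂ {x = x} {q} {c} eq s dc = shift-around 1 (c ∷ x) eq s (≈-sym (ss-cancel c x)) dc

  around₃ : ∀ {a x q c} → m q c ≡ fin 3 → Shift a x q → D c x → Shift a (q ∷ c ∷ x) c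
  around₃ {x = x} {q} {c} eq s dc = shift-around 2 (q ∷ c ∷ x) eq s
    (≈-sym (≈-trans (∷-cong c (ss-cancel q (c ∷ x))) (ss-cancel c x)))
    (trans dc (cong suc (shift-D₃ (subst (3 ≤∞_) (sym eq) ℕ.≤-refl) s dc)))

  around₄ : ∀ {a x q c} → m q c ≡ fin 4 → Shift a x q → D c x → Shift a (c ∷ q ∷ c ∷ x) q
  around₄ {x = x} {q} {c} eq s dc = shift-around 3 (c ∷ q ∷ c ∷ x) eq s
    (≈-sym (≈-trans (∷-cong c (∷-cong q (ss-cancel c (q ∷ c ∷ x))))
      (≈-trans (∷-cong c (ss-cancel q (c ∷ x))) (ss-cancel c x))))
    (trans dc (cong suc (trans (shift-D₃ (subst (3 ≤∞_) (sym eq) (ℕ.n≤1+n 3)) s dc)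
      (cong suc (shift-D₄ (subst (4 ≤∞_) (sym eq) ℕ.≤-refl) s dc)))))

  record Triangle (a b c : Fin n) : Set where
    constructor triangle
    field
      ab : 3 ≤∞ m a b
      bc : 3 ≤∞ m b c
      ca : 3 ≤∞ m c a
  open Triangle public

  rotate : ∀ {a b c} → Triangle a b c → Triangle b c a
  rotate (triangle x y z) = triangle y z x

  flip : ∀ {a b c} → Triangle a b c → Triangle b a c
  flip {a} {b} {c} (triangle x y z) = triangle (≤∞-sym {3} {a} {b} x) (≤∞-sym {3} {c} {a} z) (≤∞-sym {3} {b} {c} y)

  private
    -- The situation recurs at t x with (s, a, t) in place of (a, t, s). The new third condition,
    -- that t is a descent of a t x, holds because m(a,t) is at least 3.
    spiral-descent : ∀ f {a t s} x → ℓ x ≤ f → Triangle a t s → D a x → D t x → D s (t ∷ x) → ⊥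
    spiral-descent zero x x≤0 Δ da dt ds = ℕ.0≢1+n (trans (sym (ℕ.n≤0⇒n≡0 x≤0)) da)
    spiral-descent (suc f) {a} {t} {s} x x≤f Δ da dt ds = spiral-descent f (t ∷ x)
      (ℕ.≤-pred (subst (_≤ suc f) dt x≤f)) (rotate (rotate Δ))
      ds (D-both₂ (≥3⇒≢ (ab (flip Δ))) dt da) (D-both₃ (ab (flip Δ)) dt da)

  -- Otherwise x could be shortened for ever along a spiral.
  no-spiral : ∀ {a t s x} → Triangle a t s → D a x → D t x → D s (t ∷ x) → ⊥
  no-spiral {x = x} = spiral-descent (ℓ x) x ℕ.≤-refl

  no-three : ∀ {a t s x} → Triangle a t s → D a x → D t x → ¬ D s x
  no-three Δ da dt ds = no-spiral Δ da dt (D-both₂ (≥3⇒≢ (bc Δ)) dt ds)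

  private
    -- If m(p,q) = 3, the wall turns and the same configuration reappears two letters further down,
    -- with the roles cycled. A larger bond leaves one more descent q, which makes a spiral.
    wall-descent : ∀ f {a c q p} y → ℓ y ≤ f → Triangle c q p → D c y → D q y → Shift a (c ∷ y) p → ⊥
    wall-descent zero y y≤0 Δ dc dq sh = ℕ.0≢1+n (trans (sym (ℕ.n≤0⇒n≡0 y≤0)) dc)
    wall-descent (suc f) {a} {c} {q} {p} y y≤f Δ dc dq sh = cases (≤∞-split 3 (m p q) pq≥3)
      where
      pq≥3 : 3 ≤∞ m p q
      pq≥3 = ≤∞-sym {3} {q} {p} (bc Δ)
      dqz : D q (c ∷ y)
      dqz = D-both₂ (≥3⇒≢ (ab Δ)) dc dq
      dp : D p (q ∷ c ∷ y)
      dp = shift-D₃ pq≥3 sh dqz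
      dc′ : D c (q ∷ c ∷ y)
      dc′ = D-both₃ (ab Δ) dc dq
      shorter : ℓ (q ∷ c ∷ y) ≤ f
      shorter = ℕ.≤-trans (ℕ.n≤1+n _) (ℕ.≤-pred (subst (_≤ suc f) (trans dc (cong suc dqz)) y≤f))
      cases : (m p q ≡ fin 3) ⊎ (4 ≤∞ m p q) → ⊥
      cases (inj₁ eq) = wall-descent f (q ∷ c ∷ y) shorter (rotate (rotate Δ)) dp dc′ (around₃ eq sh dqz)
      cases (inj₂ b) = no-spiral (flip (rotate (rotate Δ))) dc′ dp (shift-D₄ b sh dqz)

  wall-inner : ∀ {a c q p y} → Triangle c q p → D c y → D q y → Shift a (c ∷ y) p → ⊥
  wall-inner {y = y} = wall-descent (ℓ y) y ℕ.≤-refl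

  -- Since y already has two descents, c lengthens it, and the wall has to turn around the vertex of
  -- p and c. For bond 3 this lands at p y, the case of `wall-inner`; for a larger bond c shortens p
  -- y, a spiral.
  wall-outer : ∀ {a p q c y} → Triangle p q c → D p y → D q y → Shift a (c ∷ y) p → ⊥
  wall-outer {a} {p} {q} {c} {y} Δ dp dq sh = cases (≤∞-split 3 (m p c) pc≥3)
    where
    pc≥3 : 3 ≤∞ m p c
    pc≥3 = ≤∞-sym {3} {c} {p} (ca Δ)
    dc : D c (c ∷ y)
    dc = D-flip (no-three Δ dp dq)
    back : p ∷ c ∷ c ∷ y ≈ p ∷ y
    back = ∷-cong p (ss-cancel c y)
    cases : (m p c ≡ fin 3) ⊎ (4 ≤∞ m p c) → ⊥
    cases (inj₁ eq) = wall-inner Δ dp dq (Shift-resp back (around₃ eq sh dc))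
    cases (inj₂ b) = no-spiral (flip Δ) dq dp (D-resp back (shift-D₄ b sh dc))

  -- The same as `wall-outer` from one letter further out: a bond of 4 is just enough to lead the
  -- wall back to p y.
  wall-far : ∀ {a p q c y} → Triangle p q c → 4 ≤∞ m c p → D p y → D q y → Shift a (p ∷ c ∷ y) c → ⊥
  wall-far {a} {p} {q} {c} {y} Δ b dp dq sh = cases (≤∞-split 4 (m c p) b)
    where
    dc : D c (c ∷ y)
    dc = D-flip (no-three Δ dp dq)
    back : p ∷ c ∷ c ∷ y ≈ p ∷ y
    back = ∷-cong p (ss-cancel c y)
    ¬dp : ¬ D p (c ∷ y)
    ¬dp d = no-spiral (flip Δ) dq dp (D-resp back (D-both₃ (ca Δ) dc d))
    dp′ : D p (p ∷ c ∷ y)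
    dp′ = D-flip ¬dp
    back₃ : p ∷ c ∷ p ∷ p ∷ c ∷ y ≈ p ∷ y
    back₃ = ≈-trans (∷-cong p (∷-cong c (ss-cancel p (c ∷ y)))) back
    cases : (m c p ≡ fin 4) ⊎ (5 ≤∞ m c p) → ⊥
    cases (inj₁ eq) = wall-inner Δ dp dq (Shift-resp back₃ (around₄ eq sh dp′))
    cases (inj₂ b) = no-spiral (flip Δ) dq dp (D-resp back₃ (shift-D₅ b sh dp′))

-- Alternating words stacked on a minimal element.

module Growth {n : ℕ} (M : CoxeterMatrix n) where
  open CoxeterMatrix M
  open Coxeter M
  open Words M
  open Decidability M
  open LengthFunction M
  open Parabolic M
  open RankThree M

  -- The first argument is the letter next to z and letters are piled up in front of it, so a
  -- deletion or a slide at the bottom becomes visible by unfolding.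
  grow : Fin n → Fin n → ℕ → Word → Word
  grow p q zero z = z
  grow p q (suc l) z = grow q p l (p ∷ z)

  grow≡ : ∀ p q l z → grow p q l z ≡ reverse (alt p q l) ++ z
  grow≡ p q zero z = refl
  grow≡ p q (suc l) z = trans (grow≡ q p l (p ∷ z)) (sym (reverse-∷-++ p (alt q p l) z))

  grow-cong : ∀ p q l {z z′} → z ≈ z′ → grow p q l z ≈ grow p q l z′
  grow-cong p q zero e = e
  grow-cong p q (suc l) e = grow-cong q p l (∷-cong p e)

  grow-++ : ∀ p q l z y → grow p q l z ++ y ≡ grow p q l (z ++ y)
  grow-++ p q zero z y = refl
  grow-++ p q (suc l) z y = grow-++ q p l (p ∷ z) y

  grow-top : ∀ p q l z → grow p q (suc l) z ≡ nth p q l ∷ grow p q l z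
  grow-top p q zero z = refl
  grow-top p q (suc l) z = grow-top q p l (p ∷ z)

  grow-braid : ∀ {p q k} → m p q ≡ fin k → ∀ z → grow p q k z ≈ grow q p k z
  grow-braid {p} {q} {k} e z = ≈-trans (≡⇒≈ (grow≡ p q k z)) (≈-trans
    (++-congʳ z (reverse-cong (subst₂ _≈_ (++-identityʳ _) (++-identityʳ _) (alt-braid e []))))
    (≡⇒≈ (sym (grow≡ q p k z))))

  Pair : Fin n → Fin n → Fin n → Set
  Pair p q k = (k ≡ p) ⊎ (k ≡ q)

  pair? : ∀ p q k → Dec (Pair p q k)
  pair? p q k = (k ≟ p) ⊎-dec (k ≟ q)

  pair-alt : ∀ p q l → All (Pair p q) (alt p q l)
  pair-alt p q zero = []
  pair-alt p q (suc l) = inj₁ refl ∷ All.map swap (pair-alt q p l)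
    where
    swap : ∀ {k} → Pair q p k → Pair p q k
    swap (inj₁ e) = inj₂ e
    swap (inj₂ e) = inj₁ e

  pair-min : ∀ {p q z} → ¬ D p z → ¬ D q z → LMin (Pair p q) z
  pair-min ¬p ¬q k (inj₁ refl) = ¬p
  pair-min ¬p ¬q k (inj₂ refl) = ¬q

  -- If p shortened the shorter word, which has the descent q, then `D-alt` would give it an
  -- alternating prefix longer than itself.
  ℓ-alt-suc : ∀ {p q} l → p ≢ q → suc (suc l) ≤∞ m p q → ℓ (alt q p (suc l)) ≡ suc l →
    ℓ (alt p q (suc (suc l))) ≡ suc (suc l)
  ℓ-alt-suc {p} {q} l p≢q b IH = trans (¬D⇒ascent ¬d) (cong suc IH)
    where
    dq : D q (alt q p (suc l))
    dq = D-red (ℓ⇒red (trans IH (sym (length-alt q p (suc l)))))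
    ¬d : ¬ D p (alt q p (suc l))
    ¬d d with D-alt p≢q d dq (suc (suc l)) b
    ... | z , _ , len = ℕ.m≢1+m+n (suc l) (trans (sym IH) len)

  ℓ-alt : ∀ {p q} l → p ≢ q → l ≤∞ m p q → ℓ (alt p q l) ≡ l
  ℓ-alt zero _ _ = ℓ[]
  ℓ-alt (suc zero) _ _ = ℓ-singleton _
  ℓ-alt {p} {q} (suc (suc l)) p≢q b = ℓ-alt-suc l p≢q b
    (ℓ-alt (suc l) (λ e → p≢q (sym e)) (≤∞-sym {suc l} {p} {q} (≤∞-trans (m p q) (ℕ.n≤1+n _) b)))

  ℓ-grow : ∀ {p q z} l → p ≢ q → ¬ D p z → ¬ D q z → l ≤∞ m p q → ℓ (grow p q l z) ≡ l + ℓ z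
  ℓ-grow {p} {q} {z} l p≢q ¬p ¬q b = begin
    ℓ (grow p q l z)                  ≡⟨ cong ℓ (grow≡ p q l z) ⟩
    ℓ (reverse (alt p q l) ++ z)      ≡⟨ LMin-additive (pair? p q) (pair-min ¬p ¬q) (reverse⁺ (pair-alt p q l)) ⟩
    ℓ (reverse (alt p q l)) + ℓ z     ≡⟨ cong (_+ ℓ z) (trans (ℓ-reverse (alt p q l)) (ℓ-alt l p≢q b)) ⟩
    l + ℓ z                           ∎
    where open ≡-Reasoning

  grow-D : ∀ {p q z} l → p ≢ q → ¬ D p z → ¬ D q z → suc l ≤∞ m p q → D (nth p q l) (grow p q (suc l) z)
  grow-D {p} {q} {z} l p≢q ¬p ¬q b = trans (ℓ-grow (suc l) p≢q ¬p ¬q b) (cong suc (begin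
    l + ℓ z                                       ≡⟨ ℓ-grow l p≢q ¬p ¬q (≤∞-trans (m p q) (ℕ.n≤1+n l) b) ⟨
    ℓ (grow p q l z)                              ≡⟨ ℓ-cong (ss-cancel (nth p q l) (grow p q l z)) ⟨
    ℓ (nth p q l ∷ nth p q l ∷ grow p q l z)      ≡⟨ cong (λ h → ℓ (nth p q l ∷ h)) (grow-top p q l z) ⟨
    ℓ (nth p q l ∷ grow p q (suc l) z)            ∎))
    where open ≡-Reasoning

  D-in : ∀ {K : Fin n → Set} {x k} X → x ≈ X → All K X → D k x → K k
  D-in {K} {x} {k} X e KX d = All.head (red-in (k ∷ nf (k ∷ x)) X
    (ℓ⇒red (trans (ℓ-cong x≈) d)) (≈-trans x≈ e) KX)
    where
    x≈ : k ∷ nf (k ∷ x) ≈ x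
    x≈ = ≈-sym (∷-transpose k (≈-sym (nf≈ (k ∷ x))))

  nonempty-D : ∀ x → (x ≈ []) ⊎ (∃[ k ] D k x)
  nonempty-D x = go (nf x) (nf≈ x) (nf-red x)
    where
    go : ∀ X → X ≈ x → Red X → (x ≈ []) ⊎ (∃[ k ] D k x)
    go [] e R = inj₁ (≈-sym e)
    go (k ∷ X) e R = inj₂ (k , D-resp e (D-red R))

-- Consequences of having no second admissible deletion.

-- Everything is written for inverses: v, u stand for v⁻¹, u⁻¹, so that J acts on the right and
-- the last letter e of the paper's v comes first.
module Setting {n : ℕ} (M : CoxeterMatrix n) {J : Fin n → Set} (J? : ∀ a → Dec (J a))
  (u v : Coxeter.Word M) (Ju : All J u) (Rv : Parabolic.RMin M J v)
  (e : Fin n) (De : LengthFunction.D M e v)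
  (good : ∀ v′ → Coatoms.Coat M v v′ → LengthFunction.D M e v′ →
    LengthFunction.ℓ M (v′ ++ u) ≢ LengthFunction.ℓ M v′ + LengthFunction.ℓ M u) where
  open CoxeterMatrix M
  open Coxeter M
  open Words M
  open Decidability M
  open LengthFunction M
  open Parabolic M
  open Coatoms M
  open RankThree M
  open Growth M
  open import Data.List.Membership.Propositional using (_∈_)

  coat-not-min : ∀ {v′} → Coat v v′ → D e v′ → ¬ RMin J v′
  coat-not-min {v′} c d R = good v′ c d (RMin-additive J? R Ju)

  -- If a lengthened u, it could be moved from v″ a over to u, and v″ (a u) would be additive,
  -- against `good`.
  coat-shift-descent : ∀ {v′ v″ a} → Coat v v′ → D e v′ → v′ ≈ v″ ++ a ∷ [] → RMin J v″ → J a → D a u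
  coat-shift-descent {v′} {v″} {a} c d v′≈ R Ja with D? a u
  ... | yes da = da
  ... | no ¬da = ⊥-elim (good v′ c d (begin
    ℓ (v′ ++ u)                 ≡⟨ ℓ-cong (≈-trans (++-congʳ u v′≈) (≡⇒≈ (++-assoc v″ (a ∷ []) u))) ⟩
    ℓ (v″ ++ a ∷ u)             ≡⟨ RMin-additive J? R (Ja ∷ Ju) ⟩
    ℓ v″ + ℓ (a ∷ u)            ≡⟨ cong (ℓ v″ +_) (¬D⇒ascent ¬da) ⟩
    ℓ v″ + suc (ℓ u)            ≡⟨ ℕ.+-suc (ℓ v″) (ℓ u) ⟩
    suc (ℓ v″) + ℓ u            ≡⟨ cong (_+ ℓ u) (R a Ja) ⟨
    ℓ (v″ ++ a ∷ []) + ℓ u      ≡⟨ cong (_+ ℓ u) (ℓ-cong v′≈) ⟨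
    ℓ v′ + ℓ u                  ∎))
    where open ≡-Reasoning

  -- For another descent k, the element k v lies in W^J and still has the descent e; it would be an
  -- admissible coatom.
  top-unique : ∀ {k} → D k v → k ≡ e
  top-unique {k} dk with k ≟ e
  ... | yes p = p
  ... | no k≢e = ⊥-elim (coat-not-min ([] , k , k ∷ v , ≈-sym (ss-cancel k v) , ≈-refl , dk)
    (D-both₂ k≢e dk De) (RMin-∷ k Rv dk))

  -- In a reduced word of v starting with e, a deletion behind this letter leaves e in front.
  coat-top : ∀ {v′} → Coat v v′ → D e v′ ⊎ (v′ ≈ e ∷ v)
  coat-top {v′} (a , b , c , ev , ev′ , len) = located (strong-exchange a b V shorter)
    where
    V : Word
    V = e ∷ nf (e ∷ v)
    V≈v : V ≈ v
    V≈v = ≈-sym (∷-transpose e (≈-sym (nf≈ (e ∷ v))))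
    deleted : reflection a b ++ V ≈ v′
    deleted = ≈-trans (++-congˡ (reflection a b) (≈-trans V≈v ev))
      (≈-trans (reflection-delete a b c ≈-refl) (≈-sym ev′))
    shorter : ℓ (reflection a b ++ V) < ℓ V
    shorter = ℕ.≤-reflexive (trans (cong suc (ℓ-cong deleted)) (trans (sym len) (ℓ-cong (≈-sym V≈v))))
    located : ∃[ p ] ∃[ q ] ∃[ r ] (V ≡ p ++ q ∷ r) × (reflection a b ++ V ≈ p ++ r) → D e v′ ⊎ (v′ ≈ e ∷ v)
    located ([] , q , r , eq , f) = inj₂ (≈-trans (≈-sym deleted) (≈-trans f
      (≈-trans (≡⇒≈ (sym (proj₂ (∷-injective eq)))) (nf≈ (e ∷ v)))))
    located (s ∷ p , q , r , eq , f) with ∷-injective eq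
    ... | refl , eq′ = inj₁ (<⇒D (begin
      suc (ℓ (e ∷ v′))              ≤⟨ s≤s (ℓ-min (∷-transpose e (≈-trans (≈-sym f) deleted))) ⟩
      suc (length (p ++ r))         ≡⟨ length-delete p q r ⟨
      length (p ++ q ∷ r)           ≡⟨ cong length eq′ ⟨
      ℓ (e ∷ v)                     ≡⟨ ℕ.suc-injective (trans (sym De) len) ⟩
      ℓ v′                          ∎))
      where open ℕ.≤-Reasoning

  ShiftJ : Word → Fin n → Set
  ShiftJ z k = ∃[ a ] J a × (k ∷ z ≈ z ++ a ∷ [])

  shiftJ? : ∀ z k → Dec (ShiftJ z k)
  shiftJ? z k = any? (λ a → J? a ×-dec (k ∷ z ≈? z ++ a ∷ []))

  RMin-not-shift : ∀ {z k} → RMin J (k ∷ z) → ¬ D k z → ¬ ShiftJ z k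
  RMin-not-shift {z} {k} R ¬d (a , Ja , s) = ℕ.m≢1+m+n (ℓ z) {1} (begin
    ℓ z                            ≡⟨ ℓ-cong (≈-trans (++-congˡ z (ss-cancel a [])) (≡⇒≈ (++-identityʳ z))) ⟨
    ℓ (z ++ a ∷ a ∷ [])            ≡⟨ cong ℓ (++-assoc z (a ∷ []) (a ∷ [])) ⟨
    ℓ ((z ++ a ∷ []) ++ a ∷ [])    ≡⟨ ℓ-cong (++-congʳ (a ∷ []) s) ⟨
    ℓ (k ∷ z ++ a ∷ [])            ≡⟨ R a Ja ⟩
    suc (ℓ (k ∷ z))                ≡⟨ cong suc (¬D⇒ascent ¬d) ⟩
    suc (suc (ℓ z))                ≡⟨ cong suc (ℕ.+-comm 1 (ℓ z)) ⟩
    suc (ℓ z + 1)                  ∎)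
    where open ≡-Reasoning

  -- The coatoms of y attached to two letters that do not slide through z into J would give two coatoms
  -- of v in W^J.
  one-unshifted : ∀ {K : Fin n → Set} (K? : ∀ k → Dec (K k)) y z → v ≈ y ++ z → All K y → LMin K z →
    ∀ {k k′} → k ≢ k′ → k ∈ nf y → k′ ∈ nf y → ¬ ShiftJ z k → ¬ ShiftJ z k′ → ⊥
  one-unshifted {K} K? y z v≈ Ky Lz {k} {k′} k≢k′ k∈ k′∈ ¬k ¬k′ =
    contradict (coatoms (shiftJ? z) 2 (k ∷ k′ ∷ []) refl y Ry ((k≢k′ ∷ []) ∷ [] ∷ []) ((k∈ , ¬k) ∷ (k′∈ , ¬k′) ∷ []))
    where
    ℓv : ℓ v ≡ ℓ y + ℓ z
    ℓv = trans (ℓ-cong v≈) (LMin-additive K? Lz Ky)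
    Rz : RMin J z
    Rz = RMin-suffix {J} {y} {z} (RMin-resp v≈ Rv) (LMin-additive K? Lz Ky)
    Ry : RMin (ShiftJ z) y
    Ry k (a , Ja , s) with ascentʳ? y k
    ... | inj₁ eq = eq
    ... | inj₂ eq = ⊥-elim (ℕ.<⇒≱ (ℕ.≤-reflexive (sym (Rv a Ja))) (begin
      ℓ (v ++ a ∷ [])               ≡⟨ ℓ-cong va≈ ⟩
      ℓ ((y ++ k ∷ []) ++ z)        ≤⟨ ℓ-++ (y ++ k ∷ []) z ⟩
      ℓ (y ++ k ∷ []) + ℓ z         ≤⟨ ℕ.+-monoˡ-≤ (ℓ z) (ℕ.n≤1+n _) ⟩
      suc (ℓ (y ++ k ∷ [])) + ℓ z   ≡⟨ cong (_+ ℓ z) eq ⟨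
      ℓ y + ℓ z                     ≡⟨ ℓv ⟨
      ℓ v                           ∎))
      where
      open ℕ.≤-Reasoning
      va≈ : v ++ a ∷ [] ≈ (y ++ k ∷ []) ++ z
      va≈ = ≈-trans (++-congʳ (a ∷ []) v≈) (≈-trans (≡⇒≈ (++-assoc y z (a ∷ [])))
        (≈-trans (++-congˡ y (≈-sym s)) (≡⇒≈ (sym (++-assoc y (k ∷ []) z)))))
    is-top : ∀ {y′} → Coat y y′ × RMin (ShiftJ z) y′ → y′ ++ z ≈ e ∷ v
    is-top {y′} (cy@(a , b , c , ey , ey′ , len) , R′) = inner (coat-in y ≈-refl Ky cy)
      where
      inner : ∃[ Y ] (y′ ≈ Y) × All K Y → y′ ++ z ≈ e ∷ v
      inner (Y , y′≈Y , KY) = conclude (coat-top coat)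
        where
        coat : Coat v (y′ ++ z)
        coat = a , b , c ++ z , ≈-trans v≈ (≈-trans (++-congʳ z ey) (≡⇒≈ (++-assoc a (b ∷ c) z))) ,
          ≈-trans (++-congʳ z ey′) (≡⇒≈ (++-assoc a c z)) ,
          trans ℓv (trans (cong (_+ ℓ z) len) (cong suc (sym
            (trans (ℓ-cong (++-congʳ z y′≈Y)) (trans (LMin-additive K? Lz KY) (cong (_+ ℓ z) (ℓ-cong (≈-sym y′≈Y))))))))
        R″ : RMin J (y′ ++ z)
        R″ = RMin-resp (++-congʳ z (≈-sym y′≈Y)) (RMin-double J? K? Rz Lz KY
          (λ k a _ Ja s → RMin-resp y′≈Y R′ k (a , Ja , s)))
        conclude : D e (y′ ++ z) ⊎ (y′ ++ z ≈ e ∷ v) → y′ ++ z ≈ e ∷ v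
        conclude (inj₁ d) = ⊥-elim (coat-not-min coat d R″)
        conclude (inj₂ eq) = eq
    contradict : ∃[ L ] (length L ≡ 2) × Independent (shiftJ? z) y L → ⊥
    contradict (y₁ ∷ y₂ ∷ [] , refl , ((¬eq ∷ []) ∷ _) , (c₁ ∷ c₂ ∷ [])) =
      ¬eq (++-cancelʳ z (≈-trans (is-top c₁) (≈-sym (is-top c₂))))

  shiftJ⇒ : ∀ {z k} → ¬ D k z → (s : ShiftJ z k) → Shift (proj₁ s) z k
  shiftJ⇒ ¬d (a , _ , s) = s , ¬d

  module _ {p q : Fin n} {k : ℕ} {x : Word} (R : RMin J x) (p≢q : p ≢ q) (¬p : ¬ D p x) (¬q : ¬ D q x)
    (Rq : RMin J (q ∷ x)) where

    private
      y : Word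
      y = reverse (alt q p k)
      double-min : (∀ a → J a → p ∷ x ≈ x ++ a ∷ [] → ℓ (y ++ p ∷ []) ≡ suc (ℓ y)) → RMin J (grow q p k x)
      double-min ascent = subst (RMin J) (sym (grow≡ q p k x))
        (RMin-double J? (pair? q p) R (pair-min ¬q ¬p) (reverse⁺ (pair-alt q p k)) λ where
          j a (inj₁ refl) Ja s → ⊥-elim (RMin-not-shift Rq ¬q (a , Ja , s))
          j a (inj₂ refl) Ja s → ascent a Ja s)

    grow-RMin-unshifted : ¬ ShiftJ x p → RMin J (grow q p k x)
    grow-RMin-unshifted ¬s = double-min λ a Ja s → ⊥-elim (¬s (a , Ja , s))

    -- Even if p slides through x, an alternating word with fewer than m(p,q) letters is still
    -- lengthened by it, so the criterion of `RMin-double` holds.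
    grow-RMin-short : suc k ≤∞ m p q → RMin J (grow q p k x)
    grow-RMin-short b = double-min λ a Ja s → begin
      ℓ (reverse (alt q p k) ++ p ∷ [])    ≡⟨ cong ℓ (reverse-∷ p (alt q p k)) ⟨
      ℓ (reverse (alt p q (suc k)))        ≡⟨ trans (ℓ-reverse (alt p q (suc k))) (ℓ-alt (suc k) p≢q b) ⟩
      suc k                                ≡⟨ cong suc (trans (ℓ-reverse (alt q p k))
                                                (ℓ-alt k (λ r → p≢q (sym r)) (≤∞-sym {k} {p} {q} (≤∞-trans (m p q) (ℕ.n≤1+n k) b)))) ⟨
      suc (ℓ (reverse (alt q p k)))        ∎
      where open ≡-Reasoning

  -- Such a coatom must leave W^J. Given that q x is in W^J, this requires both that p slides
  -- through x and that the alternating word is full.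
  grow-coat-min : ∀ {p q k x v′} → Coat v v′ → D e v′ → v′ ≈ grow q p k x → RMin J x → p ≢ q →
    ¬ D p x → ¬ D q x → k ≤∞ m p q → RMin J (q ∷ x) → (m p q ≡ fin k) × ShiftJ x p
  grow-coat-min {p} {q} {k} {x} {v′} c d v′≈ R p≢q ¬p ¬q b Rq = cases (≤∞-split k (m p q) b) (shiftJ? x p)
    where
    not-min : ¬ RMin J (grow q p k x)
    not-min R′ = coat-not-min c d (RMin-resp (≈-sym v′≈) R′)
    cases : (m p q ≡ fin k) ⊎ (suc k ≤∞ m p q) → Dec (ShiftJ x p) → (m p q ≡ fin k) × ShiftJ x p
    cases (inj₁ eq) (yes s) = eq , s
    cases _ (no ¬s) = ⊥-elim (not-min (grow-RMin-unshifted {k = k} R p≢q ¬p ¬q Rq ¬s))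
    cases (inj₂ b′) (yes _) = ⊥-elim (not-min (grow-RMin-short {k = k} R p≢q ¬p ¬q Rq b′))

  -- If q x were in W^J, `grow-coat-min` would make k equal to m(p,q).
  grow-coat-short : ∀ {p q k x v′} → Coat v v′ → D e v′ → v′ ≈ grow q p k x → RMin J x → p ≢ q →
    ¬ D p x → ¬ D q x → suc k ≤∞ m p q → ShiftJ x q
  grow-coat-short {p} {q} {k} {x} c d v′≈ R p≢q ¬p ¬q b = cases (RMin-or-shift J? q R ¬q)
    where
    cases : RMin J (q ∷ x) ⊎ (∃[ a ] J a × (q ∷ x ≈ x ++ a ∷ [])) → ShiftJ x q
    cases (inj₂ s) = s
    cases (inj₁ Rq) with grow-coat-min {p} {q} {k} c d v′≈ R p≢q ¬p ¬q (≤∞-trans (m p q) (ℕ.n≤1+n k) b) Rq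
    ... | eq , _ = ⊥-elim (ℕ.1+n≰n (subst (suc k ≤∞_) eq b))

-- Stripping alternating prefixes, and avoidance as a rule on commuting letters.

module Peeling {n : ℕ} (M : CoxeterMatrix n) where
  open CoxeterMatrix M
  open Coxeter M
  open Words M
  open LengthFunction M
  open Parabolic M
  open RankThree M
  open Growth M

  strip-max : ∀ f s t x → ℓ x ≤ f →
    ∃[ l ] ∃[ z ] (x ≈ alt s t l ++ z) × (ℓ x ≡ l + ℓ z) × ¬ D (nth s t l) z
  strip-max f s t x x≤f with D? s x
  ... | no ¬d = 0 , x , ≈-refl , refl , ¬d
  strip-max zero s t x x≤0 | yes d = ⊥-elim (ℕ.0≢1+n (trans (sym (ℕ.n≤0⇒n≡0 x≤0)) d))
  strip-max (suc f) s t x x≤f | yes d with strip-max f t s (s ∷ x) (ℕ.≤-pred (subst (_≤ suc f) d x≤f))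
  ... | l , z , e , len , ¬d = suc l , z , ∷-transpose s e , trans d (cong suc len) , ¬d

  nth-self : ∀ (a b : Fin n) k → nth (nth a b k) (nth b a k) k ≡ a
  nth-self a b zero = refl
  nth-self a b (suc k) = nth-self a b k

  alt-split : ∀ (s t : Fin n) k j → alt s t (k + j) ≡ alt s t k ++ alt (nth s t k) (nth t s k) j
  alt-split s t zero j = refl
  alt-split s t (suc k) j = cong (s ∷_) (alt-split t s k j)

  nth-pair : ∀ (p q : Fin n) k → Pair p q (nth p q k)
  nth-pair p q zero = inj₁ refl
  nth-pair p q (suc k) with nth-pair q p k
  ... | inj₁ e = inj₂ e
  ... | inj₂ e = inj₁ e

  bounded? : ∀ L μ → (suc L ≤∞ μ) ⊎ (∃[ k ] (μ ≡ fin k) × (k ≤ L))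
  bounded? L ∞ = inj₁ tt
  bounded? L (fin k) with ℕ.≤-total (suc L) k
  ... | inj₁ p = inj₁ p
  ... | inj₂ p with ℕ.m≤n⇒m<n∨m≡n p
  ...   | inj₁ (s≤s lt) = inj₂ (k , refl , lt)
  ...   | inj₂ refl = inj₁ ℕ.≤-refl

  commute-out : ∀ c y x → All (λ k → m c k ≡ fin 2) y → c ∷ y ++ x ≈ y ++ c ∷ x
  commute-out c [] x [] = ≈-refl
  commute-out c (k ∷ y) x (e ∷ es) = ≈-trans (alt-braid e (y ++ x)) (∷-cong k (commute-out c y x es))

  -- With an infinite bond, p and q are never descents together, so whichever letter comes next
  -- lengthens.
  ℓ-grow-∞ : ∀ {p q} k {x} → p ≢ q → m p q ≡ ∞ → D q x → ℓ (grow p q k x) ≡ k + ℓ x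
  ℓ-grow-∞ zero _ _ _ = refl
  ℓ-grow-∞ {p} {q} (suc k) {x} p≢q eq dq =
    trans (ℓ-grow-∞ k (λ e → p≢q (sym e)) (trans (m-sym q p) eq) (D-flip ¬dp))
      (trans (cong (k +_) (¬D⇒ascent ¬dp)) (ℕ.+-suc k (ℓ x)))
    where
    ¬dp : ¬ D p x
    ¬dp dp = D-finite p≢q dp dq eq

  ≥2-split : ∀ {s t} → s ≢ t → (m s t ≡ fin 2) ⊎ (3 ≤∞ m s t)
  ≥2-split {s} {t} s≢t = ≤∞-split 2 (m s t) (m-off s t s≢t)

  finite-split : ∀ {μ} → μ ≢ ∞ → ∃[ k ] μ ≡ fin k
  finite-split {∞} ne = ⊥-elim (ne refl)
  finite-split {fin k} _ = k , refl

  module Avoid (avoid : AvoidsT) where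
    -- All uses of avoidance go through this rule: a letter s commuting with r also commutes with,
    -- or equals, each neighbour t of r along a finite bond.
    commute-along : ∀ {r s t} → m r s ≡ fin 2 → m r t ≢ ∞ → 3 ≤∞ m r t → ¬ 3 ≤∞ m s t
    commute-along {r} {s} {t} rs fin-rt rt st with finite-split fin-rt
    ... | b , eq = avoid b (m s t) (subst (3 ≤∞_) eq rt) st
      (r , s , t , r≢s , ≥3⇒≢ rt , ≥3⇒≢ st , rs , eq , refl)
      where
      r≢s : r ≢ s
      r≢s refl with trans (sym rs) (m-diag r)
      ... | ()

-- The two top letters, the letter below them, and the rank bound.

module Top {n : ℕ} (M : CoxeterMatrix n) (avoid : Coxeter.AvoidsT M)
  {J : Fin n → Set} (J? : ∀ a → Dec (J a))
  (u v : Coxeter.Word M) (Ju : All J u) (Rv : Parabolic.RMin M J v)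
  (e : Fin n) (De : LengthFunction.D M e v)
  (good : ∀ v′ → Coatoms.Coat M v v′ → LengthFunction.D M e v′ →
    LengthFunction.ℓ M (v′ ++ u) ≢ LengthFunction.ℓ M v′ + LengthFunction.ℓ M u) where
  open CoxeterMatrix M
  open Coxeter M
  open Words M
  open Game M
  open Decidability M
  open LengthFunction M
  open Parabolic M
  open Coatoms M
  open RankThree M
  open Growth M
  open Peeling M
  open Avoid avoid
  open Setting M J? u v Ju Rv e De good
  open import Data.List.Membership.Propositional using (_∈_)

  RMin-part : ∀ P {x} → v ≈ P ++ x → ℓ v ≡ length P + ℓ x → RMin J x
  RMin-part P {x} v≈ len = RMin-suffix {J} {P} {x} (RMin-resp v≈ Rv) (ℕ.≤-antisym (ℓ-++ P x)
    (ℕ.≤-trans (ℕ.+-monoˡ-≤ (ℓ x) (ℓ≤length P)) (ℕ.≤-reflexive (trans (sym len) (ℓ-cong v≈)))))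

  RMin-grow : ∀ {p q} k {x} → v ≈ grow p q k x → ℓ v ≡ k + ℓ x → RMin J x
  RMin-grow {p} {q} k {x} v≈ len = RMin-part (reverse (alt p q k)) (≈-trans v≈ (≡⇒≈ (grow≡ p q k x)))
    (trans len (cong (_+ ℓ x) (sym (trans (length-reverse (alt p q k)) (length-alt p q k)))))

  coat-grow : ∀ p q k a b c {v′} → v ≈ grow p q k (a ++ b ∷ c) → v′ ≈ grow p q k (a ++ c) →
    ℓ v ≡ suc (ℓ v′) → Coat v v′
  coat-grow p q k a b c v≈ v′≈ len = reverse (alt p q k) ++ a , b , c ,
    ≈-trans v≈ (≡⇒≈ (trans (grow≡ p q k (a ++ b ∷ c)) (sym (++-assoc (reverse (alt p q k)) a (b ∷ c))))) ,
    ≈-trans v′≈ (≡⇒≈ (trans (grow≡ p q k (a ++ c)) (sym (++-assoc (reverse (alt p q k)) a c)))) , len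

  -- In v = d z the alternating word d has p at the bottom and e at the top. It is taken maximal, so
  -- neither p nor q shortens z, and it stays strictly shorter than m(p,q).
  record Head : Set where
    field
      {p q} : Fin n
      l : ℕ
      z : Word
      v≈ : v ≈ grow p q (suc (suc l)) z
      p≢q : p ≢ q
      ¬Dp : ¬ D p z
      ¬Dq : ¬ D q z
      bound : suc (suc (suc l)) ≤∞ m p q
      e≡ : e ≡ nth p q (suc l)

  head : (v ≈ e ∷ []) ⊎ Head
  head = cases (nonempty-D (e ∷ v))
    where
    cases : (e ∷ v ≈ []) ⊎ (∃[ k ] D k (e ∷ v)) → (v ≈ e ∷ []) ⊎ Head
    cases (inj₁ eq) = inj₁ (∷-transpose e eq)
    cases (inj₂ (f , df)) = inj₂ (build (strip-max (ℓ (f ∷ e ∷ v)) e f (f ∷ e ∷ v) ℕ.≤-refl))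
      where
      e≢f : e ≢ f
      e≢f refl = ¬D-flip De df
      build : ∃[ l ] ∃[ z ] (f ∷ e ∷ v ≈ alt e f l ++ z) × (ℓ (f ∷ e ∷ v) ≡ l + ℓ z) × ¬ D (nth e f l) z → Head
      build (l , z , eq , len , ¬d) = record
        { p = nth e f (suc l)
        ; q = nth f e (suc l)
        ; l = l
        ; z = z
        ; v≈ = ≈-trans v≈alt (≡⇒≈ (sym (trans (grow≡ _ _ (suc (suc l)) z) (cong (_++ z)
            (trans (reverse-alt _ _ (suc l)) (cong₂ (λ a b → alt a b (suc (suc l))) (nth-self e f (suc l)) (nth-self f e (suc l))))))))
        ; p≢q = nth-≢ (suc l) e≢f
        ; ¬Dp = ascent⇒¬D (ℕ.≤-antisym (ℓ-min (∷-cong _ (nf≈ z))) (ℕ.+-cancelˡ-≤ (suc l) _ _ (begin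
            suc l + suc (ℓ z)                            ≡⟨ ℕ.+-suc (suc l) (ℓ z) ⟩
            suc (suc l) + ℓ z                            ≡⟨ ℓv ⟨
            ℓ v                                          ≡⟨ ℓ-cong (≈-trans v≈alt (≡⇒≈ (trans (cong (_++ z) (alt-snoc e f (suc l))) (++-assoc (alt e f (suc l)) _ z)))) ⟩
            ℓ (alt e f (suc l) ++ nth e f (suc l) ∷ z)   ≤⟨ ℓ-alt-++ (suc l) e f _ ⟩
            suc l + ℓ (nth e f (suc l) ∷ z)              ∎)))
        ; ¬Dq = ¬d
        ; bound = subst (suc (suc (suc l)) ≤∞_) (sym (m-nth e f (suc l))) (short (bounded? (suc (suc l)) (m e f)))
        ; e≡ = sym (nth-self e f (suc l))
        }
        where
        open ℕ.≤-Reasoning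
        v≈alt : v ≈ alt e f (suc (suc l)) ++ z
        v≈alt = ∷-transpose e (∷-transpose f eq)
        ℓv : ℓ v ≡ suc (suc l) + ℓ z
        ℓv = trans De (cong suc (trans df (cong suc len)))
        short : (suc (suc (suc l)) ≤∞ m e f) ⊎ (∃[ k ] (m e f ≡ fin k) × (k ≤ suc (suc l))) → suc (suc (suc l)) ≤∞ m e f
        short (inj₁ b) = b
        short (inj₂ (zero , mk , _)) = ⊥-elim (impossible (subst (2 ≤∞_) mk (m-off e f e≢f)))
          where
          impossible : ¬ 2 ≤ 0
          impossible ()
        -- A full alternating word at the top could be rewritten to start with f, giving v a second
        -- descent.
        short (inj₂ (suc k , mk , k≤)) = ⊥-elim (e≢f (sym (top-unique (<⇒D (begin
          suc (ℓ (f ∷ v))                       ≡⟨ cong suc (ℓ-cong fv≈) ⟩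
          suc (ℓ (alt e f k ++ rest))           ≤⟨ s≤s (ℓ-alt-++ k e f rest) ⟩
          suc (k + ℓ rest)                      ≤⟨ s≤s (ℕ.+-monoʳ-≤ k (ℓ-alt-++ j _ _ z)) ⟩
          suc (k + (j + ℓ z))                   ≡⟨ ℕ.+-assoc (suc k) j (ℓ z) ⟨
          suc k + j + ℓ z                       ≡⟨ cong (_+ ℓ z) k+j ⟩
          suc (suc l) + ℓ z                     ≡⟨ ℓv ⟨
          ℓ v                                   ∎)))))
          where
          j : ℕ
          j = suc (suc l) ∸ suc k
          k+j : suc k + j ≡ suc (suc l)
          k+j = ℕ.m+[n∸m]≡n k≤
          rest : Word
          rest = alt (nth e f (suc k)) (nth f e (suc k)) j ++ z
          fv≈ : f ∷ v ≈ alt e f k ++ rest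
          fv≈ = ≈-sym (∷-transpose f (≈-sym (≈-trans v≈alt (≈-trans (≡⇒≈ (trans
            (cong (λ h → alt e f h ++ z) (sym k+j)) (trans (cong (_++ z) (alt-split e f (suc k) j)) (++-assoc (alt e f (suc k)) _ z))))
            (alt-braid mk rest)))))

  module AtHead (H : Head) where
    open Head H public

    L : ℕ
    L = suc (suc l)

    L≤ : L ≤∞ m p q
    L≤ = ≤∞-trans (m p q) (ℕ.n≤1+n L) bound

    q≢p : q ≢ p
    q≢p r = p≢q (sym r)

    pq≥3 : 3 ≤∞ m p q
    pq≥3 = ≤∞-trans (m p q) (s≤s (s≤s (s≤s z≤n))) bound

    ℓv : ℓ v ≡ L + ℓ z
    ℓv = trans (ℓ-cong v≈) (ℓ-grow L p≢q ¬Dp ¬Dq L≤)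

    e-pair : Pair p q e
    e-pair = subst (Pair p q) (sym e≡) (nth-pair p q (suc l))

    Rz : RMin J z
    Rz = RMin-grow L v≈ ℓv

    Rpz : RMin J (p ∷ z)
    Rpz = RMin-grow (suc l) v≈ (trans ℓv (trans (cong suc (sym (ℕ.+-suc l (ℓ z))))
      (cong (λ h → suc (l + h)) (sym (¬D⇒ascent ¬Dp)))))

    shortened-coat : Coat v (grow q p (suc l) z)
    shortened-coat = coat-grow q p (suc l) [] p z v≈ ≈-refl
      (trans ℓv (cong suc (sym (ℓ-grow (suc l) q≢p ¬Dq ¬Dp (≤∞-sym {suc l} {p} {q} (≤∞-trans (m p q) (ℕ.n≤1+n _) L≤))))))

    shortened-D : D e (grow q p (suc l) z)
    shortened-D = subst (λ h → D h (grow q p (suc l) z)) (sym e≡)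
      (grow-D l q≢p ¬Dq ¬Dp (≤∞-sym {suc l} {p} {q} (≤∞-trans (m p q) (ℕ.n≤1+n _) L≤)))

    -- Deleting the bottom letter p of d keeps e on top and leaves an alternating word too short to
    -- be full, so q has to slide through z.
    q-shift : ShiftJ z q
    q-shift = grow-coat-short {p} {q} {suc l} shortened-coat shortened-D ≈-refl Rz p≢q ¬Dp ¬Dq L≤

    a : Fin n
    a = proj₁ q-shift

    Ja : J a
    Ja = proj₁ (proj₂ q-shift)

    sh : Shift a z q
    sh = proj₂ (proj₂ q-shift) , ¬Dq

    -- Sliding the bottom q of the shortened word through z writes this coatom as v″ a with v″ a
    -- suffix of v, hence in W^J.
    a-descent : D a u
    a-descent = coat-shift-descent shortened-coat shortened-D
      (≈-trans (grow-cong p q l (shifts sh)) (≡⇒≈ (sym (grow-++ p q l z (a ∷ [])))))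
      (RMin-part (nth p q (suc l) ∷ nth p q l ∷ [])
        (≈-trans v≈ (≡⇒≈ (trans (grow-top p q (suc l) z) (cong (nth p q (suc l) ∷_) (grow-top p q l z)))))
        (trans ℓv (cong (λ h → suc (suc h)) (sym (ℓ-grow l p≢q ¬Dp ¬Dq
          (≤∞-trans (m p q) (ℕ.≤-trans (ℕ.n≤1+n l) (ℕ.n≤1+n (suc l))) L≤))))))
      Ja

    -- Such a letter could be brought to the front of v and would be a second descent.
    c-commutes⇒⊥ : ∀ {c} y {x} → v ≈ y ++ x → ℓ v ≡ length y + ℓ x → D c x → c ≢ e →
      All (λ k → m c k ≡ fin 2) y → ⊥
    c-commutes⇒⊥ {c} y {x} v≈yx len dc c≢e comm = c≢e (top-unique (<⇒D (begin
      suc (ℓ (c ∷ v))              ≡⟨ cong suc (ℓ-cong (≈-trans (∷-cong c v≈yx) (commute-out c y x comm))) ⟩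
      suc (ℓ (y ++ c ∷ x))         ≤⟨ s≤s (ℕ.≤-trans (ℓ-++ y (c ∷ x)) (ℕ.+-monoˡ-≤ (ℓ (c ∷ x)) (ℓ≤length y))) ⟩
      suc (length y + ℓ (c ∷ x))   ≡⟨ ℕ.+-suc (length y) (ℓ (c ∷ x)) ⟨
      length y + suc (ℓ (c ∷ x))   ≡⟨ cong (length y +_) dc ⟨
      length y + ℓ x               ≡⟨ len ⟨
      ℓ v                          ∎)))
      where open ℕ.≤-Reasoning

    module Below {c : Fin n} (Dc : D c z) where

      c≢p : c ≢ p
      c≢p refl = ¬Dp Dc

      c≢q : c ≢ q
      c≢q refl = ¬Dq Dc

      c≢e : c ≢ e
      c≢e refl with e-pair
      ... | inj₁ r = c≢p r
      ... | inj₂ r = c≢q r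

      qc-finite : m q c ≢ ∞
      qc-finite = shift-finite sh Dc

      y : Word
      y = reverse (alt p q L)

      v≈yz : v ≈ y ++ z
      v≈yz = ≈-trans v≈ (≡⇒≈ (grow≡ p q L z))

      length-y : length y ≡ L
      length-y = trans (length-reverse (alt p q L)) (length-alt p q L)

      -- If c commutes with p as well, it comes to the top. Otherwise avoidance makes m(p,q)
      -- infinite. Deleting c keeps the slide of q, and since a shortens u, q is a descent of c z u.
      -- The infinite alternating word then grows freely on it, and this coatom is additive with u.
      qc≢2 : m q c ≢ fin 2
      qc≢2 qc with ≥2-split c≢p
      ... | inj₁ cp = c-commutes⇒⊥ y v≈yz (trans ℓv (cong (_+ ℓ z) (sym length-y))) Dc c≢e
              (reverse⁺ (All.map comm (pair-alt p q L)))
        where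
        comm : ∀ {k} → Pair p q k → m c k ≡ fin 2
        comm (inj₁ refl) = cp
        comm (inj₂ refl) = trans (m-sym c q) qc
      ... | inj₂ cp≥3 = good v′ coat (subst (λ h → D h v′) (sym e≡) (grow-D (suc l) p≢q ¬Dp₀ (ascends sh₀) L≤)) (begin
          ℓ (v′ ++ u)                     ≡⟨ cong ℓ (grow-++ p q L (c ∷ z) u) ⟩
          ℓ (grow p q L (c ∷ z ++ u))     ≡⟨ ℓ-grow-∞ L p≢q pq∞ Dq-zu ⟩
          L + ℓ (c ∷ z ++ u)              ≡⟨ cong (L +_) (RMin-additive J? Rcz Ju) ⟩
          L + (ℓ (c ∷ z) + ℓ u)           ≡⟨ ℕ.+-assoc L (ℓ (c ∷ z)) (ℓ u) ⟨
          L + ℓ (c ∷ z) + ℓ u             ≡⟨ cong (_+ ℓ u) ℓv′ ⟨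
          ℓ v′ + ℓ u                      ∎)
        where
        open ≡-Reasoning
        pq∞ : m p q ≡ ∞
        pq∞ = trans (m-sym p q) (infinite (m q p) refl)
          where
          infinite : ∀ μ → m q p ≡ μ → m q p ≡ ∞
          infinite ∞ eq = eq
          infinite (fin k) eq = ⊥-elim (commute-along {q} {c} {p} qc (λ r → fin≢∞ (trans (sym eq) r))
            (≤∞-sym {3} {p} {q} pq≥3) cp≥3)
            where
            fin≢∞ : fin k ≢ ∞
            fin≢∞ ()
        sh₀ : Shift a (c ∷ z) q
        sh₀ = around₂ qc sh Dc
        v′ : Word
        v′ = grow p q L (c ∷ z)
        Rcz : RMin J (c ∷ z)
        Rcz = RMin-∷ c Rz Dc
        ¬Dp₀ : ¬ D p (c ∷ z)
        ¬Dp₀ d = shift-finite sh₀ d (trans (m-sym q p) pq∞)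
        ℓv′ : ℓ v′ ≡ L + ℓ (c ∷ z)
        ℓv′ = ℓ-grow L p≢q ¬Dp₀ (ascends sh₀) L≤
        coat : Coat v v′
        coat = coat-grow p q L [] c (c ∷ z) (≈-trans v≈ (grow-cong p q L (≈-sym (ss-cancel c z)))) ≈-refl
          (trans ℓv (trans (cong (L +_) Dc) (trans (ℕ.+-suc L _) (cong suc (sym ℓv′)))))
        Dq-zu : D q (c ∷ z ++ u)
        Dq-zu = begin
          ℓ (c ∷ z ++ u)                    ≡⟨ RMin-additive J? Rcz Ju ⟩
          ℓ (c ∷ z) + ℓ u                   ≡⟨ cong (ℓ (c ∷ z) +_) a-descent ⟩
          ℓ (c ∷ z) + suc (ℓ (a ∷ u))       ≡⟨ ℕ.+-suc _ _ ⟩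
          suc (ℓ (c ∷ z) + ℓ (a ∷ u))       ≡⟨ cong suc (RMin-additive J? Rcz (Ja ∷ Ju)) ⟨
          suc (ℓ (c ∷ z ++ a ∷ u))          ≡⟨ cong suc (ℓ-cong (≈-trans (++-congʳ u (shifts sh₀)) (≡⇒≈ (++-assoc (c ∷ z) (a ∷ []) u)))) ⟨
          suc (ℓ (q ∷ c ∷ z ++ u))          ∎

      qc≥3 : 3 ≤∞ m q c
      qc≥3 with ≥2-split (λ r → c≢q (sym r))
      ... | inj₁ eq = ⊥-elim (qc≢2 eq)
      ... | inj₂ b = b

      cp≥3 : 3 ≤∞ m c p
      cp≥3 with ≥2-split c≢p
      ... | inj₂ b = b
      ... | inj₁ eq = ⊥-elim (commute-along {c} {p} {q} eq (λ r → qc-finite (trans (m-sym q c) r))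
              (≤∞-sym {3} {q} {c} qc≥3) pq≥3)

      Δ : Triangle p q c
      Δ = triangle pq≥3 qc≥3 cp≥3

      K : Fin n → Set
      K k = (k ≡ p) ⊎ (k ≡ q) ⊎ (k ≡ c)

      K? : ∀ k → Dec (K k)
      K? k = (k ≟ p) ⊎-dec ((k ≟ q) ⊎-dec (k ≟ c))

      pair⊆K : ∀ {k} → Pair p q k → K k
      pair⊆K (inj₁ r) = inj₁ r
      pair⊆K (inj₂ r) = inj₂ (inj₁ r)

      Ky : All K y
      Ky = reverse⁺ (All.map pair⊆K (pair-alt p q L))

      module Bottom (y₂ z′ : Word) (cz≈ : c ∷ z ≈ y₂ ++ z′) (Ky₂ : All K y₂) (Lz′ : LMin K z′) (len : ℓ (c ∷ z) ≡ ℓ y₂ + ℓ z′) where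

        Y : Word
        Y = y ++ c ∷ nf y₂

        v≈Yz′ : v ≈ Y ++ z′
        v≈Yz′ = begin
          v                            ≈⟨ v≈yz ⟩
          y ++ z                       ≈⟨ ++-congˡ y (∷-transpose c cz≈) ⟩
          y ++ c ∷ y₂ ++ z′            ≈⟨ ++-congˡ y (∷-cong c (++-congʳ z′ (nf≈ y₂))) ⟨
          y ++ c ∷ nf y₂ ++ z′         ≡⟨ ++-assoc y (c ∷ nf y₂) z′ ⟨
          Y ++ z′                      ∎
          where open ≈-Reasoning

        Knf : All K (nf y₂)
        Knf = red-in (nf y₂) y₂ (nf-red y₂) (nf≈ y₂) Ky₂

        KY : All K Y
        KY = ++⁺ Ky (inj₂ (inj₂ refl) ∷ Knf)

        length-Y : ℓ v ≡ length Y + ℓ z′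
        length-Y = begin
          ℓ v                                       ≡⟨ ℓv ⟩
          L + ℓ z                                   ≡⟨ cong (L +_) (trans Dc (cong suc len)) ⟩
          L + suc (ℓ y₂ + ℓ z′)                     ≡⟨ ℕ.+-assoc L (suc (ℓ y₂)) (ℓ z′) ⟨
          L + suc (ℓ y₂) + ℓ z′                     ≡⟨ cong (λ h → h + suc (ℓ y₂) + ℓ z′) length-y ⟨
          length y + length (c ∷ nf y₂) + ℓ z′      ≡⟨ cong (_+ ℓ z′) (length-++ y) ⟨
          length Y + ℓ z′                           ∎
          where open ≡-Reasoning

        R-Y : Red Y
        R-Y = ℓ⇒red (ℕ.+-cancelʳ-≡ (ℓ z′) (ℓ Y) (length Y)
          (trans (sym (LMin-additive K? Lz′ KY)) (trans (ℓ-cong (≈-sym v≈Yz′)) length-Y)))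

        occ-c : c ∈ nf Y
        occ-c = occurs-in Y R-Y ≈-refl (∈-++⁺ʳ y (here refl))

        occ-pair : ∀ {k} → k ∈ y → k ∈ nf Y
        occ-pair k∈ = occurs-in Y R-Y ≈-refl (∈-++⁺ˡ k∈)

        p∈y : p ∈ y
        p∈y = subst (p ∈_) (sym (reverse-∷ p (alt q p (suc l)))) (∈-++⁺ʳ _ (here refl))

        q∈y : q ∈ y
        q∈y = subst (q ∈_) (sym (trans (reverse-∷ p (q ∷ alt p q l)) (cong (_++ p ∷ []) (reverse-∷ q (alt p q l)))))
          (∈-++⁺ˡ (∈-++⁺ʳ (reverse (alt p q l)) (here refl)))

        two-shift : ∀ {k k′} → k ≢ k′ → k ∈ nf Y → k′ ∈ nf Y → ShiftJ z′ k ⊎ ShiftJ z′ k′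
        two-shift {k} {k′} k≢k′ k∈ k′∈ with shiftJ? z′ k | shiftJ? z′ k′
        ... | yes s | _ = inj₁ s
        ... | no _ | yes s = inj₂ s
        ... | no ¬s | no ¬s′ = ⊥-elim (one-unshifted K? Y z′ v≈Yz′ KY Lz′ k≢k′ k∈ k′∈ ¬s ¬s′)

        as-shift : ∀ {k} → K k → (s : ShiftJ z′ k) → Shift (proj₁ s) z′ k
        as-shift Kk s = shiftJ⇒ (Lz′ _ Kk) s

        -- The bonds of x to sliding letters are finite, so avoidance excludes that x commutes with
        -- just one of them. If x commutes with neither, both sliding letters are descents of x z′
        -- and `wall-outer` applies there.
        both-commute : ∀ {b b′ x} → K b → K b′ → 3 ≤∞ m b b′ → ShiftJ z′ b → ShiftJ z′ b′ → D x z′ →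
          (m x b ≡ fin 2) × (m x b′ ≡ fin 2)
        both-commute {b} {b′} {x} Kb Kb′ bb′ s s′ dx with ≥2-split (shift-≢ S dx) | ≥2-split (shift-≢ S′ dx)
          where
          S = as-shift Kb s
          S′ = as-shift Kb′ s′
        ... | inj₁ e₁ | inj₁ e₂ = trans (m-sym x b) e₁ , trans (m-sym x b′) e₂
        ... | inj₁ e₁ | inj₂ b₂ = ⊥-elim (commute-along {x} {b} {b′} (trans (m-sym x b) e₁)
              (λ r → shift-finite (as-shift Kb′ s′) dx (trans (m-sym b′ x) r)) (≤∞-sym {3} {b′} {x} b₂) bb′)
        ... | inj₂ b₁ | inj₁ e₂ = ⊥-elim (commute-along {x} {b′} {b} (trans (m-sym x b′) e₂)
              (λ r → shift-finite (as-shift Kb s) dx (trans (m-sym b x) r)) (≤∞-sym {3} {b} {x} b₁) (≤∞-sym {3} {b} {b′} bb′))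
        ... | inj₂ b₁ | inj₂ b₂ = ⊥-elim (wall-outer (triangle bb′ b₂ (≤∞-sym {3} {b} {x} b₁))
              (shift-D₃ b₁ S dx) (shift-D₃ b₂ S′ dx) (Shift-resp (≈-sym (ss-cancel x z′)) S))
          where
          S = as-shift Kb s
          S′ = as-shift Kb′ s′

        commutes-all⇒⊥ : ∀ {x} → D x z′ → m x p ≡ fin 2 → m x q ≡ fin 2 → m x c ≡ fin 2 → ⊥
        commutes-all⇒⊥ {x} dx xp xq xc = c-commutes⇒⊥ Y v≈Yz′ length-Y dx x≢e (All.map comm KY)
          where
          comm : ∀ {k} → K k → m x k ≡ fin 2
          comm (inj₁ refl) = xp
          comm (inj₂ (inj₁ refl)) = xq
          comm (inj₂ (inj₂ refl)) = xc
          x≢e : x ≢ e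
          x≢e refl = Lz′ x (pair⊆K e-pair) dx

        third : ∀ {x b b′} → m x b ≡ fin 2 → 3 ≤∞ m b b′ → m b b′ ≢ ∞ → x ≢ b′ → m x b′ ≡ fin 2
        third {x} {b} {b′} xb bb′ fin-bb′ x≢b′ with ≥2-split x≢b′
        ... | inj₁ eq = eq
        ... | inj₂ xb′ = ⊥-elim (commute-along {b} {x} {b′} (trans (m-sym b x) xb) fin-bb′ bb′ xb′)

        x≢K : ∀ {x k} → D x z′ → K k → x ≢ k
        x≢K dx Kk refl = Lz′ _ Kk dx

        -- p is free from q and c, so the wall of a can only be followed inside ⟨q, c⟩ down to z′.
        free⇒⊥ : m p q ≡ ∞ → m p c ≡ ∞ → ShiftJ z′ q → ShiftJ z′ c → ⊥
        free⇒⊥ pq∞ pc∞ sq sc = finish (proj₁ (finite-split qc-finite)) (proj₂ (finite-split qc-finite))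
          where
          finish : ∀ k → m q c ≡ fin k → ⊥
          finish zero eq with subst (3 ≤∞_) eq qc≥3
          ... | ()
          finish (suc zero) eq with subst (3 ≤∞_) eq qc≥3
          ... | s≤s ()
          finish (suc (suc k)) eq = around (shift-alt sh Dc (suc k) (subst (suc (suc k) ≤∞_) (sym eq) ℕ.≤-refl))
            where
            around : Alt (suc k) c q z → ⊥
            around (z₀ , z≈ , lenz) = RMin-not-shift Rb ¬Db (shift-b (nth-pair c q k))
              where
              sh₀ : Shift a z₀ (nth c q (suc k))
              sh₀ = shift-around (suc k) z₀ eq sh z≈ lenz
              b : Fin n
              b = nth c q k
              z≈b : z ≈ alt c q k ++ b ∷ z₀
              z≈b = ≈-trans z≈ (≡⇒≈ (trans (cong (_++ z₀) (alt-snoc c q k)) (++-assoc (alt c q k) (b ∷ []) z₀)))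
              ¬Db₀ : ¬ D b z₀
              ¬Db₀ = ascent⇒¬D (ℕ.≤-antisym (ℓ-min (∷-cong b (nf≈ z₀))) (ℕ.+-cancelˡ-≤ k _ _ (begin
                k + suc (ℓ z₀)              ≡⟨ ℕ.+-suc k (ℓ z₀) ⟩
                suc k + ℓ z₀                ≡⟨ lenz ⟨
                ℓ z                         ≡⟨ ℓ-cong z≈b ⟩
                ℓ (alt c q k ++ b ∷ z₀)     ≤⟨ ℓ-alt-++ k c q (b ∷ z₀) ⟩
                k + ℓ (b ∷ z₀)              ∎)))
                where open ℕ.≤-Reasoning
              ∞-pair : ∀ {j} → Pair c q j → m j p ≡ ∞
              ∞-pair (inj₁ refl) = trans (m-sym c p) pc∞
              ∞-pair (inj₂ refl) = trans (m-sym q p) pq∞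
              ¬Dp₀ : ¬ D p z₀
              ¬Dp₀ d = shift-finite sh₀ d (∞-pair (nth-pair c q (suc k)))
              ¬Dqc : ∀ {j} → Pair c q j → ¬ D j z₀
              ¬Dqc {j} P with nth-cover c q j k
              ... | inj₁ refl = ¬Db₀
              ... | inj₂ (inj₁ refl) = ascends sh₀
              ... | inj₂ (inj₂ (j≢c , j≢q)) = λ _ → none-of P
                where
                none-of : Pair c q j → ⊥
                none-of (inj₁ r) = j≢c r
                none-of (inj₂ r) = j≢q r
              Lz₀ : LMin K z₀
              Lz₀ j (inj₁ refl) = ¬Dp₀
              Lz₀ j (inj₂ (inj₁ refl)) = ¬Dqc (inj₂ refl)
              Lz₀ j (inj₂ (inj₂ refl)) = ¬Dqc (inj₁ refl)
              Kalt : All K (alt c q (suc k))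
              Kalt = All.map (λ { (inj₁ r) → inj₂ (inj₂ r) ; (inj₂ r) → inj₂ (inj₁ r) }) (pair-alt c q (suc k))
              z₀≈z′ : z₀ ≈ z′
              z₀≈z′ = LMin-unique K? Lz₀ Lz′ Kalt (inj₂ (inj₂ refl) ∷ Ky₂) (≈-trans (≈-sym z≈) (∷-transpose c cz≈))
              ¬Db : ¬ D b z′
              ¬Db d = ¬Db₀ (D-resp (≈-sym z₀≈z′) d)
              Rb : RMin J (b ∷ z′)
              Rb = RMin-resp (∷-cong b z₀≈z′) (RMin-part (y ++ alt c q k)
                (≈-trans v≈yz (≈-trans (++-congˡ y z≈b) (≡⇒≈ (sym (++-assoc y (alt c q k) (b ∷ z₀))))))
                (begin
                  ℓ v                                          ≡⟨ ℓv ⟩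
                  L + ℓ z                                      ≡⟨ cong (L +_) lenz ⟩
                  L + (suc k + ℓ z₀)                           ≡⟨ cong (L +_) (ℕ.+-suc k (ℓ z₀)) ⟨
                  L + (k + suc (ℓ z₀))                         ≡⟨ ℕ.+-assoc L k _ ⟨
                  L + k + suc (ℓ z₀)                           ≡⟨ cong₂ _+_ (cong₂ _+_ length-y (length-alt c q k)) (¬D⇒ascent ¬Db₀) ⟨
                  length y + length (alt c q k) + ℓ (b ∷ z₀)   ≡⟨ cong (_+ ℓ (b ∷ z₀)) (length-++ y) ⟨
                  length (y ++ alt c q k) + ℓ (b ∷ z₀)         ∎))
                where open ≡-Reasoning
              shift-b : Pair c q b → ShiftJ z′ b
              shift-b (inj₁ r) = subst (ShiftJ z′) (sym r) sc
              shift-b (inj₂ r) = subst (ShiftJ z′) (sym r) sq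

        -- At most one of p, q, c does not slide through z′. A descent x of z′ commutes with two
        -- sliding letters and, along a finite bond, with the third, so it would come to the top of
        -- v. Only two infinite bonds at p interrupt this argument.
        z′-empty : z′ ≈ []
        z′-empty = cases (nonempty-D z′)
          where
          finite-or-∞ : ∀ μ → (μ ≢ ∞) ⊎ (μ ≡ ∞)
          finite-or-∞ (fin _) = inj₁ λ ()
          finite-or-∞ ∞ = inj₂ refl
          kp : K p
          kp = inj₁ refl
          kq : K q
          kq = inj₂ (inj₁ refl)
          kc : K c
          kc = inj₂ (inj₂ refl)
          case-pq : ∀ {x} → D x z′ → ShiftJ z′ p → ShiftJ z′ q → ⊥
          case-pq {x} dx sp sq = commutes-all⇒⊥ dx (proj₁ xpq) (proj₂ xpq) (third (proj₂ xpq) qc≥3 qc-finite (x≢K dx kc))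
            where
            xpq : (m x p ≡ fin 2) × (m x q ≡ fin 2)
            xpq = both-commute kp kq pq≥3 sp sq dx
          case-pc : ∀ {x} → D x z′ → ShiftJ z′ p → ShiftJ z′ c → ⊥
          case-pc {x} dx sp sc = commutes-all⇒⊥ dx (proj₁ xpc)
              (third (proj₂ xpc) (≤∞-sym {3} {q} {c} qc≥3) (λ r → qc-finite (trans (m-sym q c) r)) (x≢K dx kq)) (proj₂ xpc)
            where
            xpc : (m x p ≡ fin 2) × (m x c ≡ fin 2)
            xpc = both-commute kp kc (≤∞-sym {3} {c} {p} cp≥3) sp sc dx
          case-qc : ∀ {x} → D x z′ → ShiftJ z′ q → ShiftJ z′ c → ⊥
          case-qc {x} dx sq sc = split (finite-or-∞ (m p q)) (finite-or-∞ (m p c))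
            where
            xqc : (m x q ≡ fin 2) × (m x c ≡ fin 2)
            xqc = both-commute kq kc qc≥3 sq sc dx
            split : (m p q ≢ ∞) ⊎ (m p q ≡ ∞) → (m p c ≢ ∞) ⊎ (m p c ≡ ∞) → ⊥
            split (inj₁ fpq) _ = commutes-all⇒⊥ dx
              (third (proj₁ xqc) (≤∞-sym {3} {p} {q} pq≥3) (λ r → fpq (trans (m-sym p q) r)) (x≢K dx kp)) (proj₁ xqc) (proj₂ xqc)
            split (inj₂ _) (inj₁ fpc) = commutes-all⇒⊥ dx
              (third (proj₂ xqc) cp≥3 (λ r → fpc (trans (m-sym p c) r)) (x≢K dx kp)) (proj₁ xqc) (proj₂ xqc)
            split (inj₂ pq∞) (inj₂ pc∞) = free⇒⊥ pq∞ pc∞ sq sc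
          combine : ∀ {x} → D x z′ → ShiftJ z′ p ⊎ ShiftJ z′ q → ShiftJ z′ q ⊎ ShiftJ z′ c → ShiftJ z′ p ⊎ ShiftJ z′ c → ⊥
          combine dx (inj₁ sp) (inj₁ sq) _ = case-pq dx sp sq
          combine dx (inj₁ sp) (inj₂ sc) _ = case-pc dx sp sc
          combine dx (inj₂ sq) _ (inj₁ sp) = case-pq dx sp sq
          combine dx (inj₂ sq) _ (inj₂ sc) = case-qc dx sq sc
          cases : (z′ ≈ []) ⊎ (∃[ x ] D x z′) → z′ ≈ []
          cases (inj₁ eq) = eq
          cases (inj₂ (x , dx)) = ⊥-elim (combine dx
            (two-shift p≢q (occ-pair p∈y) (occ-pair q∈y))
            (two-shift (λ r → c≢q (sym r)) (occ-pair q∈y) occ-c)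
            (two-shift (λ r → c≢p (sym r)) (occ-pair p∈y) occ-c))

        in-triangle : ∃[ Z ] (z ≈ Z) × All K Z
        in-triangle = c ∷ y₂ , ∷-transpose c (≈-trans cz≈ (≈-trans (++-congˡ y₂ z′-empty) (≡⇒≈ (++-identityʳ y₂)))) ,
          inj₂ (inj₂ refl) ∷ Ky₂

      abstract
        z-in-triangle : ∃[ Z ] (z ≈ Z) × All K Z
        z-in-triangle = bottom (decompose K? (c ∷ z))
          where
          bottom : ∃[ y₂ ] ∃[ z′ ] (c ∷ z ≈ y₂ ++ z′) × All K y₂ × LMin K z′ × (ℓ (c ∷ z) ≡ ℓ y₂ + ℓ z′) →
            ∃[ Z ] (z ≈ Z) × All K Z
          bottom (y₂ , z′ , eq , Ky₂ , L , len) = Bottom.in-triangle y₂ z′ eq Ky₂ L len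

-- Excluding larger bonds and further turns of the wall.

module Walls {n : ℕ} (M : CoxeterMatrix n) where
  open CoxeterMatrix M
  open Coxeter M
  open Words M
  open Decidability M
  open LengthFunction M
  open Parabolic M
  open RankThree M

  cancel₁ : ∀ a s x → a ∷ s ∷ s ∷ x ≈ a ∷ x
  cancel₁ a s x = ∷-cong a (ss-cancel s x)

  cancel₂ : ∀ s t x → s ∷ t ∷ t ∷ s ∷ x ≈ x
  cancel₂ s t x = ≈-trans (cancel₁ s t (s ∷ x)) (ss-cancel s x)

  ≥4⇒≥3 : ∀ {s t} → 4 ≤∞ m s t → 3 ≤∞ m s t
  ≥4⇒≥3 {s} {t} = ≤∞-trans (m s t) (ℕ.n≤1+n 3)

  =3⇒≥3 : ∀ {s t} → m s t ≡ fin 3 → 3 ≤∞ m s t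
  =3⇒≥3 eq = subst (3 ≤∞_) (sym eq) ℕ.≤-refl

  module Long {a p q c : Fin n} {z : Word} (Δ : Triangle p q c) (qc≥4 : 4 ≤∞ m q c) (sh : Shift a z q) (Dc : D c z) where
    pq : 3 ≤∞ m p q
    pq = ab Δ
    qp : 3 ≤∞ m q p
    qp = ≤∞-sym {3} {p} {q} pq
    cp : 3 ≤∞ m c p
    cp = ca Δ
    pc : 3 ≤∞ m p c
    pc = ≤∞-sym {3} {c} {p} cp
    y′ Y : Word
    y′ = q ∷ c ∷ z
    Y = c ∷ y′
    Dc′ : D c y′
    Dc′ = shift-D₄ qc≥4 sh Dc
    pcq : Triangle p c q
    pcq = triangle pc (≤∞-sym {3} {q} {c} (bc Δ)) qp
    qcp : Triangle q c p
    qcp = rotate Δ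

    at-Y : m q c ≡ fin 4 → Shift a Y q
    at-Y eq = around₄ eq sh Dc

    -- Suppose p and c both shorten y′. For m(q,c) at least 5, q is a further descent of c y′, a
    -- spiral. For m(q,c) = 4 the wall of a turns onto `Y`, and p Y has the two descents q and c
    -- beside it.
    ¬Dp : ¬ D p y′
    ¬Dp d = cases (≤∞-split 4 (m q c) qc≥4)
      where
      cases : (m q c ≡ fin 4) ⊎ (5 ≤∞ m q c) → ⊥
      cases (inj₂ b) = no-spiral pcq d Dc′ (shift-D₅ b sh Dc)
      cases (inj₁ eq) = wall-outer qcp
        (shift-D₃ qp (at-Y eq) (D-both₂ (≥3⇒≢ cp) Dc′ d))
        (D-both₃ cp Dc′ d)
        (Shift-resp (≈-sym (ss-cancel p Y)) (at-Y eq))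

    -- Two walls would pass along y′, that of a and that of a′. For bond 4 they are followed in
    -- turn; each step on one wall supplies the descent that lets the other turn, until `wall-outer`
    -- or a spiral stops them.
    no-shift : ∀ {a′} → ¬ Shift a′ y′ p
    no-shift {a′} sh′ = cases (≤∞-split 4 (m q c) qc≥4)
      where
      DpY : D p Y
      DpY = shift-D₃ pc sh′ Dc′
      module Four (eq : m q c ≡ fin 4) where
        cq≥4 : 4 ≤∞ m c q
        cq≥4 = ≤∞-sym {4} {q} {c} qc≥4
        Y₁ Y₂ : Word
        Y₁ = p ∷ Y
        Y₂ = q ∷ Y₁
        DqY₁ : D q Y₁
        DqY₁ = shift-D₃ qp (at-Y eq) DpY
        ¬DcY₁ : ¬ D c Y₁
        ¬DcY₁ d = wall-outer qcp DqY₁ d (Shift-resp (≈-sym (ss-cancel p Y)) (at-Y eq))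
        module Three (eq₃ : m p c ≡ fin 3) where
          sh₁ : Shift a′ Y₁ c
          sh₁ = around₃ eq₃ sh′ Dc′
          DcY₂ : D c Y₂
          DcY₂ = shift-D₃ (≥4⇒≥3 cq≥4) sh₁ DqY₁
          DqcY₂ : D q (c ∷ Y₂)
          DqcY₂ = shift-D₄ cq≥4 sh₁ DqY₁
          last : (m q p ≡ fin 3) ⊎ (4 ≤∞ m q p) → ⊥
          last (inj₂ b) = no-spiral pcq (shift-D₄ b (at-Y eq) DpY) DcY₂ DqcY₂
          last (inj₁ e₃) = wall-outer Δ (shift-D₃ pc sh₂ DcY₂) DqcY₂ (Shift-resp (≈-sym (ss-cancel c Y₂)) sh₂)
            where
            sh₂ : Shift a Y₂ p
            sh₂ = around₃ e₃ (at-Y eq) DpY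
        four : (m p c ≡ fin 3) ⊎ (4 ≤∞ m p c) → ⊥
        four (inj₂ b) = ¬DcY₁ (shift-D₄ b sh′ Dc′)
        four (inj₁ eq₃) = Three.last eq₃ (≤∞-split 3 (m q p) qp)
      cases : (m q c ≡ fin 4) ⊎ (5 ≤∞ m q c) → ⊥
      cases (inj₂ b) = wall-outer Δ DpY (shift-D₅ b sh Dc) (Shift-resp (≈-sym (ss-cancel c y′)) sh′)
      cases (inj₁ eq) = Four.four eq (≤∞-split 3 (m p c) pc)

  module Short {a p q c : Fin n} {z₀ : Word} (Δ : Triangle p q c) (qc₃ : m q c ≡ fin 3) (sh : Shift a z₀ c) (Dp : D p z₀) where
    pq : 3 ≤∞ m p q
    pq = ab Δ
    qp : 3 ≤∞ m q p
    qp = ≤∞-sym {3} {p} {q} pq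
    cp : 3 ≤∞ m c p
    cp = ca Δ
    pc : 3 ≤∞ m p c
    pc = ≤∞-sym {3} {c} {p} cp
    qc : 3 ≤∞ m q c
    qc = bc Δ
    cq : 3 ≤∞ m c q
    cq = ≤∞-sym {3} {q} {c} qc
    cq₃ : m c q ≡ fin 3
    cq₃ = trans (m-sym c q) qc₃
    cqp : Triangle c q p
    cqp = triangle cq qp pc
    qcp : Triangle q c p
    qcp = rotate Δ
    qpc : Triangle q p c
    qpc = flip Δ
    pcq : Triangle p c q
    pcq = triangle pc cq qp
    Y X : Word
    Y = p ∷ z₀
    X = c ∷ Y
    DcY : D c Y
    DcY = shift-D₃ cp sh Dp
    sh-pY : Shift a (p ∷ Y) c
    sh-pY = Shift-resp (≈-sym (ss-cancel p z₀)) sh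

    ¬DqY : ¬ D q Y
    ¬DqY d = wall-outer cqp DcY d sh-pY

    -- Again two walls meet. With m(c,p) = 3 both turn once, and the assumption that m(p,q) is at
    -- least 4 leaves an extra descent q beside the wall of a′.
    no-shift-Y : ∀ {a′} → 4 ≤∞ m p q → ¬ Shift a′ Y q
    no-shift-Y {a′} pq≥4 sh′ = cases (≤∞-split 3 (m c p) cp)
      where
      DqX : D q X
      DqX = shift-D₃ qc sh′ DcY
      cases : (m c p ≡ fin 3) ⊎ (4 ≤∞ m c p) → ⊥
      cases (inj₂ b) = wall-outer qpc DqX (shift-D₄ b sh Dp) (Shift-resp (≈-sym (ss-cancel c Y)) sh′)
      cases (inj₁ eq) = wall-outer cqp (shift-D₃ cp shX′ DpX′) (shift-D₄ pq≥4 shX DqX)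
          (Shift-resp (≈-sym (ss-cancel p X′)) shX′)
        where
        X′ : Word
        X′ = q ∷ X
        shX : Shift a X p
        shX = around₃ eq sh Dp
        shX′ : Shift a′ X′ c
        shX′ = around₃ qc₃ sh′ DcY
        DpX′ : D p X′
        DpX′ = shift-D₃ pq shX DqX

    -- Data for refuting the bond m(c,p) of at least 4. `W₂` is what remains of z under q after
    -- deleting a p; climbing X, `W₁`, `W₂` meets neither a descent nor a slide, so it stays in W^J.
    module Fat (cp≥4 : 4 ≤∞ m c p) where
      pc≥4 : 4 ≤∞ m p c
      pc≥4 = ≤∞-sym {4} {c} {p} cp≥4
      W₁ W₂ : Word
      W₁ = q ∷ X
      W₂ = c ∷ W₁
      DpX : D p X
      DpX = shift-D₄ cp≥4 sh Dp
      ¬DcX : ¬ D c X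
      ¬DcX = ¬D-flip DcY
      ¬DqX : ¬ D q X
      ¬DqX d = wall-far Δ cp≥4 DpX d
        (Shift-resp (≈-sym (≈-trans (cancel₁ p c Y) (ss-cancel p z₀))) sh)
      DqW₁ : D q W₁
      DqW₁ = D-flip ¬DqX
      ¬DcW₁ : ¬ D c W₁
      ¬DcW₁ d = ¬DcX (D-resp (ss-cancel q X) (D-both₂ (≥3⇒≢ qc) DqW₁ d))
      DcW₂ : D c W₂
      DcW₂ = D-flip ¬DcW₁
      ¬DqW₂ : ¬ D q W₂
      ¬DqW₂ d = ¬DcX (D-resp (cancel₂ q c X) (D-both₃ cq DcW₂ d))
      back : ∀ s → s ∷ c ∷ W₂ ≈ s ∷ W₁
      back s = cancel₁ s c W₁
      ¬DpW₂ : ¬ D p W₂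
      ¬DpW₂ d = no-spiral qcp
        (D-both₂ (≥3⇒≢ pq) (D-resp (ss-cancel c W₁) (D-both₂ (≥3⇒≢ cp) DcW₂ d)) DqW₁)
        (D-resp (back p) (D-both₃ cp DcW₂ d))
        (D-resp (∷-cong c (back p)) (D-both₄ cp≥4 DcW₂ d))

      no-shift-X : ∀ {a′} → ¬ Shift a′ X q
      no-shift-X {a′} sh′ = cases (≤∞-split 4 (m c p) cp≥4)
        where
        Z T T′ : Word
        Z = p ∷ X
        T = q ∷ Z
        T′ = c ∷ T
        DqZ : D q Z
        DqZ = shift-D₃ qp sh′ DpX
        module Four (eq : m c p ≡ fin 4) where
          shZ : Shift a Z c
          shZ = around₄ eq sh Dp
          DcT : D c T
          DcT = shift-D₃ cq shZ DqZ
          shT′ : Shift a T′ q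
          shT′ = around₃ cq₃ shZ DqZ
          four : (m q p ≡ fin 3) ⊎ (4 ≤∞ m q p) → ⊥
          four (inj₂ b) = wall-far pcq b (shift-D₄ b sh′ DpX) DcT
            (Shift-resp (≈-sym (cancel₂ p q X)) sh′)
          four (inj₁ e₃) = wall-outer qcp (shift-D₃ qp shT′ DpT′) (shift-D₄ pc≥4 shT DcT)
              (Shift-resp (≈-sym (ss-cancel p T′)) shT′)
            where
            shT : Shift a′ T p
            shT = around₃ e₃ sh′ DpX
            DpT′ : D p T′
            DpT′ = shift-D₃ pc shT DcT
        cases : (m c p ≡ fin 4) ⊎ (5 ≤∞ m c p) → ⊥
        cases (inj₂ b) = wall-outer qcp DqZ (shift-D₅ b sh Dp) (Shift-resp (≈-sym (ss-cancel p X)) sh′)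
        cases (inj₁ eq) = Four.four eq (≤∞-split 3 (m q p) qp)

      no-shift-W₁ : ∀ {a′} → ¬ Shift a′ W₁ c
      no-shift-W₁ sh′ = ¬DcX (D-resp (ss-cancel q X) (shift-D₃ cq sh′ DqW₁))

      shift-W₂-q : ∀ {a′} → Shift a′ W₂ q → Shift a′ X c
      shift-W₂-q sh′ = Shift-resp (cancel₂ q c X) (around₃ qc₃ sh′ DcW₂)

      no-shift-W₂-p : ∀ {a′} → ¬ Shift a′ W₂ p
      no-shift-W₂-p sh′ = wall-far cqp pc≥4 (D-resp (back p) (shift-D₄ pc≥4 sh′ DcW₂))
        (D-both₂ (≥3⇒≢ pq) (D-resp (ss-cancel c W₁) (shift-D₃ pc sh′ DcW₂)) DqW₁)
        (Shift-resp (≈-sym (cancel₁ c p W₁)) sh′)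

  -- Data for refuting a further descent q when m(p,q) is at least 4. `V₁` to `V₄` climb back from
  -- `X′` along the word that braid moves produce after deleting one q; no step meets a descent or a
  -- slide.
  module Long₂ {a p q c : Fin n} {z₁ : Word} (Δ : Triangle p q c) (qc₃ : m q c ≡ fin 3) (cp₃ : m c p ≡ fin 3) (pq≥4 : 4 ≤∞ m p q)
    (sh : Shift a z₁ p) (Dq : D q z₁) where
    pq : 3 ≤∞ m p q
    pq = ab Δ
    qp : 3 ≤∞ m q p
    qp = ≤∞-sym {3} {p} {q} pq
    qp≥4 : 4 ≤∞ m q p
    qp≥4 = ≤∞-sym {4} {p} {q} pq≥4
    cp : 3 ≤∞ m c p
    cp = ca Δ
    pc : 3 ≤∞ m p c
    pc = ≤∞-sym {3} {c} {p} cp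
    qc : 3 ≤∞ m q c
    qc = bc Δ
    cq : 3 ≤∞ m c q
    cq = ≤∞-sym {3} {q} {c} qc
    cq₃ : m c q ≡ fin 3
    cq₃ = trans (m-sym c q) qc₃
    pc₃ : m p c ≡ fin 3
    pc₃ = trans (m-sym p c) cp₃
    qcp : Triangle q c p
    qcp = rotate Δ
    cqp : Triangle c q p
    cqp = triangle cq qp pc
    cpq : Triangle c p q
    cpq = rotate (rotate Δ)
    X X′ V₁ V₂ V₃ V₄ : Word
    X = q ∷ z₁
    X′ = p ∷ X
    V₁ = c ∷ X′
    V₂ = p ∷ V₁
    V₃ = q ∷ V₂
    V₄ = c ∷ V₃
    DpX : D p X
    DpX = shift-D₃ pq sh Dq
    DqX′ : D q X′
    DqX′ = shift-D₄ pq≥4 sh Dq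
    ¬DpX′ : ¬ D p X′
    ¬DpX′ = ¬D-flip DpX
    ¬DcX′ : ¬ D c X′
    ¬DcX′ d = wall-far qcp pq≥4 DqX′ d
      (Shift-resp (≈-sym (≈-trans (cancel₁ q p X) (ss-cancel q z₁))) sh)
    DcV₁ : D c V₁
    DcV₁ = D-flip ¬DcX′
    ¬DpV₁ : ¬ D p V₁
    ¬DpV₁ d = ¬DpX′ (D-resp (ss-cancel c X′) (D-both₂ (≥3⇒≢ cp) DcV₁ d))
    DpV₂ : D p V₂
    DpV₂ = D-flip ¬DpV₁
    no-turn : D q V₁ → D p (q ∷ V₁) → ⊥
    no-turn = no-spiral cqp DcV₁
    ¬DqV₂ : ¬ D q V₂
    ¬DqV₂ d = no-turn (D-resp (ss-cancel p V₁) (D-both₂ (≥3⇒≢ pq) DpV₂ d))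
      (D-resp (cancel₁ q p V₁) (D-both₃ pq DpV₂ d))
    ¬DcV₂ : ¬ D c V₂
    ¬DcV₂ d = ¬DpX′ (D-resp (≈-trans (cancel₁ c p V₁) (ss-cancel c X′)) (D-both₃ pc DpV₂ d))
    DqV₃ : D q V₃
    DqV₃ = D-flip ¬DqV₂
    ¬DcV₃ : ¬ D c V₃
    ¬DcV₃ d = ¬DcV₂ (D-resp (ss-cancel q V₂) (D-both₂ (≥3⇒≢ qc) DqV₃ d))
    ¬DpV₃ : ¬ D p V₃
    ¬DpV₃ d = no-turn
      (D-resp (cancel₂ p q V₁) (D-both₃ qp DqV₃ d))
      (D-resp (∷-cong q (cancel₂ p q V₁)) (D-both₄ qp≥4 DqV₃ d))
    DcV₄ : D c V₄
    DcV₄ = D-flip ¬DcV₃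
    ¬DpV₄ : ¬ D p V₄
    ¬DpV₄ d = ¬DpV₃ (D-resp (ss-cancel c V₃) (D-both₂ (≥3⇒≢ cp) DcV₄ d))
    ¬DqV₄ : ¬ D q V₄
    ¬DqV₄ d = ¬DcV₂ (D-resp (cancel₂ q c V₂) (D-both₃ cq DcV₄ d))

    no-shift-X′ : ∀ {a′} → ¬ Shift a′ X′ c
    no-shift-X′ {a′} sh′ = cases (≤∞-split 4 (m p q) pq≥4)
      where
      T T′ R R′ : Word
      T = q ∷ X′
      T′ = c ∷ T
      R = p ∷ T′
      R′ = q ∷ R
      DcT : D c T
      DcT = shift-D₃ cq sh′ DqX′
      shT′ : Shift a′ T′ q
      shT′ = around₃ cq₃ sh′ DqX′
      cases : (m p q ≡ fin 4) ⊎ (5 ≤∞ m p q) → ⊥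
      cases (inj₂ b) = wall-outer cpq DcT (shift-D₅ b sh Dq) (Shift-resp (≈-sym (ss-cancel q X′)) sh′)
      cases (inj₁ eq) = wall-outer cpq (shift-D₃ cq shR DqR) DpR′ (Shift-resp (≈-sym (ss-cancel q R)) shR)
        where
        shT : Shift a T p
        shT = around₄ eq sh Dq
        DpT′ : D p T′
        DpT′ = shift-D₃ pc shT DcT
        shR : Shift a R c
        shR = around₃ pc₃ shT DcT
        DqR : D q R
        DqR = shift-D₃ qp shT′ DpT′
        DpR′ : D p R′
        DpR′ = shift-D₄ qp≥4 shT′ DpT′

    no-shift-V₁ : ∀ {a′} → ¬ Shift a′ V₁ p
    no-shift-V₁ sh′ = ¬DpX′ (D-resp (ss-cancel c X′) (shift-D₃ pc sh′ DcV₁))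

    no-shift-V₂ : ∀ {a′} → ¬ Shift a′ V₂ q
    no-shift-V₂ sh′ = no-turn (D-resp (ss-cancel p V₁) (shift-D₃ qp sh′ DpV₂))
      (D-resp (cancel₁ q p V₁) (shift-D₄ qp≥4 sh′ DpV₂))

    no-shift-V₃ : ∀ {a′} → ¬ Shift a′ V₃ c
    no-shift-V₃ sh′ = ¬DcV₂ (D-resp (ss-cancel q V₂) (shift-D₃ cq sh′ DqV₃))

    shift-V₄-q : ∀ {a′} → Shift a′ V₄ q → Shift a′ X′ p
    shift-V₄-q sh′ = Shift-resp (cancel₂ c p X′) (around₃ cp₃ (Shift-resp (cancel₂ q c V₂) (around₃ qc₃ sh′ DcV₄)) DpV₂)

    no-shift-V₄-p : ∀ {a′} → ¬ Shift a′ V₄ p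
    no-shift-V₄-p sh′ = ¬DpV₃ (D-resp (ss-cancel c V₃) (shift-D₃ pc sh′ DcV₄))

-- Spiral words in the triangle with all bonds 3.

module Spirals {n : ℕ} (M : CoxeterMatrix n) where
  open CoxeterMatrix M
  open Coxeter M
  open Words M
  open Decidability M
  open LengthFunction M
  open Parabolic M
  open RankThree M
  open Growth M
  open Walls M

  Three : Fin n → Fin n → Fin n → Fin n → Set
  Three r s t k = (k ≡ r) ⊎ (k ≡ s) ⊎ (k ≡ t)

  nth₃ : Fin n → Fin n → Fin n → ℕ → Fin n
  nth₃ x y w zero = x
  nth₃ x y w (suc j) = nth₃ y w x j

  spiral-snoc : ∀ (x y w : Fin n) j → spiral x y w (suc j) ≡ spiral x y w j ++ nth₃ x y w j ∷ []
  spiral-snoc x y w zero = refl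
  spiral-snoc x y w (suc j) = cong (x ∷_) (spiral-snoc y w x j)

  spiral-snoc₂ : ∀ (x y w : Fin n) j →
    spiral x y w (suc (suc j)) ≡ spiral x y w j ++ nth₃ x y w j ∷ nth₃ x y w (suc j) ∷ []
  spiral-snoc₂ x y w zero = refl
  spiral-snoc₂ x y w (suc j) = cong (x ∷_) (spiral-snoc₂ y w x j)

  length-spiral : ∀ (x y w : Fin n) j → length (spiral x y w j) ≡ j
  length-spiral x y w zero = refl
  length-spiral x y w (suc j) = cong suc (length-spiral y w x j)

  record Affine (x y w : Fin n) : Set where
    constructor affine
    field
      xy₃ : m x y ≡ fin 3
      yw₃ : m y w ≡ fin 3
      wx₃ : m w x ≡ fin 3
  open Affine public

  turn : ∀ {x y w} → Affine x y w → Affine y w x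
  turn (affine a b c) = affine b c a

  nth₃-bond : ∀ {x y w} → Affine x y w → ∀ j → m (nth₃ x y w j) (nth₃ x y w (suc j)) ≡ fin 3
  nth₃-bond A zero = xy₃ A
  nth₃-bond A (suc j) = nth₃-bond (turn A) j

  data Rotation (p q c : Fin n) : Fin n → Fin n → Fin n → Set where
    rot₀ : Rotation p q c p q c
    rot₁ : Rotation p q c q c p
    rot₂ : Rotation p q c c p q

  rotation-turn : ∀ {p q c x y w} → Rotation q c p x y w → Rotation p q c x y w
  rotation-turn rot₀ = rot₁
  rotation-turn rot₁ = rot₂
  rotation-turn rot₂ = rot₀

  -- Besides the word, it records which letter would come next and that a is the second letter of
  -- the spiral; this is what lets the recursion extend it at the far end and identify a.
  record SpiralShape (a p q c : Fin n) (z : Word) : Set where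
    field
      {x y w} : Fin n
      k : ℕ
      rotation : Rotation p q c x y w
      shape : reverse z ++ p ∷ q ∷ [] ≈ spiral x y w (double k)
      next₀ : nth₃ x y w (double k) ≡ c
      next₁ : nth₃ y w x (double k) ≡ p
      next₂ : nth₃ w x y (double k) ≡ q
      a≡y : a ≡ y
      size : double k ≡ 2 + ℓ z

  shift-[] : ∀ {a x k} → Shift a x k → x ≈ [] → a ≡ k
  shift-[] {a} {x} {k} (s , _) e = sym (∷-injective-≈ (≈-trans (∷-cong k (≈-sym e)) (≈-trans s (++-congʳ (a ∷ []) e))))

  -- Only c can shorten z. The wall then turns around a vertex of order 3, which peels off c q and
  -- leaves the same situation with (p, q, c) cycled.
  spiral-shape : ∀ f {a p q c} z → ℓ z ≤ f → Affine p q c → (∃[ Z ] (z ≈ Z) × All (Three p q c) Z) →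
    Shift a z q → ¬ D p z → SpiralShape a p q c z
  spiral-shape f {a} {p} {q} {c} z z≤f A (Z , z≈Z , KZ) sh ¬Dp = cases f z≤f (nonempty-D z)
    where
    cases : ∀ f → ℓ z ≤ f → (z ≈ []) ⊎ (∃[ k ] D k z) → SpiralShape a p q c z
    cases f _ (inj₁ e) = record
      { k = 1 ; rotation = rot₀ ; shape = ++-congʳ (p ∷ q ∷ []) (reverse-cong e)
      ; next₀ = refl ; next₁ = refl ; next₂ = refl ; a≡y = shift-[] sh e
      ; size = cong (λ h → suc (suc h)) (sym (trans (ℓ-cong e) ℓ[])) }
    cases f z≤f (inj₂ (i , d)) = which (D-in Z z≈Z KZ d) f z≤f
      where
      which : Three p q c i → ∀ f → ℓ z ≤ f → SpiralShape a p q c z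
      which (inj₁ refl) _ _ = ⊥-elim (¬Dp d)
      which (inj₂ (inj₁ refl)) _ _ = ⊥-elim (ascends sh d)
      which (inj₂ (inj₂ refl)) zero z≤0 = ⊥-elim (ℕ.0≢1+n (trans (sym (ℕ.n≤0⇒n≡0 z≤0)) d))
      which (inj₂ (inj₂ refl)) (suc f) z≤f = extend (spiral-shape f z′ z′≤f (turn A) (q ∷ c ∷ Z , ∷-cong q (∷-cong c z≈Z) , K′)
          (around₃ (yw₃ A) sh d) (¬D-flip dq))
        where
        z′ : Word
        z′ = q ∷ c ∷ z
        dq : D q (c ∷ z)
        dq = shift-D₃ (=3⇒≥3 (yw₃ A)) sh d
        ℓz : ℓ z ≡ 2 + ℓ z′
        ℓz = trans d (cong suc dq)
        z′≤f : ℓ z′ ≤ f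
        z′≤f = ℕ.≤-trans (ℕ.n≤1+n _) (ℕ.≤-pred (subst (_≤ suc f) ℓz z≤f))
        rot : ∀ {k} → Three p q c k → Three q c p k
        rot (inj₁ r) = inj₂ (inj₂ r)
        rot (inj₂ (inj₁ r)) = inj₁ r
        rot (inj₂ (inj₂ r)) = inj₂ (inj₁ r)
        K′ : All (Three q c p) (q ∷ c ∷ Z)
        K′ = inj₁ refl ∷ inj₂ (inj₁ refl) ∷ All.map rot KZ
        rev-z : reverse z ≈ reverse z′ ++ q ∷ c ∷ []
        rev-z = ≈-trans (reverse-cong (≈-sym (cancel₂ c q z)))
          (≡⇒≈ (trans (reverse-∷ c (q ∷ z′)) (trans (cong (_++ c ∷ []) (reverse-∷ q z′)) (++-assoc (reverse z′) (q ∷ []) (c ∷ [])))))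
        extend : SpiralShape a q c p z′ → SpiralShape a p q c z
        extend S = record
          { k = suc k ; rotation = rotation-turn rotation
          ; shape = ≈-trans (++-congʳ (p ∷ q ∷ []) (≈-trans rev-z shape))
              (≡⇒≈ (sym (trans (spiral-snoc₂ x y w (double k)) (cong₂ (λ g h → spiral x y w (double k) ++ g ∷ h ∷ []) next₀ next₁))))
          ; next₀ = next₂ ; next₁ = next₀ ; next₂ = next₁ ; a≡y = a≡y
          ; size = cong (λ h → suc (suc h)) (trans size (sym ℓz)) }
          where open SpiralShape S

  -- The braid move xwx = wxw passes through the spiral two letters at a time and emerges as one
  -- letter at the far end.
  spiral-twist : ∀ {x y w} → Affine x y w → ∀ j →
    x ∷ spiral w x y (double (suc j)) ≈ w ∷ spiral x y w (suc (double j)) ++ nth₃ x y w (double (suc j)) ∷ []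
  spiral-twist {x} {y} {w} A zero = alt-braid {k = 3} (trans (m-sym x w) (wx₃ A)) []
  spiral-twist {x} {y} {w} A (suc j) = ≈-trans
    (alt-braid {k = 3} (trans (m-sym x w) (wx₃ A)) (spiral y w x (double (suc j))))
    (∷-cong w (∷-cong x (spiral-twist (turn (turn A)) j)))

  module Ends {x y w : Fin n} (A : Affine x y w) where
    tip : ℕ → Word
    tip j = reverse (spiral x y w (suc (double j)))

    side : ℕ → Fin n
    side j = nth₃ x y w (double (suc j))

    base : ℕ → Fin n
    base j = nth₃ x y w (suc (double j))

    tip-suc : ∀ j → tip (suc j) ≡ side j ∷ base j ∷ tip j
    tip-suc j = trans (cong reverse (spiral-snoc₂ x y w (suc (double j)))) (reverse-++ (spiral x y w (suc (double j))) (base j ∷ side j ∷ []))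

    bond : ∀ j → m (base j) (side j) ≡ fin 3
    bond j = nth₃-bond A (suc (double j))

    -- A descent or slide of `base j` through the longer tip would turn back around the vertex of
    -- its two top letters into one of `side j` through the shorter tip. By period three,
    -- `side (suc j)` computes to `base j`.
    side-free : ∀ j → Red (tip j) → ¬ D (side j) (tip j) × (∀ a → ¬ Shift a (tip j) (side j))
    side-free zero R = ¬d , λ a s → ¬D[] (D-resp (ss-cancel x []) (shift-D₃ (=3⇒≥3 (wx₃ A)) s (D-red R)))
      where
      ¬d : ¬ D w (x ∷ [])
      ¬d d = ≥3⇒≢ (=3⇒≥3 (wx₃ A)) (D-in {K = _≡ x} (x ∷ []) ≈-refl (refl ∷ []) d)
    side-free (suc j) R = ¬d , ¬s
      where
      R′ : Red (side j ∷ base j ∷ tip j)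
      R′ = subst Red (tip-suc j) R
      IH : ¬ D (side j) (tip j) × (∀ a → ¬ Shift a (tip j) (side j))
      IH = side-free j (red-suffix (side j ∷ base j ∷ []) R′)
      dS : D (side j) (side j ∷ base j ∷ tip j)
      dS = D-red R′
      sb₃ : m (side j) (base j) ≡ fin 3
      sb₃ = trans (m-sym (side j) (base j)) (bond j)
      ¬d : ¬ D (base j) (tip (suc j))
      ¬d d = proj₁ IH (D-resp (cancel₂ (base j) (side j) (tip j))
        (D-both₃ (=3⇒≥3 sb₃) dS (subst (D (base j)) (tip-suc j) d)))
      ¬s : ∀ a → ¬ Shift a (tip (suc j)) (base j)
      ¬s a s = proj₂ IH a (Shift-resp (cancel₂ (base j) (side j) (tip j))
        (around₃ (bond j) (subst (λ h → Shift a h (base j)) (tip-suc j) s) dS))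

-- The three shapes, and the letters of J that shorten u.

module Classification {n : ℕ} (M : CoxeterMatrix n) (avoid : Coxeter.AvoidsT M)
  {J : Fin n → Set} (J? : ∀ a → Dec (J a))
  (u v : Coxeter.Word M) (Ju : All J u) (Rv : Parabolic.RMin M J v)
  (e : Fin n) (De : LengthFunction.D M e v)
  (good : ∀ v′ → Coatoms.Coat M v v′ → LengthFunction.D M e v′ →
    LengthFunction.ℓ M (v′ ++ u) ≢ LengthFunction.ℓ M v′ + LengthFunction.ℓ M u) where
  open CoxeterMatrix M
  open Coxeter M
  open Words M
  open Decidability M
  open LengthFunction M
  open Parabolic M
  open Coatoms M
  open RankThree M
  open Growth M
  open Walls M
  open Spirals M
  open Setting M J? u v Ju Rv e De good
  open Top M avoid J? u v Ju Rv e De good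
  open import Data.List.Membership.Propositional using (_∈_)

  -- The BP property in the form used with lifting: every letter shared by J and v already shortens
  -- u.
  Absorbs : Set
  Absorbs = ∀ k → J k → k ∈ nf v → D k u

  Letters : (Fin n → Set) → Set
  Letters K = ∃[ V ] (v ≈ V) × All K V

  Shape : Set
  Shape = (∃[ p ] ∃[ q ] Letters (Pair p q)) ⊎
    (∃[ r ] ∃[ s ] ∃[ t ] (r ≢ s) × (r ≢ t) × (s ≢ t) × Letters (Three r s t) ×
      (Case1 (reverse v) r s t ⊎ Case2 (reverse v) r s t ⊎ Case3 (reverse v) r s t))

  absorbs : ∀ {K} → Letters K → (∀ k → K k → J k → D k u) → Absorbs
  absorbs (V , v≈V , KV) h k Jk k∈ = h k (occurs-all V v≈V KV k∈) Jk

  end-not-J : ∀ {k x} → RMin J (k ∷ x) → x ≈ [] → ¬ J k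
  end-not-J {k} {x} R x≈[] Jk = ℕ.0≢1+n (trans (sym ℓ[]) (trans
    (ℓ-cong (≈-sym (≈-trans (∷-cong k (++-congʳ (k ∷ []) x≈[])) (ss-cancel k [])))) (R k Jk)))

  single : v ≈ e ∷ [] → Absorbs × Shape
  single v≈e = absorbs L h , inj₁ (e , e , L)
    where
    L : Letters (Pair e e)
    L = e ∷ [] , v≈e , inj₁ refl ∷ []
    ¬Je : ¬ J e
    ¬Je = end-not-J (RMin-resp v≈e Rv) ≈-refl
    h : ∀ k → Pair e e k → J k → D k u
    h k (inj₁ refl) Jk = ⊥-elim (¬Je Jk)
    h k (inj₂ refl) Jk = ⊥-elim (¬Je Jk)

  module Two (H : Head) where
    open AtHead H
    two : z ≈ [] → Absorbs × Shape
    two z≈[] = absorbs Ls h , inj₁ (p , q , Ls)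
      where
      Ls : Letters (Pair p q)
      Ls = reverse (alt p q L) , ≈-trans v≈ (≈-trans (grow-cong p q L z≈[]) (≡⇒≈ (trans (grow≡ p q L []) (++-identityʳ _)))) ,
        reverse⁺ (pair-alt p q L)
      h : ∀ k → Pair p q k → J k → D k u
      h k (inj₁ refl) Jk = ⊥-elim (end-not-J Rpz z≈[] Jk)
      h k (inj₂ refl) Jk = subst (λ b → D b u) (shift-[] sh z≈[]) a-descent

  up : ∀ {k x} → RMin J x → ¬ D k x → (∀ a → ¬ Shift a x k) → RMin J (k ∷ x)
  up {k} {x} R ¬d ¬s = cases (RMin-or-shift J? k R ¬d)
    where
    cases : RMin J (k ∷ x) ⊎ (∃[ a ] J a × (k ∷ x ≈ x ++ a ∷ [])) → RMin J (k ∷ x)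
    cases (inj₁ R′) = R′
    cases (inj₂ (a , _ , s)) = ⊥-elim (¬s a (s , ¬d))

  module SpiralEnd {x y w : Fin n} (A : Affine x y w) (j : ℕ)
    (v≈ : v ≈ reverse (spiral x y w (double (suc (suc j))))) (ℓv : ℓ v ≡ double (suc (suc j))) where
    open Ends A

    S : Word
    S = spiral w x y (double (suc j))

    red-v : Red (spiral x y w (double (suc (suc j))))
    red-v = ℓ⇒red (trans (sym (ℓ-reverse _)) (trans (ℓ-cong (≈-sym v≈)) (trans ℓv (sym (length-spiral x y w _)))))

    red-reverse : ∀ {z} → Red z → Red (reverse z)
    red-reverse {z} R = ℓ⇒red (trans (ℓ-reverse z) (trans (red⇒ℓ R) (sym (length-reverse z))))

    above : Word
    above = nth₃ x y w (suc (suc (suc (double j)))) ∷ nth₃ x y w (suc (suc (double j))) ∷ nth₃ x y w (suc (double j)) ∷ []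

    v≈tip : reverse (spiral x y w (double (suc (suc j)))) ≡ above ++ tip j
    v≈tip = begin
      reverse (spiral x y w (double (suc (suc j))))
        ≡⟨ cong reverse (spiral-snoc₂ x y w (suc (suc (double j)))) ⟩
      reverse (spiral x y w (suc (suc (double j))) ++ b₂ ∷ b₃ ∷ [])
        ≡⟨ reverse-++ (spiral x y w (suc (suc (double j)))) (b₂ ∷ b₃ ∷ []) ⟩
      b₃ ∷ b₂ ∷ reverse (spiral x y w (suc (suc (double j))))
        ≡⟨ cong (λ h → b₃ ∷ b₂ ∷ reverse h) (spiral-snoc x y w (suc (double j))) ⟩
      b₃ ∷ b₂ ∷ reverse (spiral x y w (suc (double j)) ++ b₁ ∷ [])
        ≡⟨ cong (λ h → b₃ ∷ b₂ ∷ h) (reverse-++ (spiral x y w (suc (double j))) (b₁ ∷ [])) ⟩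
      above ++ tip j ∎
      where
      open ≡-Reasoning
      b₁ b₂ b₃ : Fin n
      b₁ = nth₃ x y w (suc (double j))
      b₂ = nth₃ x y w (suc (suc (double j)))
      b₃ = nth₃ x y w (suc (suc (suc (double j))))

    red-tip : Red (tip j)
    red-tip = red-suffix above (subst Red v≈tip (red-reverse red-v))

    ℓ-tip : ℓ (tip j) ≡ suc (double j)
    ℓ-tip = trans (red⇒ℓ red-tip) (trans (length-reverse (spiral x y w (suc (double j)))) (length-spiral x y w _))

    R-tip : RMin J (tip j)
    R-tip = RMin-part above (≈-trans v≈ (≡⇒≈ v≈tip)) (trans ℓv (cong (λ h → suc (suc (suc h))) (sym ℓ-tip)))

    R-side : RMin J (side j ∷ tip j)
    R-side = up R-tip (proj₁ (side-free j red-tip)) (proj₂ (side-free j red-tip))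

    v′ : Word
    v′ = reverse (x ∷ S)

    -- Deleting the second letter y of the spiral leaves x w x at its start; the twist moves one
    -- letter w to the side of J.
    v′≈ : v′ ≈ (side j ∷ tip j) ++ w ∷ []
    v′≈ = ≈-trans (reverse-cong (spiral-twist A j)) (≡⇒≈ (trans (reverse-∷ w (spiral x y w (suc (double j)) ++ side j ∷ []))
      (cong (_++ w ∷ []) (reverse-++ (spiral x y w (suc (double j))) (side j ∷ [])))))

    ¬Jx : ¬ J x
    ¬Jx = end-not-J (RMin-part (reverse (spiral y w x (suc (double (suc j)))))
      (≈-trans v≈ (≡⇒≈ (reverse-∷ x (spiral y w x (suc (double (suc j)))))))
      (trans ℓv (sym (trans (cong₂ _+_ (trans (length-reverse (spiral y w x (suc (double (suc j))))) (length-spiral y w x _)) (ℓ-singleton x)) (ℕ.+-comm _ 1))))) ≈-refl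

    module Descent (Jw : J w) where
      ℓv′ : ℓ v′ ≡ suc (suc (suc (double j)))
      ℓv′ = trans (ℓ-cong v′≈) (trans (R-side w Jw) (cong suc (trans (¬D⇒ascent (proj₁ (side-free j red-tip))) (cong suc ℓ-tip))))

      coat : Coat v v′
      coat = reverse S , y , x ∷ [] ,
        ≈-trans v≈ (≡⇒≈ (trans (reverse-∷ x (y ∷ S)) (trans (cong (_++ x ∷ []) (reverse-∷ y S)) (++-assoc (reverse S) (y ∷ []) (x ∷ []))))) ,
        ≡⇒≈ (reverse-∷ x S) , trans ℓv (cong suc (sym ℓv′))

      f : Fin n
      f = nth₃ w x y (suc (double j))

      starts : ∀ P → reverse (P ++ S) ≡ f ∷ reverse (P ++ spiral w x y (suc (double j)))
      starts P = trans (cong (λ h → reverse (P ++ h)) (spiral-snoc w x y (suc (double j))))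
        (trans (cong reverse (sym (++-assoc P (spiral w x y (suc (double j))) (f ∷ [])))) (reverse-++ (P ++ spiral w x y (suc (double j))) (f ∷ [])))

      f≡e : f ≡ e
      f≡e = top-unique (D-resp (≈-trans (≡⇒≈ (sym (starts (x ∷ y ∷ [])))) (≈-sym v≈)) (D-red (subst Red (starts (x ∷ y ∷ [])) (red-reverse red-v))))

      De′ : D e v′
      De′ = subst (λ h → D h v′) f≡e (subst (D f) (sym (starts (x ∷ [])))
        (D-red (subst Red (starts (x ∷ [])) (ℓ⇒red (trans ℓv′ (sym (trans (length-reverse (x ∷ S)) (cong suc (length-spiral w x y _)))))))))

      -- Before its final w, the coatom v′ is a tip with a free side letter and hence in W^J, so w
      -- cannot lengthen u.
      descent : D w u
      descent = coat-shift-descent coat De′ v′≈ R-side Jw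

  module Large (H : Head) {c : Fin n} (Dc : D c (Head.z H)) where
    open AtHead H
    open Below Dc

    qp-bound : suc L ≤∞ m q p
    qp-bound = ≤∞-sym {suc L} {p} {q} bound

    -- A letter deleted inside z pays off when the remainder can be written q x: this q joins d and
    -- makes an alternating word of length L + 1.
    deletion : ∀ w₁ b w₂ x → z ≈ w₁ ++ b ∷ w₂ → w₁ ++ w₂ ≈ q ∷ x → ¬ D p x → ¬ D q x → ℓ z ≡ 2 + ℓ x →
      Coat v (grow q p (suc L) x) × D e (grow q p (suc L) x)
    deletion w₁ b w₂ x z≈ qx≈ ¬p ¬q len =
      coat-grow p q L w₁ b w₂ (≈-trans v≈ (grow-cong p q L z≈)) (grow-cong p q L (≈-sym qx≈))
        (begin
          ℓ v                             ≡⟨ ℓv ⟩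
          L + ℓ z                         ≡⟨ cong (L +_) len ⟩
          L + (2 + ℓ x)                   ≡⟨ ℕ.+-suc L (suc (ℓ x)) ⟩
          suc (L + suc (ℓ x))             ≡⟨ cong suc (ℕ.+-suc L (ℓ x)) ⟩
          suc (suc L + ℓ x)               ≡⟨ cong suc (ℓ-grow (suc L) q≢p ¬q ¬p qp-bound) ⟨
          suc (ℓ (grow q p (suc L) x))    ∎) ,
      subst (λ h → D h (grow q p (suc L) x)) (sym e≡) (grow-D L q≢p ¬q ¬p qp-bound)
      where open ≡-Reasoning

    z₀ : Word
    z₀ = q ∷ c ∷ z

    Dqcz : D q (c ∷ z)
    Dqcz = shift-D₃ qc≥3 sh Dc

    ℓz : ℓ z ≡ 2 + ℓ z₀
    ℓz = trans Dc (cong suc Dqcz)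

    ¬Dqz₀ : ¬ D q z₀
    ¬Dqz₀ = ¬D-flip Dqcz

    Rcz : RMin J (c ∷ z)
    Rcz = RMin-∷ c Rz Dc

    Rz₀ : RMin J z₀
    Rz₀ = RMin-∷ q Rcz Dqcz

    Rqz₀ : RMin J (q ∷ z₀)
    Rqz₀ = RMin-resp (≈-sym (ss-cancel q (c ∷ z))) Rcz

    z≈z₀ : z ≈ c ∷ q ∷ z₀
    z≈z₀ = ≈-sym (cancel₂ c q z)

    drop-c : ¬ D p z₀ → Coat v (grow q p (suc L) z₀) × D e (grow q p (suc L) z₀)
    drop-c ¬p = deletion [] c (c ∷ z) z₀ (≈-sym (ss-cancel c z)) (≈-sym (ss-cancel q (c ∷ z))) ¬p ¬Dqz₀ ℓz

    drop-c-shift : ¬ D p z₀ → (m p q ≡ fin (suc L)) × ShiftJ z₀ p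
    drop-c-shift ¬p = grow-coat-min {p} {q} {suc L} {z₀} (proj₁ (drop-c ¬p)) (proj₂ (drop-c ¬p)) ≈-refl Rz₀ p≢q ¬p ¬Dqz₀ bound Rqz₀

    -- After deleting c, p would have to slide through z₀, which `Long` excludes for a larger bond.
    qc₃ : m q c ≡ fin 3
    qc₃ = cases (≤∞-split 3 (m q c) qc≥3)
      where
      cases : (m q c ≡ fin 3) ⊎ (4 ≤∞ m q c) → m q c ≡ fin 3
      cases (inj₁ eq) = eq
      cases (inj₂ b) = ⊥-elim (Long.no-shift Δ b sh Dc (shiftJ⇒ ¬p (proj₂ (drop-c-shift ¬p))))
        where
        ¬p : ¬ D p z₀
        ¬p = Long.¬Dp Δ b sh Dc

    sh₀ : Shift a z₀ c
    sh₀ = around₃ qc₃ sh Dc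

    Z : Word
    Z = proj₁ z-in-triangle

    z≈Z : z ≈ Z
    z≈Z = proj₁ (proj₂ z-in-triangle)

    KZ : All (Three p q c) Z
    KZ = proj₂ (proj₂ z-in-triangle)

    letters : Letters (Three p q c)
    letters = y ++ Z , ≈-trans v≈yz (++-congˡ y z≈Z) , ++⁺ Ky KZ

    letters-cpq : Letters (Three c p q)
    letters-cpq = proj₁ letters , proj₁ (proj₂ letters) , All.map to (proj₂ (proj₂ letters))
      where
      to : ∀ {k} → Three p q c k → Three c p q k
      to (inj₁ r) = inj₂ (inj₁ r)
      to (inj₂ (inj₁ r)) = inj₂ (inj₂ r)
      to (inj₂ (inj₂ r)) = inj₁ r

    cq₃ : m c q ≡ fin 3
    cq₃ = trans (m-sym c q) qc₃

    reverse-word : ∀ x → z ≈ x → reverse v ≈ reverse x ++ alt p q L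
    reverse-word x z≈x = ≈-trans (reverse-cong (≈-trans v≈yz (++-congˡ y z≈x)))
      (≡⇒≈ (trans (reverse-++ y x) (cong (reverse x ++_) (reverse-involutive (alt p q L)))))

    case-one : z₀ ≈ [] → Absorbs × Shape
    case-one z₀≈[] = absorbs letters h , inj₂ (c , p , q , c≢p , c≢q , p≢q , letters-cpq ,
        inj₁ (cq₃ , cp≥3 , suc L , pqL , s≤s (s≤s (s≤s z≤n)) , reverse-word (c ∷ q ∷ []) (≈-trans z≈z₀ (∷-cong c (∷-cong q z₀≈[])))))
      where
      ¬p : ¬ D p z₀
      ¬p d = ¬D[] (D-resp z₀≈[] d)
      pqL : m p q ≡ fin (suc L)
      pqL = proj₁ (drop-c-shift ¬p)
      sp : ShiftJ z₀ p
      sp = proj₂ (drop-c-shift ¬p)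
      Dp-u : D (proj₁ sp) u
      Dp-u = coat-shift-descent (proj₁ (drop-c ¬p)) (proj₂ (drop-c ¬p))
        -- Since L + 1 = m(p,q), the alternating word can be restarted with p at the bottom; this p
        -- slides through z₀ and becomes the letter of J at the right end.
        (≈-trans (grow-braid (trans (m-sym q p) pqL) z₀) (≈-trans (grow-cong q p L (proj₂ (proj₂ sp)))
          (≡⇒≈ (sym (grow-++ q p L z₀ (proj₁ sp ∷ []))))))
        (grow-RMin-short {p} {q} {L} {z₀} Rz₀ p≢q ¬p ¬Dqz₀ Rqz₀ bound) (proj₁ (proj₂ sp))
      h : ∀ k → Three p q c k → J k → D k u
      h k (inj₁ refl) _ = subst (λ b → D b u) (shift-[] (shiftJ⇒ ¬p sp) z₀≈[]) Dp-u
      h k (inj₂ (inj₁ refl)) Jk = ⊥-elim (end-not-J Rqz₀ z₀≈[] Jk)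
      h k (inj₂ (inj₂ refl)) _ = subst (λ b → D b u) (shift-[] sh₀ z₀≈[]) a-descent

    module Deep (Dp : D p z₀) where
      module Sh = Short Δ qc₃ sh₀ Dp
      open Sh using (Y; X; DcY)

      RY : RMin J Y
      RY = RMin-∷ p Rz₀ Dp

      RX : RMin J X
      RX = RMin-∷ c RY DcY

      RcX : RMin J (c ∷ X)
      RcX = RMin-resp (≈-sym (ss-cancel c Y)) RY

      ¬DcX : ¬ D c X
      ¬DcX = ¬D-flip DcY

      ℓzX : ℓ z ≡ 4 + ℓ X
      ℓzX = trans ℓz (cong (λ h → suc (suc h)) (trans Dp (cong suc DcY)))

      z≈Y : z ≈ c ∷ q ∷ p ∷ Y
      z≈Y = ≈-trans z≈z₀ (∷-cong c (∷-cong q (≈-sym (ss-cancel p z₀))))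

      z≈X : z ≈ c ∷ q ∷ p ∷ c ∷ X
      z≈X = ≈-trans z≈Y (∷-cong c (∷-cong q (∷-cong p (≈-sym (ss-cancel c Y)))))

      -- If the bond were larger, deleting c would leave an alternating word of L + 2 letters on
      -- `Y`, with p at its bottom. That coatom would force q to slide through `Y`, which `Short`
      -- excludes once m(p,q) is at least 4.
      pqL : m p q ≡ fin (suc L)
      pqL = cases (≤∞-split (suc L) (m p q) bound)
        where
        cases : (m p q ≡ fin (suc L)) ⊎ (suc (suc L) ≤∞ m p q) → m p q ≡ fin (suc L)
        cases (inj₁ eq) = eq
        cases (inj₂ b) = ⊥-elim (Sh.no-shift-Y (≤∞-trans (m p q) (s≤s (s≤s (s≤s (s≤s z≤n)))) b) (shiftJ⇒ Sh.¬DqY (proj₂ result)))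
          where
          open ≡-Reasoning
          ¬DpY : ¬ D p Y
          ¬DpY = ¬D-flip Dp
          v′ : Word
          v′ = grow p q (suc (suc L)) Y
          v′≈ : v′ ≈ grow p q L (c ∷ z)
          v′≈ = grow-cong p q L (≈-trans (∷-cong q (ss-cancel p z₀)) (ss-cancel q (c ∷ z)))
          ℓv′ : ℓ v′ ≡ suc (suc L) + ℓ Y
          ℓv′ = ℓ-grow (suc (suc L)) p≢q ¬DpY Sh.¬DqY b
          coat : Coat v v′
          coat = coat-grow p q L [] c (c ∷ z) (≈-trans v≈ (grow-cong p q L (≈-sym (ss-cancel c z)))) v′≈ (begin
            ℓ v                        ≡⟨ ℓv ⟩
            L + ℓ z                    ≡⟨ cong (L +_) (trans ℓz (cong (λ h → suc (suc h)) Dp)) ⟩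
            L + (3 + ℓ Y)              ≡⟨ ℕ.+-assoc L 3 (ℓ Y) ⟨
            L + 3 + ℓ Y                ≡⟨ cong (_+ ℓ Y) (ℕ.+-comm L 3) ⟩
            suc (suc (suc L) + ℓ Y)    ≡⟨ cong suc ℓv′ ⟨
            suc (ℓ v′)                 ∎)
          De′ : D e v′
          De′ = subst (λ h → D h v′) (sym e≡) (grow-D (suc L) p≢q ¬DpY Sh.¬DqY b)
          result : (m q p ≡ fin (suc (suc L))) × ShiftJ Y q
          result = grow-coat-min {q} {p} {suc (suc L)} {Y} coat De′ ≈-refl RY q≢p Sh.¬DqY ¬DpY
            (≤∞-sym {suc (suc L)} {p} {q} b) (RMin-resp (≈-sym (ss-cancel p z₀)) Rz₀)

      -- For a larger bond, delete p in z = c q p c X; the braid c q c = q c q turns the rest into q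
      -- `W₂`. A slide of q through `W₂` would give one of c through X, although c X is in W^J, and
      -- `Fat` excludes a slide of p.
      cp₃ : m c p ≡ fin 3
      cp₃ = cases (≤∞-split 3 (m c p) cp≥3)
        where
        cases : (m c p ≡ fin 3) ⊎ (4 ≤∞ m c p) → m c p ≡ fin 3
        cases (inj₁ eq) = eq
        cases (inj₂ b) = ⊥-elim (split (RMin-or-shift J? q RW₂ F.¬DqW₂))
          where
          module F = Sh.Fat b
          open F using (W₁; W₂)
          RW₁ : RMin J W₁
          RW₁ = up RX F.¬DqX (λ _ → F.no-shift-X)
          RW₂ : RMin J W₂
          RW₂ = up RW₁ F.¬DcW₁ (λ _ → F.no-shift-W₁)
          del : Coat v (grow q p (suc L) W₂) × D e (grow q p (suc L) W₂)
          del = deletion (c ∷ q ∷ []) p Y W₂ z≈Y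
            (≈-trans (∷-cong c (∷-cong q (≈-sym (ss-cancel c Y)))) (alt-braid {k = 3} cq₃ X))
            F.¬DpW₂ F.¬DqW₂ (trans ℓzX (cong (λ h → suc (suc h)) (sym
              (trans (¬D⇒ascent F.¬DcW₁) (cong suc (¬D⇒ascent F.¬DqX))))))
          split : RMin J (q ∷ W₂) ⊎ (∃[ a′ ] J a′ × (q ∷ W₂ ≈ W₂ ++ a′ ∷ [])) → ⊥
          split (inj₂ s) = RMin-not-shift RcX ¬DcX (proj₁ s , proj₁ (proj₂ s) , shifts (F.shift-W₂-q (shiftJ⇒ F.¬DqW₂ s)))
          split (inj₁ Rq) = F.no-shift-W₂-p (shiftJ⇒ F.¬DpW₂ (proj₂
            (grow-coat-min {p} {q} {suc L} {W₂} (proj₁ del) (proj₂ del) ≈-refl RW₂ p≢q F.¬DpW₂ F.¬DqW₂ bound Rq)))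

      sh₁ : Shift a X p
      sh₁ = around₃ cp₃ sh₀ Dp

      -- Delete the q that would follow c q p c in z. The braids p c p = c p c and c q c = q c q
      -- bring the rest to q `V₄`. A slide of q would go back to one of p through X′, although p X′
      -- is in W^J, and `Long₂` excludes a slide of p.
      no-deeper : 4 ≤∞ m p q → ¬ D q X
      no-deeper pq≥4 Dq = split (RMin-or-shift J? q RV₄ T.¬DqV₄)
        where
        module T = Long₂ Δ qc₃ cp₃ pq≥4 sh₁ Dq
        open T using (X′; V₁; V₂; V₃; V₄)
        RqX : RMin J (q ∷ X)
        RqX = RMin-∷ q RX Dq
        RX′ : RMin J X′
        RX′ = RMin-∷ p RqX T.DpX
        RV₁ : RMin J V₁
        RV₁ = up RX′ T.¬DcX′ (λ _ → T.no-shift-X′)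
        RV₂ : RMin J V₂
        RV₂ = up RV₁ T.¬DpV₁ (λ _ → T.no-shift-V₁)
        RV₃ : RMin J V₃
        RV₃ = up RV₂ T.¬DqV₂ (λ _ → T.no-shift-V₂)
        RV₄ : RMin J V₄
        RV₄ = up RV₃ T.¬DcV₃ (λ _ → T.no-shift-V₃)
        ℓV₄ : ℓ V₄ ≡ 4 + ℓ X′
        ℓV₄ = trans (¬D⇒ascent T.¬DcV₃) (cong suc (trans (¬D⇒ascent T.¬DqV₂) (cong suc
          (trans (¬D⇒ascent T.¬DpV₁) (cong suc (¬D⇒ascent T.¬DcX′))))))
        del : Coat v (grow q p (suc L) V₄) × D e (grow q p (suc L) V₄)
        del = deletion (c ∷ q ∷ p ∷ c ∷ []) q (q ∷ X) V₄
          (≈-trans z≈X (∷-cong c (∷-cong q (∷-cong p (∷-cong c (≈-sym (ss-cancel q X)))))))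
          (≈-trans (∷-cong c (∷-cong q (≈-trans (∷-cong p (∷-cong c (≈-sym (ss-cancel p (q ∷ X)))))
              (alt-braid {k = 3} (trans (m-sym p c) cp₃) X′))))
            (alt-braid {k = 3} cq₃ (p ∷ c ∷ X′)))
          T.¬DpV₄ T.¬DqV₄ (trans ℓzX (trans (cong (4 +_) (trans Dq (cong suc T.DpX))) (cong (2 +_) (sym ℓV₄))))
        split : RMin J (q ∷ V₄) ⊎ (∃[ a′ ] J a′ × (q ∷ V₄ ≈ V₄ ++ a′ ∷ [])) → ⊥
        split (inj₂ s) = RMin-not-shift (RMin-resp (≈-sym (ss-cancel p (q ∷ X))) RqX) T.¬DpX′
          (proj₁ s , proj₁ (proj₂ s) , shifts (T.shift-V₄-q (shiftJ⇒ T.¬DqV₄ s)))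
        split (inj₁ Rq) = T.no-shift-V₄-p (shiftJ⇒ T.¬DpV₄ (proj₂
          (grow-coat-min {p} {q} {suc L} {V₄} (proj₁ del) (proj₂ del) ≈-refl RV₄ p≢q T.¬DpV₄ T.¬DqV₄ bound Rq)))

      case-two : 4 ≤∞ m p q → X ≈ [] → Absorbs × Shape
      case-two pq≥4 X≈[] = absorbs letters h , inj₂ (c , p , q , c≢p , c≢q , p≢q , letters-cpq ,
          inj₂ (inj₁ (cp₃ , cq₃ , suc L , pqL , subst (4 ≤∞_) pqL pq≥4 ,
            reverse-word (c ∷ q ∷ p ∷ c ∷ []) (≈-trans z≈X (∷-cong c (∷-cong q (∷-cong p (∷-cong c X≈[])))))))) 
        where
        cq-word : Word
        cq-word = c ∷ q ∷ X
        cq≈ : cq-word ≈ c ∷ q ∷ []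
        cq≈ = ∷-cong c (∷-cong q X≈[])
        ℓcq : ℓ cq-word ≡ 2
        ℓcq = trans (ℓ-cong cq≈) (ℓ-alt 2 c≢q (m-off c q c≢q))
        D-c : D c cq-word
        D-c = D-resp (≈-sym cq≈) (D-red (ℓ⇒red (ℓ-alt 2 c≢q (m-off c q c≢q))))
        ¬q-word : ¬ D q cq-word
        ¬q-word d = ¬D[] (D-resp (≈-trans (cancel₂ q c X) X≈[]) (D-both₃ (≤∞-sym {3} {q} {c} qc≥3) D-c d))
        ¬p-word : ¬ D p cq-word
        ¬p-word d with D-in {K = Pair c q} (c ∷ q ∷ []) cq≈ (inj₁ refl ∷ inj₂ refl ∷ []) d
        ... | inj₁ r = c≢p (sym r)
        ... | inj₂ r = p≢q r
        del : Coat v (grow q p (suc L) cq-word) × D e (grow q p (suc L) cq-word)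
        del = deletion (c ∷ q ∷ []) p Y cq-word z≈Y
          (≈-trans (∷-cong c (∷-cong q (≈-sym (ss-cancel c Y)))) (alt-braid {k = 3} cq₃ X))
          ¬p-word ¬q-word (trans ℓzX (trans (cong (4 +_) (trans (ℓ-cong X≈[]) ℓ[])) (cong (2 +_) (sym ℓcq))))
        Rc : RMin J (c ∷ [])
        Rc = RMin-resp (∷-cong c X≈[]) RcX
        only-c : ∀ {k} → k ≢ c → ¬ D k (c ∷ [])
        only-c k≢c d = k≢c (D-in {K = _≡ c} (c ∷ []) ≈-refl (refl ∷ []) d)
        D-cc : D c (c ∷ [])
        D-cc = D-red (ℓ⇒red (ℓ-singleton c))
        ¬q₁ : ¬ D q (c ∷ [])
        ¬q₁ = only-c (λ r → c≢q (sym r))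
        ¬p₁ : ¬ D p (c ∷ [])
        ¬p₁ = only-c (λ r → c≢p (sym r))
        no-shift-q : ∀ b → ¬ Shift b (c ∷ []) q
        no-shift-q b s = ¬D[] (D-resp (ss-cancel c []) (shift-D₃ qc≥3 s D-cc))
        no-shift-p : ¬ ShiftJ (c ∷ []) p
        no-shift-p s = ¬D[] (D-resp (ss-cancel c []) (shift-D₃ (≤∞-sym {3} {c} {p} cp≥3) (shiftJ⇒ ¬p₁ s) D-cc))
        h : ∀ k → Three p q c k → J k → D k u
        h k (inj₁ refl) _ = subst (λ b → D b u) (shift-[] sh₁ X≈[]) a-descent
        -- After deleting p, the word ends in c q. The part before q is in W^J because p does not
        -- slide through c, so the final q must shorten u.
        h k (inj₂ (inj₁ refl)) Jk = coat-shift-descent (proj₁ del) (proj₂ del)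
          (≈-trans (grow-cong q p (suc L) cq≈) (≡⇒≈ (sym (grow-++ q p (suc L) (c ∷ []) (q ∷ [])))))
          (grow-RMin-unshifted {p} {q} {suc L} {c ∷ []} Rc p≢q ¬p₁ ¬q₁ (up Rc ¬q₁ no-shift-q) no-shift-p) Jk
        h k (inj₂ (inj₂ refl)) Jk = ⊥-elim (end-not-J RcX X≈[] Jk)

      -- The strict bound on d leaves L = 2, so the alternating top is itself the end of the spiral.
      case-three : m p q ≡ fin 3 → Absorbs × Shape
      case-three pq₃ = conclude (spiral-shape (ℓ z) z ℕ.≤-refl A (Z , z≈Z , KZ) sh ¬Dp)
        where
        A : Affine p q c
        A = affine pq₃ qc₃ cp₃
        L≡2 : L ≡ 2
        L≡2 = ℕ.suc-injective (fin-injective (trans (sym pqL) pq₃))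
          where
          fin-injective : ∀ {i j} → fin i ≡ fin j → i ≡ j
          fin-injective refl = refl
        v≈qpz : v ≈ q ∷ p ∷ z
        v≈qpz = subst (λ h → v ≈ grow p q h z) L≡2 v≈
        ℓv₂ : ℓ v ≡ 2 + ℓ z
        ℓv₂ = trans ℓv (cong (_+ ℓ z) L≡2)
        rev-v : reverse v ≈ reverse z ++ p ∷ q ∷ []
        rev-v = ≈-trans (reverse-cong v≈qpz) (≡⇒≈ (trans (reverse-∷ q (p ∷ z)) (trans (cong (_++ q ∷ []) (reverse-∷ p z)) (++-assoc (reverse z) (p ∷ []) (q ∷ [])))))
        double≡ : ∀ i → double i ≡ i + i
        double≡ zero = refl
        double≡ (suc i) = cong suc (trans (cong suc (double≡ i)) (sym (ℕ.+-suc i i)))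
        rotated : ∀ {x y w} → Rotation p q c x y w → Affine x y w
        rotated rot₀ = A
        rotated rot₁ = turn A
        rotated rot₂ = turn (turn A)
        covers : ∀ {x y w k} → Rotation p q c x y w → Three p q c k → Three w x y k
        covers rot₀ (inj₁ r) = inj₂ (inj₁ r)
        covers rot₀ (inj₂ (inj₁ r)) = inj₂ (inj₂ r)
        covers rot₀ (inj₂ (inj₂ r)) = inj₁ r
        covers rot₁ (inj₁ r) = inj₁ r
        covers rot₁ (inj₂ (inj₁ r)) = inj₂ (inj₁ r)
        covers rot₁ (inj₂ (inj₂ r)) = inj₂ (inj₂ r)
        covers rot₂ (inj₁ r) = inj₂ (inj₂ r)
        covers rot₂ (inj₂ (inj₁ r)) = inj₁ r
        covers rot₂ (inj₂ (inj₂ r)) = inj₂ (inj₁ r)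
        conclude : SpiralShape a p q c z → Absorbs × Shape
        conclude S = absorbs Ls (h k refl) , inj₂ (w , x , y₁ , ≥3⇒≢ (=3⇒≥3 (wx₃ Ax)) , (λ r → ≥3⇒≢ (=3⇒≥3 (yw₃ Ax)) (sym r)) ,
            ≥3⇒≢ (=3⇒≥3 (xy₃ Ax)) , Ls ,
            inj₂ (inj₂ (wx₃ Ax , trans (m-sym w y₁) (yw₃ Ax) , xy₃ Ax , k , subst (λ i → reverse v ≈ spiral x y₁ w i) (double≡ k) rev-v′)))
          where
          open SpiralShape S renaming (y to y₁)
          Ax : Affine x y₁ w
          Ax = rotated rotation
          rev-v′ : reverse v ≈ spiral x y₁ w (double k)
          rev-v′ = ≈-trans rev-v shape
          Ls : Letters (Three w x y₁)
          Ls = proj₁ letters , proj₁ (proj₂ letters) , All.map (covers rotation) (proj₂ (proj₂ letters))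
          v≈rev : ∀ i → k ≡ i → v ≈ reverse (spiral x y₁ w (double i))
          v≈rev i refl = ≈-trans (≡⇒≈ (sym (reverse-involutive v))) (reverse-cong rev-v′)
          h : ∀ i → k ≡ i → ∀ b → Three w x y₁ b → J b → D b u
          -- Spirals of length 0 or 2 would give z negative or zero length, whereas c shortens z.
          h zero eq _ _ _ = ⊥-elim (ℕ.0≢1+n (trans (cong double (sym eq)) size))
          h (suc zero) eq _ _ _ = ⊥-elim (ℕ.0≢1+n (trans (ℕ.suc-injective (ℕ.suc-injective (trans (cong double (sym eq)) size))) Dc))
          h (suc (suc i)) eq b (inj₁ refl) Jb = SpiralEnd.Descent.descent Ax i (v≈rev (suc (suc i)) eq) (trans ℓv₂ (trans (sym size) (cong double eq))) Jb
          h (suc (suc i)) eq b (inj₂ (inj₁ refl)) Jb = ⊥-elim (SpiralEnd.¬Jx Ax i (v≈rev (suc (suc i)) eq) (trans ℓv₂ (trans (sym size) (cong double eq))) Jb)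
          h (suc (suc i)) eq b (inj₂ (inj₂ refl)) Jb = subst (λ b → D b u) a≡y a-descent

      deep : Absorbs × Shape
      deep = cases (≤∞-split 3 (m p q) pq≥3)
        where
        cases : (m p q ≡ fin 3) ⊎ (4 ≤∞ m p q) → Absorbs × Shape
        cases (inj₁ pq₃) = case-three pq₃
        cases (inj₂ pq≥4) = bottom (nonempty-D X)
          where
          which : ∀ {k} → Three p q c k → D k X → ⊥
          which (inj₁ refl) d = ascends sh₁ d
          which (inj₂ (inj₁ refl)) d = no-deeper pq≥4 d
          which (inj₂ (inj₂ refl)) d = ¬DcX d
          bottom : (X ≈ []) ⊎ (∃[ k ] D k X) → Absorbs × Shape
          bottom (inj₁ X≈[]) = case-two pq≥4 X≈[]
          bottom (inj₂ (k , d)) = ⊥-elim (which (D-in (c ∷ p ∷ q ∷ c ∷ Z)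
            (∷-cong c (∷-cong p (∷-cong q (∷-cong c z≈Z))))
            (inj₂ (inj₂ refl) ∷ inj₁ refl ∷ inj₂ (inj₁ refl) ∷ inj₂ (inj₂ refl) ∷ KZ) d) d)

    large : Absorbs × Shape
    large = cases (nonempty-D z₀)
      where
      which : ∀ {k} → Three p q c k → D k z₀ → Absorbs × Shape
      which (inj₁ refl) d = Deep.deep d
      which (inj₂ (inj₁ refl)) d = ⊥-elim (¬Dqz₀ d)
      which (inj₂ (inj₂ refl)) d = ⊥-elim (ascends sh₀ d)
      cases : (z₀ ≈ []) ⊎ (∃[ k ] D k z₀) → Absorbs × Shape
      cases (inj₁ z₀≈[]) = case-one z₀≈[]
      cases (inj₂ (k , d)) = which (D-in (q ∷ c ∷ Z) (∷-cong q (∷-cong c z≈Z))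
        (inj₂ (inj₁ refl) ∷ inj₂ (inj₂ refl) ∷ KZ) d) d

  abstract
    classify : Absorbs × Shape
    classify = start head
      where
      below : ∀ H → (Head.z H ≈ []) ⊎ (∃[ k ] D k (Head.z H)) → Absorbs × Shape
      below H (inj₁ z≈[]) = Two.two H z≈[]
      below H (inj₂ (_ , Dc)) = Large.large H Dc
      start : (v ≈ e ∷ []) ⊎ Head → Absorbs × Shape
      start (inj₁ v≈e) = single v≈e
      start (inj₂ H) = below H (nonempty-D (Head.z H))

-- Counting subsets and lists.

import Data.List.Membership.Propositional as List
import Data.List.Membership.Propositional.Properties as List
open import Data.Fin.Subset using (Subset; _∈_; ∣_∣)
open import Data.Fin.Subset.Properties using (_∈?_; p⊆q⇒∣p∣≤∣q∣)

module Pigeonhole where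

  any-split : ∀ {A : Set} {P : A → Set} {L} → Any P L → ∃[ a ] ∃[ y ] ∃[ b ] (L ≡ a ++ y ∷ b) × P y
  any-split (here {x} {xs} p) = [] , x , xs , refl , p
  any-split (there {x} h) with any-split h
  ... | a , y , b , e , p = x ∷ a , y , b , cong (x ∷_) e , p

  any-remove : ∀ {A : Set} {P : A → Set} a {y b} → Any P (a ++ y ∷ b) → ¬ P y → Any P (a ++ b)
  any-remove [] (here p) ¬p = ⊥-elim (¬p p)
  any-remove [] (there h) ¬p = h
  any-remove (x ∷ a) (here p) ¬p = here p
  any-remove (x ∷ a) (there h) ¬p = there (any-remove a h ¬p)

  -- A target serves only one class of `_~_`, so once used it can be removed without depriving the
  -- remaining elements.
  pigeonhole : ∀ {A B : Set} {R : A → B → Set} {_~_ : A → A → Set} →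
    (∀ {x x′ y} → R x y → R x′ y → x ~ x′) →
    ∀ {L L′} → AllPairs (λ x x′ → ¬ x ~ x′) L → All (λ x → Any (R x) L′) L → length L ≤ length L′
  pigeonhole inj [] [] = z≤n
  pigeonhole {R = R} inj {x ∷ L} {L′} (d ∷ ds) (h ∷ hs) with any-split h
  ... | a , y , b , refl , r = subst (suc (length L) ≤_)
    (sym (trans (length-++ a) (trans (ℕ.+-suc (length a) (length b)) (cong suc (sym (length-++ a))))))
    (s≤s (pigeonhole {R = R} inj ds (All.zipWith (λ { (¬e , k) → any-remove a k (λ r′ → ¬e (inj r r′)) }) (d , hs))))

module Elements where
  open import Data.Fin using (zero; suc)
  open import Data.Vec using ([]; _∷_; here; there)

  elements : ∀ {n} → Subset n → List (Fin n)
  elements [] = []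
  elements (true ∷ A) = zero ∷ map suc (elements A)
  elements (false ∷ A) = map suc (elements A)

  length-elements : ∀ {n} (A : Subset n) → length (elements A) ≡ ∣ A ∣
  length-elements [] = refl
  length-elements (true ∷ A) = cong suc (trans (length-map suc (elements A)) (length-elements A))
  length-elements (false ∷ A) = trans (length-map suc (elements A)) (length-elements A)

  ∈⇒elements : ∀ {n} {A : Subset n} {s} → s ∈ A → s List.∈ elements A
  ∈⇒elements {A = true ∷ A} {zero} h = here refl
  ∈⇒elements {A = false ∷ A} {zero} ()
  ∈⇒elements {A = true ∷ A} {suc s} (there h) = there (List.∈-map⁺ suc (∈⇒elements h))
  ∈⇒elements {A = false ∷ A} {suc s} (there h) = List.∈-map⁺ suc (∈⇒elements h)

  elements-∈ : ∀ {n} (A : Subset n) → All (_∈ A) (elements A)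
  elements-∈ [] = []
  elements-∈ (true ∷ A) = here ∷ map⁺ (All.map there (elements-∈ A))
  elements-∈ (false ∷ A) = map⁺ (All.map there (elements-∈ A))

  elements-unique : ∀ {n} (A : Subset n) → AllPairs _≢_ (elements A)
  elements-unique [] = []
  elements-unique (true ∷ A) = map⁺ (All.map (λ _ ()) (elements-∈ A)) ∷
    AllPairs.map⁺ (AllPairs.map (λ ne e → ne (suc-injective e)) (elements-unique A))
  elements-unique (false ∷ A) = AllPairs.map⁺ (AllPairs.map (λ ne e → ne (suc-injective e)) (elements-unique A))

  card-≤ : ∀ {n} (A : Subset n) (L : List (Fin n)) → (∀ {s} → s ∈ A → s List.∈ L) → ∣ A ∣ ≤ length L
  card-≤ A L sub = subst (_≤ length L) (length-elements A)
    (Pigeonhole.pigeonhole {R = _≡_} (λ e e′ → trans e (sym e′)) (elements-unique A) (All.map sub (elements-∈ A)))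

-- From palindromicity to the theorem.

module Assembly {n : ℕ} (M : CoxeterMatrix n) (w : Coxeter.Word M) (pal : Coxeter.Palindromic M 2 w)
  (J : Subset n) (u v : Coxeter.Word M) (G : Coxeter.GrassmannianFact M J w u v) where
  open Coxeter M
  open Words M
  open Decidability M
  open LengthFunction M
  open Parabolic M
  open Coatoms M
  open Bruhat M
  open RankThree M
  open Growth M
  open Spirals M
  open Elements
  open Pigeonhole

  decomposition : ParabolicDecomp J w u v
  decomposition = proj₁ G

  w≈ : w ≈ u ++ v
  w≈ = proj₁ decomposition

  u-in : InParabolic J u
  u-in = proj₁ (proj₂ decomposition)

  ℓw : ℓ w ≡ ℓ u + ℓ v
  ℓw = proj₂ (proj₂ (proj₂ decomposition)) (ℓ w) (ℓ u) (ℓ v) (len w) (len u) (len v)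

  A : Subset n
  A = proj₁ (proj₂ (proj₂ G))

  supp-w : SuppIs w A
  supp-w = proj₁ (proj₂ (proj₂ (proj₂ G)))

  ∣A∣ : ∣ A ∣ ≡ ∣ J ∣ + 1
  ∣A∣ = proj₂ (proj₂ (proj₂ (proj₂ G)))

  supp-u : SuppIs u J
  supp-u = proj₁ (proj₂ G)

  InJ : Fin n → Set
  InJ a = a ∈ J

  J? : ∀ a → Dec (InJ a)
  J? a = a ∈? J

  -- The given spelling of u may use letters outside J; the inverse is therefore built from the
  -- J-word supplied by `u-in`.
  uʳ vʳ wʳ : Word
  uʳ = reverse (proj₁ u-in)
  vʳ = reverse v
  wʳ = vʳ ++ uʳ

  uʳ≈ : uʳ ≈ reverse u
  uʳ≈ = reverse-cong (proj₁ (proj₂ u-in))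

  Ju : All InJ uʳ
  Ju = reverse⁺ (proj₂ (proj₂ u-in))

  wʳ≈ : wʳ ≈ reverse w
  wʳ≈ = ≈-trans (++-congˡ vʳ uʳ≈) (≈-trans (≡⇒≈ (sym (reverse-++ u v))) (reverse-cong (≈-sym w≈)))

  ℓuʳ : ℓ uʳ ≡ ℓ u
  ℓuʳ = trans (ℓ-cong uʳ≈) (ℓ-reverse u)

  Rv : RMin InJ vʳ
  Rv = LMin⇒RMin (subst (LMin InJ) (sym (reverse-involutive v)) λ a Ja d → ℕ.<⇒≱ (ℕ.≤-reflexive (sym d))
    (proj₁ (proj₂ (proj₂ decomposition)) (a ∷ []) (a ∷ [] , ≈-refl , Ja ∷ []) (ℓ v) (ℓ (a ∷ v)) (len v) (len (a ∷ v))))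

  -- With v trivial, w = u would have support J, one element too small.
  v≉[] : ¬ vʳ ≈ []
  v≉[] e = ℕ.1+n≰n (subst (_≤ ∣ J ∣) (trans ∣A∣ (ℕ.+-comm ∣ J ∣ 1))
    (p⊆q⇒∣p∣≤∣q∣ (λ {s} s∈A → proj₂ (supp-u s) (≤B-respʳ w≈u (proj₁ (supp-w s) s∈A)))))
    where
    w≈u : w ≈ u
    w≈u = ≈-trans w≈ (≈-trans (++-congˡ u (subst (_≈ []) (reverse-involutive v) (reverse-cong e))) (≡⇒≈ (++-identityʳ u)))

  first-letter : ∃[ e ] D e vʳ
  first-letter = pick (nonempty-D vʳ)
    where
    pick : (vʳ ≈ []) ⊎ (∃[ e ] D e vʳ) → ∃[ e ] D e vʳ
    pick (inj₁ e) = ⊥-elim (v≉[] e)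
    pick (inj₂ d) = d

  e : Fin n
  e = proj₁ first-letter

  De : D e vʳ
  De = proj₂ first-letter

  ℓwʳ : ℓ wʳ ≡ ℓ vʳ + ℓ uʳ
  ℓwʳ = RMin-additive J? Rv Ju

  coat⇒≤B : ∀ {y} → Coat wʳ y → (reverse y ≤B w) × Len (reverse y) (ℓ w ∸ 1)
  coat⇒≤B {y} (a , b , c , e₁ , e₂ , eq) =
    ≤B-delete (reverse c) b (reverse a) w≈′ (≈-trans (reverse-cong e₂) (≡⇒≈ (reverse-++ a c)))
      (ℕ.≤-reflexive (trans (cong suc (ℓ-reverse y)) (sym ℓ-y))) ,
    subst (Len (reverse y)) (trans (ℓ-reverse y) (sym (cong (_∸ 1) ℓ-y))) (len (reverse y))
    where
    ℓ-y : ℓ w ≡ suc (ℓ y)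
    ℓ-y = trans (sym (ℓ-reverse w)) (trans (ℓ-cong (≈-sym wʳ≈)) eq)
    w≈′ : w ≈ reverse c ++ b ∷ reverse a
    w≈′ = ≈-trans (≡⇒≈ (sym (reverse-involutive w))) (≈-trans (reverse-cong (≈-sym wʳ≈))
      (≈-trans (reverse-cong e₁) (≡⇒≈ (reverse-delete a b c))))

  occurs-reverse : ∀ {x k} x′ → x′ ≈ reverse x → k List.∈ nf x → k List.∈ nf x′
  occurs-reverse {x} x′ x′≈ k∈ = occurs-in (reverse (nf x))
    (ℓ⇒red (trans (ℓ-reverse (nf x)) (trans (ℓ-cong (nf≈ x)) (sym (length-reverse (nf x))))))
    (≈-trans (reverse-cong (nf≈ x)) (≈-sym x′≈)) (∈-reverse k∈)

  ∅? : (k : Fin n) → Dec ⊥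
  ∅? _ = no (λ ())

  -- The instance of `coatoms` with no letters imposed on the right, which bounds the coatoms of u
  -- below by its support.
  u-coatoms : ∃[ L ] (length L ≡ ∣ J ∣) × Independent ∅? uʳ L
  u-coatoms = coatoms ∅? ∣ J ∣ (elements J) (length-elements J) uʳ (λ _ ()) (elements-unique J)
    (All.map (λ {t} t∈J → occurs-reverse uʳ uʳ≈ (supp⇒∈nf (proj₁ (supp-u t) t∈J)) , λ ()) (elements-∈ J))

  -- |pred(u)| coatoms u′v, the coatom u v⁻, and one more u v′ would exceed |supp(w)| = |supp(u)| + 1.
  good : ∀ v′ → Coat vʳ v′ → D e v′ → ℓ (v′ ++ uʳ) ≢ ℓ v′ + ℓ uʳ
  good v′ cv@(a , b , c , e₁ , e₂ , eq) De′ additive = contradict u-coatoms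
    (pal (ℓ w) (len w) 1 (s≤s (s≤s z≤n)) w≥1)
    where
    w≥1 : 1 ≤ ℓ w
    w≥1 = subst (1 ≤_) (sym (trans (sym (ℓ-reverse w)) (trans (ℓ-cong (≈-sym wʳ≈)) (trans ℓwʳ (cong (_+ ℓ uʳ) De))))) (s≤s z≤n)

    Rv⁻ : RMin InJ (e ∷ vʳ)
    Rv⁻ = RMin-∷ e Rv De

    coat-top : Coat wʳ (e ∷ vʳ ++ uʳ)
    coat-top = [] , e , e ∷ vʳ ++ uʳ , ≈-sym (ss-cancel e wʳ) , ≈-refl ,
      trans ℓwʳ (trans (cong (_+ ℓ uʳ) De) (cong suc (sym (RMin-additive J? Rv⁻ Ju))))

    coat-v′ : Coat wʳ (v′ ++ uʳ)
    coat-v′ = a , b , c ++ uʳ , ≈-trans (++-congʳ uʳ e₁) (≡⇒≈ (++-assoc a (b ∷ c) uʳ)) ,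
      ≈-trans (++-congʳ uʳ e₂) (≡⇒≈ (++-assoc a c uʳ)) ,
      trans ℓwʳ (trans (cong (_+ ℓ uʳ) eq) (cong suc (sym additive)))

    module _ {x : Word} (cx : Coat uʳ x) where
      private
        inside : ∃[ X ] (x ≈ X) × All InJ X
        inside = coat-in uʳ ≈-refl Ju cx
        X : Word
        X = proj₁ inside
        x≈X : x ≈ X
        x≈X = proj₁ (proj₂ inside)
        JX : All InJ X
        JX = proj₂ (proj₂ inside)

      coat-u : Coat wʳ (vʳ ++ x)
      coat-u = vʳ ++ proj₁ cx , proj₁ (proj₂ cx) , proj₁ (proj₂ (proj₂ cx)) ,
        ≈-trans (++-congˡ vʳ (proj₁ (proj₂ (proj₂ (proj₂ cx))))) (≡⇒≈ (sym (++-assoc vʳ _ _))) ,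
        ≈-trans (++-congˡ vʳ (proj₁ (proj₂ (proj₂ (proj₂ (proj₂ cx)))))) (≡⇒≈ (sym (++-assoc vʳ _ _))) ,
        (begin
          ℓ wʳ                   ≡⟨ ℓwʳ ⟩
          ℓ vʳ + ℓ uʳ            ≡⟨ cong (ℓ vʳ +_) (proj₂ (proj₂ (proj₂ (proj₂ (proj₂ cx))))) ⟩
          ℓ vʳ + suc (ℓ x)       ≡⟨ ℕ.+-suc (ℓ vʳ) (ℓ x) ⟩
          suc (ℓ vʳ + ℓ x)       ≡⟨ cong (λ h → suc (ℓ vʳ + h)) (ℓ-cong x≈X) ⟩
          suc (ℓ vʳ + ℓ X)       ≡⟨ cong suc (RMin-additive J? Rv JX) ⟨
          suc (ℓ (vʳ ++ X))      ≡⟨ cong suc (ℓ-cong (++-congˡ vʳ (≈-sym x≈X))) ⟩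
          suc (ℓ (vʳ ++ x))      ∎)
        where open ≡-Reasoning

      top≉u : ¬ e ∷ vʳ ++ uʳ ≈ vʳ ++ x
      top≉u h = ℕ.1+n≢n (trans (sym De) (ℓ-cong (≈-sym (RMin-unique J? Rv⁻ Rv Ju JX (≈-trans h (++-congˡ vʳ x≈X))))))

      -- Equality would put v′ into the coset of vʳ under W_J, whose minimal element is longer than
      -- v′.
      v′≉u : ¬ v′ ++ uʳ ≈ vʳ ++ x
      v′≉u h = ℕ.1+n≰n (begin
        suc (ℓ v′)                       ≡⟨ eq ⟨
        ℓ vʳ                             ≤⟨ ℕ.m≤m+n (ℓ vʳ) _ ⟩
        ℓ vʳ + ℓ (X ++ reverse uʳ)       ≡⟨ RMin-additive J? Rv (++⁺ JX (reverse⁺ Ju)) ⟨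
        ℓ (vʳ ++ X ++ reverse uʳ)        ≡⟨ ℓ-cong v′≈ ⟨
        ℓ v′                             ∎)
        where
        open ℕ.≤-Reasoning
        v′≈ : v′ ≈ vʳ ++ X ++ reverse uʳ
        v′≈ = ≈-trans (++-transposeʳ uʳ (≈-trans h (++-congˡ vʳ x≈X))) (≡⇒≈ (++-assoc vʳ X (reverse uʳ)))

    v′≉top : ¬ v′ ++ uʳ ≈ e ∷ vʳ ++ uʳ
    v′≉top h = ¬D-flip De (D-resp (++-cancelʳ uʳ h) De′)

    reverse-≉ : ∀ {x y} → ¬ x ≈ y → ¬ reverse x ≈ reverse y
    reverse-≉ {x} {y} ¬e h = ¬e (subst₂ _≈_ (reverse-involutive x) (reverse-involutive y) (reverse-cong h))

    contradict : ∃[ L ] (length L ≡ ∣ J ∣) × Independent ∅? uʳ L → ¬ (∃[ c ] Coeff w 1 c × Coeff w (ℓ w ∸ 1) c)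
    contradict (L , lenL , pairs , coats) (c , (L₁ , len₁ , pairs₁ , atoms , _) , (L₂ , len₂ , _ , _ , exhaust)) =
      ℕ.1+n≰n (begin
        suc (suc ∣ J ∣)         ≡⟨ cong (λ h → suc (suc h)) (trans (length-map reverse (map (vʳ ++_) L)) (trans (length-map (vʳ ++_) L) lenL)) ⟨
        length L*               ≤⟨ pigeonhole {R = _≈_} {_~_ = _≈_} (λ p q → ≈-trans p (≈-sym q)) pairs* (All.map cover coats*) ⟩
        length L₂               ≡⟨ trans len₂ (sym len₁) ⟩
        length L₁               ≤⟨ pigeonhole {R = λ x s → x ≈ s ∷ []} {_~_ = _≈_} (λ p q → ≈-trans p (≈-sym q)) pairs₁ (All.map atom atoms) ⟩
        length (elements A)     ≡⟨ trans (length-elements A) (trans ∣A∣ (ℕ.+-comm ∣ J ∣ 1)) ⟩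
        suc ∣ J ∣               ∎)
      where
      open ℕ.≤-Reasoning
      L₀ L* : List Word
      L₀ = (v′ ++ uʳ) ∷ (e ∷ vʳ ++ uʳ) ∷ map (vʳ ++_) L
      L* = map reverse L₀
      pairs₀ : AllPairs (λ x y → ¬ x ≈ y) L₀
      pairs₀ = (v′≉top ∷ map⁺ (All.map (λ c → v′≉u (proj₁ c)) coats)) ∷
        map⁺ (All.map (λ c → top≉u (proj₁ c)) coats) ∷
        AllPairs.map⁺ (AllPairs.map (λ ¬h h → ¬h (++-cancel vʳ h)) pairs)
      pairs* : AllPairs (λ x y → ¬ x ≈ y) L*
      pairs* = AllPairs.map⁺ (AllPairs.map (λ {x} {y} → reverse-≉ {x} {y}) pairs₀)
      coats₀ : All (Coat wʳ) L₀
      coats₀ = coat-v′ ∷ coat-top ∷ map⁺ (All.map (λ c → coat-u (proj₁ c)) coats)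
      coats* : All (λ x → (x ≤B w) × Len x (ℓ w ∸ 1)) L*
      coats* = map⁺ (All.map (λ {x} → coat⇒≤B {x}) coats₀)
      cover : ∀ {x} → (x ≤B w) × Len x (ℓ w ∸ 1) → Any (x ≈_) L₂
      cover {x} (x≤w , lx) = exhaust x x≤w lx
      atom : ∀ {x} → (x ≤B w) × Len x 1 → Any (λ s → x ≈ s ∷ []) (elements A)
      atom {x} (x≤w , (s ∷ [] , s≈x , _ , _)) = Any.map (λ { refl → ≈-sym s≈x })
        (∈⇒elements (proj₂ (supp-w s) (≤B-respˡ (≈-sym s≈x) x≤w)))

  module _ (avoid : AvoidsT) where
    open Classification M avoid J? uʳ vʳ Ju Rv e De good

    absorb : ∀ k → InJ k → k List.∈ nf v → ℓ (u ++ k ∷ []) < ℓ u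
    absorb k Jk k∈ = ℕ.≤-reflexive (begin
      suc (ℓ (u ++ k ∷ []))        ≡⟨ cong suc (ℓ-snoc u k) ⟩
      suc (ℓ (k ∷ reverse u))      ≡⟨ cong suc (ℓ-cong (∷-cong k uʳ≈)) ⟨
      suc (ℓ (k ∷ uʳ))             ≡⟨ proj₁ classify k Jk (occurs-reverse vʳ ≈-refl k∈) ⟨
      ℓ uʳ                         ≡⟨ ℓuʳ ⟩
      ℓ u                          ∎)
      where open ≡-Reasoning

    below : ∀ y → y ≤B w → InParabolic J y → y ≤B u
    below y y≤w (Y , Y≈y , JY) = below-in-parabolic w≈
      (red-in (nf u) (proj₁ u-in) (nf-red u) (≈-trans (nf≈ u) (≈-sym (proj₁ (proj₂ u-in)))) (proj₂ (proj₂ u-in)))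
      absorb Y y≤w Y≈y JY

    u≤w : u ≤B w
    u≤w = ≤B-respˡ (≈-trans (≡⇒≈ (reverse-involutive (nf u))) (nf≈ u))
      (≤B-respʳ (≈-trans (≡⇒≈ rev) (≈-trans (++-cong (nf≈ u) (nf≈ v)) (≈-sym w≈)))
        (subword⇒≤B (⊑-++ (reverse (nf v)) (reverse (nf u))) (subst Red (sym rev)
          (ℓ⇒red (trans (ℓ-cong (≈-trans (++-cong (nf≈ u) (nf≈ v)) (≈-sym w≈))) (trans ℓw (sym (length-++ (nf u)))))))))
      where
      ⊑-++ : ∀ x y → y ⊑ x ++ y
      ⊑-++ [] y = ⊑-refl y
      ⊑-++ (s ∷ x) y = skip s (⊑-++ x y)
      rev : reverse (reverse (nf v) ++ reverse (nf u)) ≡ nf u ++ nf v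
      rev = trans (cong reverse (sym (reverse-++ (nf u) (nf v)))) (reverse-involutive (nf u ++ nf v))

    bp-decomposition : BPDecomp J w u v
    bp-decomposition = decomposition ,
      (u≤w , u-in , λ y y≤w y-in u≤y → ≤B-antisym (below y y≤w y-in) (≤B-ℓ u≤y)) ,
      -- Every element of W_J below w is below u, so another maximal one must be u itself.
      λ x (x≤w , x-in , maximal) → ≈-sym (maximal u u≤w u-in (below x x≤w x-in))

    supp-in : ∀ {K : Fin n → Set} {B} → SuppIs v B → Letters K → ∀ {s} → s ∈ B → K s
    supp-in S (V , v≈V , KV) {s} s∈B = occurs-all V v≈V KV (occurs-reverse vʳ ≈-refl (supp⇒∈nf (proj₁ (S s) s∈B)))

    pair-card : ∀ {p q} B → (∀ {s} → s ∈ B → Pair p q s) → ∣ B ∣ ≤ 2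
    pair-card {p} {q} B sub = card-≤ B (p ∷ q ∷ []) λ h → place (sub h)
      where
      place : ∀ {s} → Pair p q s → s List.∈ p ∷ q ∷ []
      place (inj₁ r) = here r
      place (inj₂ r) = there (here r)

    three-card : ∀ {p q c} B → (∀ {s} → s ∈ B → Three p q c s) → ∣ B ∣ ≤ 3
    three-card {p} {q} {c} B sub = card-≤ B (p ∷ q ∷ c ∷ []) λ h → place (sub h)
      where
      place : ∀ {s} → Three p q c s → s List.∈ p ∷ q ∷ c ∷ []
      place (inj₁ r) = here r
      place (inj₂ (inj₁ r)) = there (here r)
      place (inj₂ (inj₂ r)) = there (there (here r))

    -- Without p, the set would consist of at most two letters.
    full : ∀ {p q c} B → ∣ B ∣ ≡ 3 → (∀ {s} → s ∈ B → Three p q c s) → p ∈ B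
    full {p} {q} {c} B card sub with p ∈? B
    ... | yes h = h
    ... | no p∉B = ⊥-elim (ℕ.1+n≰n (subst (_≤ 2) card (pair-card {q} {c} B λ h → rest h (sub h))))
      where
      rest : ∀ {s} → s ∈ B → Three p q c s → Pair q c s
      rest h (inj₁ refl) = ⊥-elim (p∉B h)
      rest h (inj₂ r) = r

    supp-card : ∀ B → SuppIs v B → ∣ B ∣ ≤ 3
    supp-card B S = bound (proj₂ classify)
      where
      bound : Shape → ∣ B ∣ ≤ 3
      bound (inj₁ (p , q , Ls)) = ℕ.m≤n⇒m≤1+n (pair-card B (supp-in S Ls))
      bound (inj₂ (r , s , t , _ , _ , _ , Ls , _)) = three-card B (supp-in S Ls)

    supp-three : ∀ B → SuppIs v B → ∣ B ∣ ≡ 3 →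
      ∃[ r ] ∃[ s ] ∃[ t ] (r ≢ s) × (r ≢ t) × (s ≢ t) × (r ∈ B) × (s ∈ B) × (t ∈ B) ×
        (Case1 v r s t ⊎ Case2 v r s t ⊎ Case3 v r s t)
    supp-three B S card = name (proj₂ classify)
      where
      name : Shape → ∃[ r ] ∃[ s ] ∃[ t ] (r ≢ s) × (r ≢ t) × (s ≢ t) × (r ∈ B) × (s ∈ B) × (t ∈ B) ×
        (Case1 v r s t ⊎ Case2 v r s t ⊎ Case3 v r s t)
      name (inj₁ (p , q , Ls)) = ⊥-elim (ℕ.1+n≰n (subst (_≤ 2) card (pair-card B (supp-in S Ls))))
      name (inj₂ (r , s , t , r≢s , r≢t , s≢t , Ls , shape)) = r , s , t , r≢s , r≢t , s≢t ,
        full B card sub , full B card (λ h → turn₁ (sub h)) , full B card (λ h → turn₂ (sub h)) ,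
        subst (λ x → Case1 x r s t ⊎ Case2 x r s t ⊎ Case3 x r s t) (reverse-involutive v) shape
        where
        sub : ∀ {k} → k ∈ B → Three r s t k
        sub = supp-in S Ls
        turn₁ : ∀ {k} → Three r s t k → Three s t r k
        turn₁ (inj₁ h) = inj₂ (inj₂ h)
        turn₁ (inj₂ (inj₁ h)) = inj₁ h
        turn₁ (inj₂ (inj₂ h)) = inj₂ (inj₁ h)
        turn₂ : ∀ {k} → Three r s t k → Three t r s k
        turn₂ (inj₁ h) = inj₂ (inj₁ h)
        turn₂ (inj₂ (inj₁ h)) = inj₂ (inj₂ h)
        turn₂ (inj₂ (inj₂ h)) = inj₁ h

theorem3p1 : ∀ {n} (M : CoxeterMatrix n) → let open Coxeter M in
    AvoidsT → ∀ (w : Word) → Palindromic 2 w →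
    ∀ (J : Subset n) (u v : Word) → GrassmannianFact J w u v →
    BPDecomp J w u v ×
    (∀ A → SuppIs v A → ∣ A ∣ ≤ 3) ×
    (∀ A → SuppIs v A → ∣ A ∣ ≡ 3 →
      ∃[ r ] ∃[ s ] ∃[ t ] (r ≢ s) × (r ≢ t) × (s ≢ t) × (r ∈ A) × (s ∈ A) × (t ∈ A) ×
        (Case1 v r s t ⊎ Case2 v r s t ⊎ Case3 v r s t))
theorem3p1 M avoid w pal J u v G = bp-decomposition avoid , supp-card avoid , supp-three avoid
  where open Assembly M w pal J u v G
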